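{- For all positive integers $t$ and $q$, there exists an integer $F(t,q)$ such that every graph of rank-width at most $q$ and rank-depth at least $F(t,q)$ contains a vertex-minor isomorphic to the path $P_t$ on $t$ vertices.
   Context: Graphs are finite and simple. The cut-rank $\rho_G(S)$ of $S\subseteq V(G)$ is the $\mathrm{GF}(2)$-rank of the $S\times(V(G)\setminus S)$ submatrix of the adjacency matrix of $G$. Rank-width: a rank-decomposition is a pair $(T,L)$ with $T$ a tree with all degrees in $\{1,3\}$ and $L$ a bijection from $V(G)$ to the leaves of $T$; the width of an edge $e$ is $\rho_G$ of the vertex set mapped to the leaves of one component of $T-e$; the rank-width is the minimum over rank-decompositions of the maximum edge width ($0$ if $|V(G)|\le1$). Rank-depth: a decomposition is a pair $(T,\sigma)$ with $T$ a tree and $\sigma$ a bijection from $V(G)$ to the leaves of $T$; for a non-leaf node $v$, the components of $T-v$ give a partition $\mathcal P_v$ of $V(G)$ and the width of $v$ is $\max_{\mathcal P'\subseteq\mathcal P_v}\rho_G(\bigcup_{X\in\mathcal P'}X)$; the width of $(T,\sigma)$ is the maximum width of a non-leaf node and its radius is the radius of $T$; the rank-depth is the least $k$ admitting a decomposition of width at most $k$ and radius at most $k$ ($0$ if $|V(G)|<2$). Local complementation at $v$ gives $G*v$ with edge set $E(G)\,\Delta\,\{xy:x,y\in N_G(v),x\ne y\}$; $H$ is a vertex-minor of $G$ if $H$ is an induced subgraph of a graph obtained from $G$ by a sequence of local complementations. -}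

module Defs where

open import Data.Nat using (ℕ; zero; suc; _+_; _≤_; _<_; _≡ᵇ_)
open import Data.Bool using (Bool; true; false; _∧_; _∨_; _xor_; not)
open import Data.Bool.Properties using (∧-comm; ∨-comm)
open import Data.Fin using (Fin; toℕ; _≟_; inject₁; fromℕ)
import Data.Fin as Fin
open import Data.Fin.Subset using (Subset; _∈_; _∉_; _⊆_; Nonempty; ∣_∣)
open import Data.Vec using (Vec; foldr′; zipWith; tabulate)
open import Data.Product using (Σ; ∃; ∃-syntax; _×_; _,_)
open import Data.Sum using (_⊎_)
open import Function using (Injective; _⇔_)
open import Relation.Nullary using (¬_; does; yes; no)
open import Relation.Binary.PropositionalEquality using (_≡_; _≢_; refl; cong; cong₂)

record Graph (n : ℕ) : Set where
  field
    adj    : Fin n → Fin n → Bool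
    sym    : ∀ x y → adj x y ≡ adj y x
    irrefl : ∀ x → adj x x ≡ false
open Graph public

-- Cut-rank.  ρ_G(X) is the GF(2)-rank of the X × (V ∖ X) submatrix of
-- the adjacency matrix, i.e. the maximum number of linearly independent
-- rows (rows indexed by x ∈ X, columns by y ∉ X, entry adj x y).

colSum : ∀ {n} → Graph n → Subset n → Fin n → Bool
colSum G R' y = foldr′ _xor_ false (zipWith _∧_ R' (tabulate (λ x → adj G x y)))

-- The rows indexed by R are linearly independent over GF(2) in the
-- X × (V ∖ X) submatrix: every nonempty subfamily has nonzero sum.
IndependentRows : ∀ {n} → Graph n → Subset n → Subset n → Set
IndependentRows {n} G X R =
  ∀ (R' : Subset n) → R' ⊆ R → Nonempty R' →
    ∃[ y ] (y ∉ X × colSum G R' y ≡ true)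

CutRank≤ : ∀ {n} → Graph n → Subset n → ℕ → Set
CutRank≤ G X k = ∀ R → R ⊆ X → IndependentRows G X R → ∣ R ∣ ≤ k

data WalkLen {m : ℕ} (E : Fin m → Fin m → Set) : Fin m → Fin m → ℕ → Set where
  here : ∀ {a} → WalkLen E a a 0
  step : ∀ {a b c l} → E a b → WalkLen E b c l → WalkLen E a c (suc l)

Conn : ∀ {m} → (Fin m → Fin m → Set) → Fin m → Fin m → Set
Conn E a b = ∃[ l ] WalkLen E a b l

Edge : ∀ {m} → Graph m → Fin m → Fin m → Set
Edge T a b = adj T a b ≡ true

EdgeDelV : ∀ {m} → Graph m → Fin m → Fin m → Fin m → Set
EdgeDelV T v a b = Edge T a b × a ≢ v × b ≢ v

EdgeDelE : ∀ {m} → Graph m → Fin m → Fin m → Fin m → Fin m → Set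
EdgeDelE T u w a b = Edge T a b × ¬ (a ≡ u × b ≡ w) × ¬ (a ≡ w × b ≡ u)

HasCycle : ∀ {m} → Graph m → Set
HasCycle {m} T =
  ∃[ k ] Σ (Fin (3 + k) → Fin m) λ c → (Injective _≡_ _≡_ c ×
    (∀ (i : Fin (suc (suc k))) → Edge T (c (inject₁ i)) (c (Fin.suc i))) ×
    Edge T (c (fromℕ (suc (suc k)))) (c Fin.zero))

IsTree : ∀ {m} → Graph m → Set
IsTree {m} T = 1 ≤ m × (∀ a b → Conn (Edge T) a b) × ¬ HasCycle T

degree : ∀ {m} → Graph m → Fin m → ℕ
degree T a = ∣ tabulate (adj T a) ∣

IsLeaf : ∀ {m} → Graph m → Fin m → Set
IsLeaf T a = degree T a ≡ 1

LeafBijection : ∀ {n m} → Graph m → (Fin n → Fin m) → Set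
LeafBijection T σ =
  Injective _≡_ _≡_ σ × (∀ x → IsLeaf T (σ x)) × (∀ u → IsLeaf T u → ∃[ x ] σ x ≡ u)

IsRankDecomp≤ : ∀ {n m} → Graph n → Graph m → (Fin n → Fin m) → ℕ → Set
IsRankDecomp≤ {n} {m} G T L k =
  IsTree T × (∀ a → degree T a ≡ 1 ⊎ degree T a ≡ 3) × LeafBijection T L ×
  (∀ u w → Edge T u w → ∀ (X : Subset n) →
     (∀ x → (x ∈ X) ⇔ Conn (EdgeDelE T u w) u (L x)) → CutRank≤ G X k)

-- rank-width(G) ≤ k   (rank-width is 0 when |V(G)| ≤ 1)
RankWidth≤ : ∀ {n} → Graph n → ℕ → Set
RankWidth≤ {n} G k =
  n ≤ 1 ⊎ ∃[ m ] Σ (Graph m) λ T → ∃[ L ] IsRankDecomp≤ G T L k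

-- width of a non-leaf node v is ≤ k: for every union X of parts of the
-- partition P_v (equivalently every X ⊆ V(G) that is a union of classes
-- of "σ x, σ y lie in the same component of T - v"), ρ_G(X) ≤ k.
NodeWidth≤ : ∀ {n m} → Graph n → Graph m → (Fin n → Fin m) → Fin m → ℕ → Set
NodeWidth≤ {n} G T σ v k =
  ∀ (X : Subset n) →
    (∀ x y → Conn (EdgeDelV T v) (σ x) (σ y) → x ∈ X → y ∈ X) →
    CutRank≤ G X k

Radius≤ : ∀ {m} → Graph m → ℕ → Set
Radius≤ T k = ∃[ c ] ∀ u → ∃[ l ] (l ≤ k × WalkLen (Edge T) c u l)

HasDepthDecomp : ∀ {n} → Graph n → ℕ → Set
HasDepthDecomp {n} G k =
  ∃[ m ] Σ (Graph m) λ T → ∃[ σ ]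
    (IsTree T × LeafBijection T σ ×
     (∀ v → ¬ IsLeaf T v → NodeWidth≤ G T σ v k) × Radius≤ T k)

-- rank-depth(G) ≤ k   (rank-depth is 0 when |V(G)| < 2; otherwise it is
-- the least k admitting a decomposition of width ≤ k and radius ≤ k)
RankDepth≤ : ∀ {n} → Graph n → ℕ → Set
RankDepth≤ {n} G k = n < 2 ⊎ HasDepthDecomp G k

RankDepth≥ : ∀ {n} → Graph n → ℕ → Set
RankDepth≥ G F = ∀ k → k < F → ¬ RankDepth≤ G k

private
  does-sym : ∀ {n} (x y : Fin n) → does (x ≟ y) ≡ does (y ≟ x)
  does-sym x y with x ≟ y | y ≟ x
  ... | yes _ | yes _ = refl
  ... | no _  | no _  = refl
  ... | yes p | no q  with q (Relation.Binary.PropositionalEquality.sym p)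
  ... | ()
  does-sym x y | no q | yes p with q (Relation.Binary.PropositionalEquality.sym p)
  ... | ()

  does-refl : ∀ {n} (x : Fin n) → does (x ≟ x) ≡ true
  does-refl x with x ≟ x
  ... | yes _ = refl
  ... | no q with q refl
  ... | ()

  xor-false : ∀ b → b xor false ≡ b
  xor-false true = refl
  xor-false false = refl

localComp : ∀ {n} → Graph n → Fin n → Graph n
localComp G v = record
  { adj    = λ x y → adj G x y xor (not (does (x ≟ y)) ∧ (adj G v x ∧ adj G v y))
  ; sym    = λ x y → cong₂ _xor_ (sym G x y)
                       (cong₂ _∧_ (cong not (does-sym x y)) (∧-comm (adj G v x) (adj G v y)))
  ; irrefl = irr
  }
  where
  irr : ∀ x → adj G x x xor (not (does (x ≟ x)) ∧ (adj G v x ∧ adj G v x)) ≡ false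
  irr x rewrite does-refl x | irrefl G x = refl

data LCSeq {n : ℕ} (G : Graph n) : Graph n → Set where
  lc-done : LCSeq G G
  lc-step : ∀ {G'} (v : Fin n) → LCSeq G G' → LCSeq G (localComp G' v)

InducedSubgraph : ∀ {k n} → Graph k → Graph n → Set
InducedSubgraph H G =
  ∃[ f ] (Injective _≡_ _≡_ f × (∀ a b → adj H a b ≡ adj G (f a) (f b)))

VertexMinor : ∀ {k n} → Graph k → Graph n → Set
VertexMinor {n = n} H G = Σ (Graph n) λ G' → LCSeq G G' × InducedSubgraph H G'

_≅_ : ∀ {k n} → Graph k → Graph n → Set
_≅_ {k} {n} H G = Σ (Fin k → Fin n) λ f → Σ (Fin n → Fin k) λ g → ((∀ a → g (f a) ≡ a) × (∀ b → f (g b) ≡ b) ×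
          (∀ a b → adj H a b ≡ adj G (f a) (f b)))

private
  suc≢ᵇ : ∀ k → (suc k ≡ᵇ k) ≡ false
  suc≢ᵇ zero = refl
  suc≢ᵇ (suc k) = suc≢ᵇ k

Path : (t : ℕ) → Graph t
Path t = record
  { adj    = λ i j → (suc (toℕ i) ≡ᵇ toℕ j) ∨ (suc (toℕ j) ≡ᵇ toℕ i)
  ; sym    = λ i j → ∨-comm (suc (toℕ i) ≡ᵇ toℕ j) (suc (toℕ j) ≡ᵇ toℕ i)
  ; irrefl = λ i → cong₂ _∨_ (suc≢ᵇ (toℕ i)) (suc≢ᵇ (toℕ i))
  }

{-# OPTIONS --safe #-}
-- Call a vertex set shallow if it is the leaf set of a rooted tree of bounded height in which, at every node, every union
-- of branches has boundedly many row types towards the other branches; a graph whose vertex set is shallow has bounded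
-- rank-depth, so one works with deep sets. Fix vertices w₁, …, w_k whose rows are linearly independent on every
-- deep subset of a deep set B. A rank-decomposition has an edge with deep parts of B on both sides (walk towards
-- the deep side), so k ≤ 2q, and downward induction on k lets us assume that no further row can be added: every
-- vertex p of B becomes a linear combination s of the w_i on some deep subset of B. Record the letter (s, e), where e is
-- the adjacency vector of p to the w_i; a vertex with letter (s, e) is adjacent to a later one with letter (s', e') iff
-- s · e' = 1. If s · e' ≠ s' · e for two letters that keep occurring in deep subsets, then they give a long half graph,
-- hence a long path. Otherwise the pairing of letters is symmetric, and adding it to the adjacency relation
-- gives a graph on B in which deep sets have deep components and every vertex misses a deep part of a given deep set, so
-- a greedy search for an induced path never gets stuck. The resulting path differs from an induced path of G by a
-- symmetric matrix of low rank, which local complementations remove one letter at a time.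

module Submission where

-- The obstacle is that the coefficients s of a vertex p are tied to one deep subset: another deep
-- subset may give p another s, so letters are not attributes of vertices. When pairings are
-- symmetric this is harmless: s · e' = s' · e shows that letters with the same second component
-- pair alike with all others, so any of them may be chosen. When a pairing is asymmetric, letters
-- are used only along a nested sequence of deep subsets, where each row is linear on everything
-- chosen later. A letter that fails to occur in some deep enough subset is struck off the list
-- there, which drives a second induction inside the one on k.
--
-- Shallowness is a property of vertex sets with one bound M on row types fixed in advance; so it
-- passes to subsets, and being decidable it turns every choice of a deep subset into a finite
-- search. Two kinds of partition must fit M: the branches at a node of the rank-decomposition
-- (three branches and the node itself, 2^q types each) and the split into components (2^k types, k
-- ≤ 2q + 1).

-- Finite searches, codes of bit vectors, connected components

module FiniteSets where

  open import Defs using (here; step; Conn)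
  open import Data.Nat using (ℕ; zero; suc; _^_; _≤_)
  open import Data.Bool using (Bool; true; false; _∧_; _xor_)
  open import Data.Fin using (Fin; zero; suc; _≟_; combine)
  open import Data.Fin.Properties using (combine-injective; injective⇒≤; suc-injective)
  open import Data.Fin.Subset using (Subset; _∈_; ∣_∣)
  open import Data.Vec using (Vec; []; _∷_; tabulate; lookup; here; there)
  open import Data.Vec.Properties using (lookup⇒[]=; []=⇒lookup; lookup∘tabulate)
  open import Data.List using (List; []; _∷_; cartesianProduct; allFin)
  open import Data.List.Relation.Unary.All using (All; []; _∷_)
  import Data.List.Relation.Unary.All as All
  open import Data.List.Membership.Propositional.Properties using (∈-cartesianProduct⁺; ∈-allFin)
  open import Data.Product using (∃; ∃-syntax; _×_; _,_)
  open import Data.Empty using (⊥-elim)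
  open import Function using (_∘_)
  open import Relation.Nullary using (¬_; Dec; yes; no; does; ¬?)
  open import Relation.Nullary.Decidable using (map′; decidable-stable; dec-true)
  open import Relation.Unary using (Decidable)
  open import Relation.Binary.PropositionalEquality using (_≡_; refl; sym; trans; cong; cong₂; subst)

  private
    variable
      n k K : ℕ
      A : Set

  abstract

    ⟪_⟫ : {P : Fin n → Set} → Decidable P → Subset n
    ⟪ P? ⟫ = tabulate (does ∘ P?)

    ∈⟪⟫⁺ : {P : Fin n → Set} (P? : Decidable P) {x : Fin n} → P x → x ∈ ⟪ P? ⟫
    ∈⟪⟫⁺ P? {x} p = lookup⇒[]= x _ (trans (lookup∘tabulate (does ∘ P?) x) (dec-true (P? x) p))

    ∈⟪⟫⁻ : {P : Fin n → Set} (P? : Decidable P) {x : Fin n} → x ∈ ⟪ P? ⟫ → P x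
    ∈⟪⟫⁻ P? {x} x∈ with P? x | trans (sym (lookup∘tabulate (does ∘ P?) x)) ([]=⇒lookup x∈)
    ... | yes p | _ = p
    ... | no _  | ()

  -- The case distinctions on deep sets are searches of finite types: vertices, subsets, vectors of
  -- labels.
  Searchable : Set → Set₁
  Searchable A = {P : A → Set} → Decidable P → Dec (∃ P)

  search-Vec : Searchable A → ∀ n → Searchable (Vec A n)
  search-Vec s zero    P? = map′ ([] ,_) (λ { ([] , p) → p }) (P? [])
  search-Vec s (suc n) P? =
    map′ (λ (x , xs , p) → x ∷ xs , p) (λ { (x ∷ xs , p) → x , xs , p })
      (s (λ x → search-Vec s n (λ xs → P? (x ∷ xs))))

  all-of? : Searchable A → {P : A → Set} → Decidable P → Dec (∀ x → P x)
  all-of? s P? with s (¬? ∘ P?)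
  ... | yes (x , ¬p) = no (λ f → ¬p (f x))
  ... | no ¬∃        = yes (λ x → decidable-stable (P? x) (λ ¬p → ¬∃ (x , ¬p)))

  not-all : Searchable A → {P : A → Set} → Decidable P → ¬ (∀ x → P x) → ∃[ x ] ¬ P x
  not-all s P? ¬∀ with s (¬? ∘ P?)
  ... | yes w = w
  ... | no ¬∃ = ⊥-elim (¬∀ (λ x → decidable-stable (P? x) (λ ¬p → ¬∃ (x , ¬p))))

  bit : Bool → Fin 2
  bit false = zero
  bit true  = suc zero

  bit-injective : ∀ {a b} → bit a ≡ bit b → a ≡ b
  bit-injective {false} {false} _ = refl
  bit-injective {true}  {true}  _ = refl

  code : Vec Bool k → Fin (2 ^ k)
  code []      = zero
  code (b ∷ v) = combine (bit b) (code v)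

  code-injective : (u v : Vec Bool k) → code u ≡ code v → u ≡ v
  code-injective []      []      _  = refl
  code-injective (a ∷ u) (b ∷ v) eq with combine-injective (bit a) (code u) (bit b) (code v) eq
  ... | p , q = cong₂ _∷_ (bit-injective p) (code-injective u v q)

  dot : Vec Bool k → Vec Bool k → Bool
  dot []      []      = false
  dot (a ∷ u) (b ∷ v) = (a ∧ b) xor dot u v

  at : (S : Subset n) → Fin ∣ S ∣ → Fin n
  at (true ∷ S)  zero    = zero
  at (true ∷ S)  (suc i) = suc (at S i)
  at (false ∷ S) i       = suc (at S i)

  at-∈ : (S : Subset n) (i : Fin ∣ S ∣) → at S i ∈ S
  at-∈ (true ∷ S)  zero    = here
  at-∈ (true ∷ S)  (suc i) = there (at-∈ S i)
  at-∈ (false ∷ S) i       = there (at-∈ S i)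

  at-injective : (S : Subset n) {i j : Fin ∣ S ∣} → at S i ≡ at S j → i ≡ j
  at-injective (true ∷ S)  {zero}  {zero}  _  = refl
  at-injective (true ∷ S)  {suc i} {suc j} eq = cong suc (at-injective S (suc-injective eq))
  at-injective (false ∷ S) eq = at-injective S (suc-injective eq)

  index : {S : Subset n} {x : Fin n} → x ∈ S → ∃[ i ] at S i ≡ x
  index {S = true ∷ S}  here      = zero , refl
  index {S = true ∷ S}  (there p) with index p
  ... | i , eq = suc i , cong suc eq
  index {S = false ∷ S} (there p) with index p
  ... | i , eq = i , cong suc eq

  card≤ : (S : Subset n) (f : Fin n → Fin K) →
          (∀ x y → x ∈ S → y ∈ S → f x ≡ f y → x ≡ y) → ∣ S ∣ ≤ K
  card≤ S f inj = injective⇒≤ {f = f ∘ at S}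
    (λ {i} {j} eq → at-injective S (inj _ _ (at-∈ S i) (at-∈ S j) eq))

  module _ {m : ℕ} {E : Fin m → Fin m → Set} where

    conn-refl : ∀ {a} → Conn E a a
    conn-refl = 0 , here

    conn-step : ∀ {a b c} → E a b → Conn E b c → Conn E a c
    conn-step e (l , w) = suc l , step e w

    conn-trans : ∀ {a b c} → Conn E a b → Conn E b c → Conn E a c
    conn-trans (_ , here)     v = v
    conn-trans (_ , step e w) v = conn-step e (conn-trans (_ , w) v)

    conn-sym : (∀ {a b} → E a b → E b a) → ∀ {a b} → Conn E a b → Conn E b a
    conn-sym s (_ , here)     = conn-refl
    conn-sym s (_ , step e w) = conn-trans (conn-sym s (_ , w)) (conn-step (s e) conn-refl)

    conn-const : {B : Set} (c : Fin m → B) → (∀ {x y} → E x y → c x ≡ c y) →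
                 ∀ {x y} → Conn E x y → c x ≡ c y
    conn-const c f (_ , here)     = refl
    conn-const c f (_ , step e w) = trans (f e) (conn-const c f (_ , w))

  conn-map : ∀ {m m'} {E : Fin m → Fin m → Set} {E' : Fin m' → Fin m' → Set} (f : Fin m → Fin m') →
             (∀ {a b} → E a b → E' (f a) (f b)) → ∀ {a b} → Conn E a b → Conn E' (f a) (f b)
  conn-map f g (_ , here)     = conn-refl
  conn-map f g (_ , step e w) = conn-step (g e) (conn-map f g (_ , w))

  -- A component is named by one of its own vertices, so components can be compared and can serve as
  -- labels.
  record Components {m : ℕ} (E : Fin m → Fin m → Set) : Set where
    field
      comp      : Fin m → Fin m
      comp-edge : ∀ {x y} → E x y → comp x ≡ comp y
      comp-conn : ∀ x → Conn E x (comp x)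

    comp-cong : ∀ {x y} → Conn E x y → comp x ≡ comp y
    comp-cong = conn-const comp comp-edge

  module _ {m : ℕ} {E : Fin m → Fin m → Set} (E? : ∀ x y → Dec (E x y))
           (E-sym : ∀ {x y} → E x y → E y x) where

    private
      Merged : List (Fin m × Fin m) → (Fin m → Fin m) → Set
      Merged ps c = All (λ (x , y) → E x y → c x ≡ c y) ps × (∀ x → Conn E x (c x))

      merge : Fin m → Fin m → Fin m → Fin m
      merge a b z with z ≟ b
      ... | yes _ = a
      ... | no _  = z

      merge-left : ∀ a b → merge a b a ≡ a
      merge-left a b with a ≟ b
      ... | yes _ = refl
      ... | no _  = refl

      merge-right : ∀ a b → merge a b b ≡ a
      merge-right a b with b ≟ b
      ... | yes _ = refl
      ... | no ¬p = ⊥-elim (¬p refl)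

      -- Two invariants are kept while pairs are processed: the ends of a processed edge share a
      -- representative, and every vertex is connected to its representative. The second one makes
      -- merging sound.
      union-find : ∀ ps → ∃ (Merged ps)
      union-find [] = (λ x → x) , [] , λ x → conn-refl
      union-find ((x , y) ∷ ps) with union-find ps | E? x y
      ... | c , eqs , conns | no ¬e = c , (λ e → ⊥-elim (¬e e)) ∷ eqs , conns
      ... | c , eqs , conns | yes e =
        c' , (λ _ → trans (merge-left (c x) (c y)) (sym (merge-right (c x) (c y))))
             ∷ All.map (λ f e' → cong (merge (c x) (c y)) (f e')) eqs
           , conns'
        where
        c' : Fin m → Fin m
        c' z = merge (c x) (c y) (c z)
        conns' : ∀ z → Conn E z (c' z)
        conns' z with c z ≟ c y
        ... | no _  = conns z
        ... | yes p =
          conn-trans (subst (Conn E z) p (conns z))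
            (conn-trans (conn-sym E-sym (conns y)) (conn-step (E-sym e) (conns x)))

    components : Components E
    components with union-find (cartesianProduct (allFin m) (allFin m))
    ... | c , eqs , conns = record
      { comp = c
      ; comp-edge = λ {x} {y} → All.lookup eqs (∈-cartesianProduct⁺ (∈-allFin x) (∈-allFin y))
      ; comp-conn = conns }

    open Components components

    comp⇒conn : ∀ {x y} → comp x ≡ comp y → Conn E x y
    comp⇒conn {x} {y} eq =
      conn-trans (comp-conn x) (subst (λ z → Conn E z y) (sym eq) (conn-sym E-sym (comp-conn y)))

    conn? : ∀ x y → Dec (Conn E x y)
    conn? x y = map′ comp⇒conn comp-cong (comp x ≟ comp y)

-- Linear algebra over GF(2): independent rows, cut-rank, row types

module CutRank where

  open import Defs using (Graph; adj; IndependentRows; CutRank≤)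
  open FiniteSets
  open import Data.Nat using (ℕ; zero; suc; _^_; _≤_; _<_)
  open import Data.Nat.Properties using (≤-refl; m≤n⇒m≤1+n; ^-monoʳ-≤; 1+n≰n; ≤-pred)
  open import Data.Bool using (Bool; true; false; _∧_; _xor_)
  import Data.Bool.Properties as Bool
  open import Data.Fin using (Fin; zero; suc; _≟_; inject≤)
  open import Data.Fin.Properties using (any?; inject≤-injective)
  open import Data.Fin.Subset using (Subset; _∈_; _∉_; _⊆_; ∣_∣; ⊥; ∁; ⁅_⁆; Nonempty)
  open import Data.Fin.Subset.Properties using (_∈?_; nonempty?; anySubset?; ∉⊥; ∣⊥∣≡0; x∈∁p⇒x∉p; x∉p⇒x∈∁p)
  open import Data.Vec using (Vec; []; _∷_; map; lookup; tabulate; _[_]≔_; foldr′; zipWith; here; there)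
  open import Data.Vec.Properties using (lookup⇒[]=; []=⇒lookup; lookup∘tabulate; lookup-map; []≔-updates; lookup∘update; lookup∘update′)
  open import Data.Product using (Σ; ∃-syntax; _×_; _,_; proj₁; proj₂)
  open import Data.Sum using (_⊎_; inj₁; inj₂)
  open import Data.Empty using (⊥-elim)
  open import Function using (_∘_)
  open import Relation.Nullary using (Dec; yes; no; _×-dec_; _→-dec_)
  open import Relation.Binary.PropositionalEquality using (_≡_; _≢_; refl; sym; trans; cong; cong₂; subst)

  private
    variable
      n k a b : ℕ

  ∣insert∣ : (S : Subset n) (x : Fin n) → x ∉ S → ∣ S [ x ]≔ true ∣ ≡ suc ∣ S ∣
  ∣insert∣ (true ∷ S)  zero    x∉ = ⊥-elim (x∉ here)
  ∣insert∣ (false ∷ S) zero    x∉ = refl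
  ∣insert∣ (true ∷ S)  (suc x) x∉ = cong suc (∣insert∣ S x (x∉ ∘ there))
  ∣insert∣ (false ∷ S) (suc x) x∉ = ∣insert∣ S x (x∉ ∘ there)

  ∈-insert⁻ : (S : Subset n) {x y : Fin n} → y ∈ S [ x ]≔ true → y ≡ x ⊎ y ∈ S
  ∈-insert⁻ S {x} {y} y∈ with y ≟ x
  ... | yes y≡x = inj₁ y≡x
  ... | no y≢x  = inj₂ (lookup⇒[]= y S (trans (sym (lookup∘update′ y≢x S true)) ([]=⇒lookup y∈)))

  ∈-remove⁻ : (S : Subset n) {x y : Fin n} → y ∈ S [ x ]≔ false → y ≢ x × y ∈ S
  ∈-remove⁻ S {x} {y} y∈ with y ≟ x
  ... | no y≢x = y≢x , lookup⇒[]= y S (trans (sym (lookup∘update′ y≢x S false)) ([]=⇒lookup y∈))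
  ... | yes refl with trans (sym (lookup∘update x S false)) ([]=⇒lookup y∈)
  ... | ()

  dot-foldr : (u v : Vec Bool k) → foldr′ _xor_ false (zipWith _∧_ u v) ≡ dot u v
  dot-foldr []      []      = refl
  dot-foldr (a ∷ u) (b ∷ v) = cong ((a ∧ b) xor_) (dot-foldr u v)

  dot-⊥ : (u : Vec Bool k) → dot ⊥ u ≡ false
  dot-⊥ []      = refl
  dot-⊥ (b ∷ u) = dot-⊥ u

  dot-⁅⁆ : (x : Fin k) (v : Vec Bool k) → dot ⁅ x ⁆ v ≡ lookup v x
  dot-⁅⁆ zero    (b ∷ v) = trans (cong (b xor_) (dot-⊥ v)) (Bool.xor-identityʳ b)
  dot-⁅⁆ (suc x) (_ ∷ v) = dot-⁅⁆ x v

  dot-remove : (u v : Vec Bool k) (i : Fin k) →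
               dot u v ≡ (lookup u i ∧ lookup v i) xor dot (u [ i ]≔ false) v
  dot-remove (a ∷ u) (b ∷ v) zero    = refl
  dot-remove (a ∷ u) (b ∷ v) (suc i) =
    trans (cong ((a ∧ b) xor_) (dot-remove u v i))
      (xor-swap (a ∧ b) (lookup u i ∧ lookup v i) (dot (u [ i ]≔ false) v))
    where
    xor-swap : ∀ x y z → x xor (y xor z) ≡ y xor (x xor z)
    xor-swap false y     z = refl
    xor-swap true  false z = refl
    xor-swap true  true  z = refl

  -- A tree edge will split the reference vertices into two such sublists, each still independent.
  data Sub {A : Set} : Vec A a → Vec A b → Set where
    []   : Sub [] []
    keep : ∀ {x} {us : Vec A a} {ws : Vec A b} → Sub us ws → Sub (x ∷ us) (x ∷ ws)
    skip : ∀ {x} {us : Vec A a} {ws : Vec A b} → Sub us ws → Sub us (x ∷ ws)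

  extend : {A : Set} {us : Vec A a} {ws : Vec A b} → Sub us ws → Vec Bool a → Vec Bool b
  extend []         _       = []
  extend (keep sub) (x ∷ s) = x ∷ extend sub s
  extend (skip sub) s       = false ∷ extend sub s

  extend-nonempty : {A : Set} {us : Vec A a} {ws : Vec A b} (sub : Sub us ws) (s : Vec Bool a) →
                    Nonempty s → Nonempty (extend sub s)
  extend-nonempty []         _       (() , _)
  extend-nonempty (keep sub) (_ ∷ s) (zero , here)      = zero , here
  extend-nonempty (keep sub) (_ ∷ s) (suc i , there i∈) with extend-nonempty sub s (i , i∈)
  ... | j , j∈ = suc j , there j∈
  extend-nonempty (skip sub) s ne with extend-nonempty sub s ne
  ... | j , j∈ = suc j , there j∈

  fromVec : Vec (Fin n) k → Subset n
  fromVec []       = ⊥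
  fromVec (w ∷ ws) = fromVec ws [ w ]≔ true

  ∈-fromVec⁻ : (ws : Vec (Fin n) k) {x : Fin n} → x ∈ fromVec ws → ∃[ i ] lookup ws i ≡ x
  ∈-fromVec⁻ []       x∈ = ⊥-elim (∉⊥ x∈)
  ∈-fromVec⁻ (w ∷ ws) x∈ with ∈-insert⁻ (fromVec ws) x∈
  ... | inj₁ refl = zero , refl
  ... | inj₂ x∈′ with ∈-fromVec⁻ ws x∈′
  ... | i , eq = suc i , eq

  ∈-fromVec⁺ : (ws : Vec (Fin n) k) (i : Fin k) → lookup ws i ∈ fromVec ws
  ∈-fromVec⁺ (w ∷ ws) zero    = []≔-updates (fromVec ws) w
  ∈-fromVec⁺ (w ∷ ws) (suc i) with lookup ws i ≟ w
  ... | yes eq = subst (_∈ fromVec ws [ w ]≔ true) (sym eq) ([]≔-updates (fromVec ws) w)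
  ... | no ne  = lookup⇒[]= _ _ (trans (lookup∘update′ ne (fromVec ws) true)
                   ([]=⇒lookup (∈-fromVec⁺ ws i)))

  module _ (G : Graph n) where

    ev : Vec (Fin n) k → Fin n → Vec Bool k
    ev ws y = map (λ w → adj G w y) ws

    -- Rows are a vector and the column set varies freely, whereas `IndependentRows` ties the
    -- columns to the complement of a set of rows; `indep⇒≤rank` translates.
    Indep : Vec (Fin n) k → Subset n → Set
    Indep ws Y = ∀ s → Nonempty s → ∃[ y ] (y ∈ Y × dot s (ev ws y) ≡ true)

    Linear : Vec (Fin n) k → Vec Bool k → Fin n → Subset n → Set
    Linear ws s p Y = ∀ y → y ∈ Y → adj G p y ≡ dot s (ev ws y)

    linear? : (ws : Vec (Fin n) k) (s : Vec Bool k) (p : Fin n) (Y : Subset n) → Dec (Linear ws s p Y)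
    linear? ws s p Y = all-of? any? (λ y → (y ∈? Y) →-dec (adj G p y Bool.≟ dot s (ev ws y)))

    indep? : (ws : Vec (Fin n) k) (Y : Subset n) → Dec (Indep ws Y)
    indep? ws Y = all-of? anySubset? (λ s → nonempty? s →-dec
                    any? (λ y → (y ∈? Y) ×-dec (dot s (ev ws y) Bool.≟ true)))

    -- A vanishing combination with coefficient one at `p` could be solved for `p`; with coefficient
    -- zero it would contradict the independence of `ws`.
    linear-or-indep : (p : Fin n) (ws : Vec (Fin n) k) {Y : Subset n} → Indep ws Y →
                      (∃[ s ] Linear ws s p Y) ⊎ Indep (p ∷ ws) Y
    linear-or-indep p ws {Y} ind with anySubset? (λ s → linear? ws s p Y)
    ... | yes w = inj₁ w
    ... | no ¬w = inj₂ ind'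
      where
      ind' : Indep (p ∷ ws) Y
      ind' (false ∷ s) (suc i , there i∈) = ind s (i , i∈)
      ind' (true ∷ s)  _ with not-all any? (λ y → (y ∈? Y) →-dec (adj G p y Bool.≟ dot s (ev ws y)))
                                (λ lin → ¬w (s , lin))
      ... | y , ¬imp with y ∈? Y
      ... | no y∉   = ⊥-elim (¬imp (⊥-elim ∘ y∉))
      ... | yes y∈  = y , y∈ , xor-≢ _ _ (λ eq → ¬imp (λ _ → eq))
        where
        xor-≢ : ∀ a b → a ≢ b → a xor b ≡ true
        xor-≢ false false ne = ⊥-elim (ne refl)
        xor-≢ false true  ne = refl
        xor-≢ true  false ne = refl
        xor-≢ true  true  ne = ⊥-elim (ne refl)

    dot-extend : {us : Vec (Fin n) a} {ws : Vec (Fin n) b} (sub : Sub us ws) (s : Vec Bool a) (y : Fin n) →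
                 dot (extend sub s) (ev ws y) ≡ dot s (ev us y)
    dot-extend []                 []      y = refl
    dot-extend (keep {x = x} sub) (c ∷ s) y = cong ((c ∧ adj G x y) xor_) (dot-extend sub s y)
    dot-extend (skip sub)         s       y = dot-extend sub s y

    indep-sub : {us : Vec (Fin n) a} {ws : Vec (Fin n) b} {Y : Subset n} → Sub us ws → Indep ws Y → Indep us Y
    indep-sub sub ind s ne with ind (extend sub s) (extend-nonempty sub s ne)
    ... | y , y∈ , eq = y , y∈ , trans (sym (dot-extend sub s y)) eq

    unit-dot : (ws : Vec (Fin n) k) (i : Fin k) → ∃[ s ] (∀ y → dot s (ev ws y) ≡ adj G (lookup ws i) y)
    unit-dot (w ∷ ws) zero    = true ∷ ⊥ , λ y → trans (cong (adj G w y xor_) (dot-⊥ (ev ws y))) (Bool.xor-identityʳ (adj G w y))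
    unit-dot (w ∷ ws) (suc i) with unit-dot ws i
    ... | s , eq = false ∷ s , eq

    -- A repeated row would cancel against its copy. So no row is lost when an independent vector is
    -- read as a subset.
    indep⇒fresh : (w : Fin n) (ws : Vec (Fin n) k) {Y : Subset n} → Indep (w ∷ ws) Y → w ∉ fromVec ws
    indep⇒fresh w ws ind w∈ with ∈-fromVec⁻ ws w∈
    ... | i , refl with unit-dot ws i
    ... | s , eq with ind (true ∷ s) (zero , here)
    ... | y , _ , eq' = false≢true (trans (sym (trans (cong (adj G w y xor_) (eq y)) (Bool.xor-same (adj G w y)))) eq')
      where
      false≢true : false ≡ true → _
      false≢true ()

    indep-tail : {w : Fin n} {ws : Vec (Fin n) k} {Y : Subset n} → Indep (w ∷ ws) Y → Indep ws Y
    indep-tail ind s (i , i∈) = ind (false ∷ s) (suc i , there i∈)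

    ∣fromVec∣ : (ws : Vec (Fin n) k) {Y : Subset n} → Indep ws Y → ∣ fromVec ws ∣ ≡ k
    ∣fromVec∣ []       ind = ∣⊥∣≡0 n
    ∣fromVec∣ (w ∷ ws) ind =
      trans (∣insert∣ (fromVec ws) w (indep⇒fresh w ws ind)) (cong suc (∣fromVec∣ ws (indep-tail ind)))

    -- `w` is removed from `R` and from the list together; it does not occur again in `ws`, so the
    -- remaining coefficients are unchanged.
    colSum-fromVec : (ws : Vec (Fin n) k) {Y : Subset n} → Indep ws Y → (R : Subset n) → R ⊆ fromVec ws →
                     ∀ y → dot R (tabulate (λ x → adj G x y)) ≡ dot (map (lookup R) ws) (ev ws y)
    colSum-fromVec [] ind R R⊆ y = trans (cong (λ S → dot S (tabulate (λ x → adj G x y))) R≡⊥) (dot-⊥ (tabulate (λ x → adj G x y)))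
      where
      ext : ∀ {k} (S : Subset k) → (∀ {x} → x ∈ S → x ∈ ⊥) → S ≡ ⊥
      ext []          _ = refl
      ext (true ∷ S)  f = ⊥-elim (∉⊥ (f here))
      ext (false ∷ S) f = cong (false ∷_) (ext S (λ x∈ → drop (f (there x∈))))
        where
        drop : ∀ {k} {x : Fin k} → suc x ∈ ⊥ → x ∈ ⊥
        drop (there p) = p
      R≡⊥ : R ≡ ⊥
      R≡⊥ = ext R R⊆
    colSum-fromVec (w ∷ ws) ind R R⊆ y =
      trans (dot-remove R (tabulate (λ x → adj G x y)) w)
        (cong₂ (λ c d → (lookup R w ∧ c) xor d) (lookup-tab w)
          (trans (colSum-fromVec ws (indep-tail ind) R' R'⊆ y)
            (cong (λ s → dot s (ev ws y)) (map-lookup ws (λ i eq → fresh (subst (_∈ fromVec ws) eq (∈-fromVec⁺ ws i)))))))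
      where
      R' : Subset n
      R' = R [ w ]≔ false
      fresh : w ∉ fromVec ws
      fresh = indep⇒fresh w ws ind
      lookup-tab : ∀ x → lookup (tabulate (λ x → adj G x y)) x ≡ adj G x y
      lookup-tab x = lookup∘tabulate (λ x → adj G x y) x
      R'⊆ : R' ⊆ fromVec ws
      R'⊆ x∈ with ∈-remove⁻ R x∈
      ... | x≢w , x∈R with ∈-insert⁻ (fromVec ws) (R⊆ x∈R)
      ... | inj₁ x≡w = ⊥-elim (x≢w x≡w)
      ... | inj₂ p   = p
      map-lookup : ∀ {j} (vs : Vec (Fin n) j) → (∀ i → lookup vs i ≢ w) → map (lookup R') vs ≡ map (lookup R) vs
      map-lookup []       _ = refl
      map-lookup (v ∷ vs) f = cong₂ _∷_ (lookup∘update′ (f zero) R false) (map-lookup vs (f ∘ suc))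

    indep⇒≤rank : (X : Subset n) {q : ℕ} → CutRank≤ G X q → (ws : Vec (Fin n) k) →
                  (∀ i → lookup ws i ∈ X) → Indep ws (∁ X) → k ≤ q
    indep⇒≤rank {k} X {q} cr ws ws∈ ind = subst (_≤ q) (∣fromVec∣ ws ind) (cr (fromVec ws) sub rows)
      where
      sub : fromVec ws ⊆ X
      sub x∈ with ∈-fromVec⁻ ws x∈
      ... | i , refl = ws∈ i
      rows : IndependentRows G X (fromVec ws)
      rows R' R'⊆ (x , x∈) with ∈-fromVec⁻ ws (R'⊆ x∈)
      ... | i , refl with ind (map (lookup R') ws) (i , lookup⇒[]= i _ (trans (lookup-map i (lookup R') ws) ([]=⇒lookup x∈)))
      ... | y , y∈ , eq = y , x∈∁p⇒x∉p y∈ ,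
        trans (dot-foldr R' _) (trans (colSum-fromVec ws ind R' R'⊆ y) eq)

    private
      Basis : Subset n → ℕ → Set
      Basis X k = Σ (Vec (Fin n) k) λ ws → (∀ i → lookup ws i ∈ X) × Indep ws (∁ X)

      Spanning : Subset n → ℕ → Set
      Spanning X k = Σ (Basis X k) λ (ws , _) → ∀ x → x ∈ X → ∃[ s ] Linear ws s x (∁ X)

    -- Rows are added greedily until there are `j` of them or they span all rows of `X`. For `j`
    -- above the cut-rank only the second can happen.
    grow-basis : (X : Subset n) (j : ℕ) → Basis X j ⊎ (∃[ k ] (k < j × Spanning X k))
    grow-basis X zero    = inj₁ ([] , (λ ()) , λ { [] (() , _) })
    grow-basis X (suc j) with grow-basis X j
    ... | inj₂ (k , k<j , sp) = inj₂ (k , m≤n⇒m≤1+n k<j , sp)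
    ... | inj₁ (ws , ws∈ , ind)
        with all-of? any? (λ x → (x ∈? X) →-dec anySubset? (λ s → linear? ws s x (∁ X)))
    ... | yes sp = inj₂ (j , ≤-refl , (ws , ws∈ , ind) , sp)
    ... | no ¬sp with not-all any? (λ x → (x ∈? X) →-dec anySubset? (λ s → linear? ws s x (∁ X))) ¬sp
    ... | x , ¬imp with x ∈? X
    ... | no x∉ = ⊥-elim (¬imp (⊥-elim ∘ x∉))
    ... | yes x∈ with linear-or-indep x ws ind
    ... | inj₁ lin  = ⊥-elim (¬imp (λ _ → lin))
    ... | inj₂ ind' = inj₁ (x ∷ ws , (λ { zero → x∈ ; (suc i) → ws∈ i }) , ind')

    -- A row is determined by its at most `q` coefficients over a basis.
    rank⇒types : (X : Subset n) (q : ℕ) → CutRank≤ G X q →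
                 Σ (Fin n → Fin (2 ^ q)) λ ℓ → ∀ x x' → x ∈ X → x' ∈ X → ℓ x ≡ ℓ x' →
                   ∀ y → y ∉ X → adj G x y ≡ adj G x' y
    rank⇒types X q cr with grow-basis X (suc q)
    ... | inj₁ (ws , ws∈ , ind) = ⊥-elim (1+n≰n (indep⇒≤rank X cr ws ws∈ ind))
    ... | inj₂ (k , k<1+q , (ws , _) , sp) = ℓ , same
      where
      2^k≤ : 2 ^ k ≤ 2 ^ q
      2^k≤ = ^-monoʳ-≤ 2 (≤-pred k<1+q)
      coeff : Fin n → Vec Bool k
      coeff x with x ∈? X
      ... | yes x∈ = proj₁ (sp x x∈)
      -- A dummy value: `same` compares vertices of `X` only.
      ... | no _   = ⊥
      coeff-linear : ∀ x → x ∈ X → Linear ws (coeff x) x (∁ X)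
      coeff-linear x x∈ with x ∈? X
      ... | yes x∈′ = proj₂ (sp x x∈′)
      ... | no x∉   = ⊥-elim (x∉ x∈)
      ℓ : Fin n → Fin (2 ^ q)
      ℓ x = inject≤ (code (coeff x)) 2^k≤
      same : ∀ x x' → x ∈ X → x' ∈ X → ℓ x ≡ ℓ x' → ∀ y → y ∉ X → adj G x y ≡ adj G x' y
      same x x' x∈ x'∈ eq y y∉ =
        trans (coeff-linear x x∈ y (x∉p⇒x∈∁p y∉))
          (trans (cong (λ s → dot s (ev ws y)) (code-injective (coeff x) (coeff x') (inject≤-injective _ _ _ _ eq)))
            (sym (coeff-linear x' x'∈ y (x∉p⇒x∈∁p y∉))))

-- Paths obtained by local complementation: half graphs and twisted paths

module LocalComplementation where

  open import Defs hiding (sym)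
  open import Data.Nat using (ℕ; zero; suc; _+_; _≤_; z≤n; s≤s; _≡ᵇ_)
  open import Data.Nat.Properties using (≤-refl; ≤-trans; ≤-reflexive; n≤1+n; +-identityʳ; m≤m+n; +-suc; ≤-pred)
  open import Data.Bool using (Bool; true; false; _∧_; _∨_; _xor_; not)
  import Data.Bool.Properties as Bool
  open import Data.Fin using (Fin; zero; suc; toℕ; _≟_; inject≤)
  open import Data.Fin.Properties using (toℕ-inject≤; inject≤-injective)
  open import Data.List using (List; []; _∷_; _++_; length; lookup; map; filter)
  open import Data.List.Properties using (length-map; ++-assoc; filter-notAll)
  open import Data.List.Membership.Propositional using (_∈_; find; lose)
  open import Data.List.Membership.Propositional.Properties using (∈-∃++; ∈-lookup; ∈-++⁺ˡ; ∈-++⁺ʳ; ∈-filter⁺)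
  open import Data.List.Relation.Unary.Any using (here; there)
  import Data.List.Relation.Unary.Any as Any
  open import Data.List.Relation.Unary.All using (All; []; _∷_)
  import Data.List.Relation.Unary.All as All
  open import Data.List.Relation.Unary.All.Properties using (++⁻ʳ; ++⁻ˡ; ¬Any⇒All¬)
  open import Data.Product using (∃-syntax; _×_; _,_; proj₁; proj₂)
  open import Data.Sum using (_⊎_; inj₁; inj₂; [_,_]′)
  open import Data.Unit using (⊤; tt)
  open import Data.Empty using (⊥-elim)
  open import Function using (_∘_)
  open import Relation.Nullary using (Dec; yes; no; does; ¬?)
  open import Relation.Binary.PropositionalEquality using (_≡_; _≢_; refl; sym; trans; cong; cong₂; subst)

  private
    variable
      n t : ℕ

  -- `LCSeq` appends steps at the end, while the constructions here complement first and continue in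
  -- the resulting graph.
  lcseq-cons : {G G' : Graph n} (v : Fin n) → LCSeq (localComp G v) G' → LCSeq G G'
  lcseq-cons v lc-done        = lc-step v lc-done
  lcseq-cons v (lc-step w s)  = lc-step w (lcseq-cons v s)

  minor-lc : (t : ℕ) (G : Graph n) (v : Fin n) → VertexMinor (Path t) (localComp G v) → VertexMinor (Path t) G
  minor-lc t G v (G' , s , ind) = G' , lcseq-cons v s , ind

  module _ (G : Graph n) (v : Fin n) where

    lc-val : ∀ {x y} → x ≢ y → adj (localComp G v) x y ≡ adj G x y xor (adj G v x ∧ adj G v y)
    lc-val {x} {y} x≢y with x ≟ y
    ... | yes x≡y = ⊥-elim (x≢y x≡y)
    ... | no _    = refl

    lc-offʳ : ∀ x {y} → adj G v y ≡ false → adj (localComp G v) x y ≡ adj G x y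
    lc-offʳ x {y} eq rewrite eq with adj G v x | does (x ≟ y) | adj G x y
    ... | true  | true  | true  = refl
    ... | true  | true  | false = refl
    ... | true  | false | true  = refl
    ... | true  | false | false = refl
    ... | false | true  | true  = refl
    ... | false | true  | false = refl
    ... | false | false | true  = refl
    ... | false | false | false = refl

    lc-offˡ : ∀ {x} y → adj G v x ≡ false → adj (localComp G v) x y ≡ adj G x y
    lc-offˡ {x} y eq =
      trans (Graph.sym (localComp G v) x y) (trans (lc-offʳ y eq) (Graph.sym G y x))

    lc-on : ∀ {x y} → x ≢ y → adj G v x ≡ true → adj G v y ≡ true →
            adj (localComp G v) x y ≡ not (adj G x y)
    lc-on {x} {y} x≢y vx vy rewrite lc-val x≢y | vx | vy with adj G x y
    ... | true  = refl
    ... | false = refl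

  module _ (G : Graph n) where

    IPathHead : Fin n → List (Fin n) → Set
    IPathHead x []       = ⊤
    IPathHead x (y ∷ ys) = (x ≢ y × adj G x y ≡ true) × All (λ z → x ≢ z × adj G x z ≡ false) ys

    IPath : List (Fin n) → Set
    IPath []       = ⊤
    IPath (x ∷ xs) = IPathHead x xs × IPath xs

    ipath-fresh : ∀ x xs → IPathHead x xs → ∀ i → x ≢ lookup xs i
    ipath-fresh x (y ∷ ys) ((x≢y , _) , _) zero    = x≢y
    ipath-fresh x (y ∷ ys) (_ , far)       (suc i) = proj₁ (All.lookup far (∈-lookup i))

    ipath-injective : ∀ xs → IPath xs → ∀ i j → lookup xs i ≡ lookup xs j → i ≡ j
    ipath-injective (x ∷ xs) (hd , ip) zero    zero    _  = refl
    ipath-injective (x ∷ xs) (hd , ip) zero    (suc j) eq = ⊥-elim (ipath-fresh x xs hd j eq)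
    ipath-injective (x ∷ xs) (hd , ip) (suc i) zero    eq = ⊥-elim (ipath-fresh x xs hd i (sym eq))
    ipath-injective (x ∷ xs) (hd , ip) (suc i) (suc j) eq = cong suc (ipath-injective xs ip i j eq)

    ipath-head-adj : ∀ x xs → IPathHead x xs → ∀ j → adj G x (lookup xs j) ≡ (0 ≡ᵇ toℕ j)
    ipath-head-adj x (y ∷ ys) ((_ , xy) , _) zero    = xy
    ipath-head-adj x (y ∷ ys) (_ , far)      (suc j) = proj₂ (All.lookup far (∈-lookup j))

    ipath-adj : ∀ xs → IPath xs → ∀ i j →
                adj G (lookup xs i) (lookup xs j) ≡ (suc (toℕ i) ≡ᵇ toℕ j) ∨ (suc (toℕ j) ≡ᵇ toℕ i)
    ipath-adj (x ∷ xs) (hd , ip) zero    zero    = irrefl G x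
    ipath-adj (x ∷ xs) (hd , ip) zero    (suc j) =
      trans (ipath-head-adj x xs hd j) (sym (Bool.∨-identityʳ (0 ≡ᵇ toℕ j)))
    ipath-adj (x ∷ xs) (hd , ip) (suc i) zero    =
      trans (Graph.sym G (lookup xs i) x) (ipath-head-adj x xs hd i)
    ipath-adj (x ∷ xs) (hd , ip) (suc i) (suc j) = ipath-adj xs ip i j

    ipath-minor : ∀ xs → IPath xs → t ≤ length xs → VertexMinor (Path t) G
    ipath-minor {t} xs ip t≤ = G , lc-done , f ,
      (λ eq → inject≤-injective t≤ t≤ _ _ (ipath-injective xs ip _ _ eq)) , adj-f
      where
      f : Fin t → Fin n
      f i = lookup xs (inject≤ i t≤)
      adj-f : ∀ i j → adj (Path t) i j ≡ adj G (f i) (f j)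
      adj-f i j with ipath-adj xs ip (inject≤ i t≤) (inject≤ j t≤)
      ... | eq rewrite toℕ-inject≤ i t≤ | toℕ-inject≤ j t≤ = sym eq

  -- Agreement on the columns of `P` suffices: two distinct vertices of the path include one of `P`.
  ipath-transport : (G G' : Graph n) (p : Fin n) (P : List (Fin n)) →
                    All (λ y → ∀ x → adj G' x y ≡ adj G x y) P → IPath G (p ∷ P) → IPath G' (p ∷ P)
  ipath-transport G G' p []      _          _ = tt , tt
  ipath-transport G G' p (q ∷ P) (eq ∷ eqs) (((p≢q , pq) , far) , ip) =
    ((p≢q , trans (eq p) pq) , All.zipWith (λ (e , ne , pz) → ne , trans (e p) pz) (eqs , far)) ,
    ipath-transport G G' q P eqs ip

  -- Half graphs

  -- Here `p` precedes `p'`. `ca` and `cb` tell whether each side is a clique or independent; with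
  -- `h` true, every a-vertex sees the b-vertices of its own and of all later pairs.
  record PairRel (G : Graph n) (ca cb h : Bool) (p p' : Fin n × Fin n) : Set where
    constructor pairRel
    field
      a≢a' : proj₁ p ≢ proj₁ p'
      a≢b' : proj₁ p ≢ proj₂ p'
      b≢a' : proj₂ p ≢ proj₁ p'
      b≢b' : proj₂ p ≢ proj₂ p'
      aa'  : adj G (proj₁ p) (proj₁ p') ≡ ca
      ab'  : adj G (proj₁ p) (proj₂ p') ≡ h
      ba'  : adj G (proj₂ p) (proj₁ p') ≡ not h
      bb'  : adj G (proj₂ p) (proj₂ p') ≡ cb

  HalfGraph : Graph n → (ca cb h : Bool) → List (Fin n × Fin n) → Set
  HalfGraph G ca cb h []              = ⊤
  HalfGraph G ca cb h ((a , b) ∷ ps) =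
    (a ≢ b × adj G a b ≡ h) × All (PairRel G ca cb h (a , b)) ps × HalfGraph G ca cb h ps

  halfgraph-map : (G G' : Graph n) {ca cb h ca' cb' h' : Bool} →
    (R : Fin n × Fin n → Set) →
    (∀ {a b} → R (a , b) → a ≢ b → adj G a b ≡ h → adj G' a b ≡ h') →
    (∀ {p p'} → R p → R p' → PairRel G ca cb h p p' → PairRel G' ca' cb' h' p p') →
    ∀ ps → All R ps → HalfGraph G ca cb h ps → HalfGraph G' ca' cb' h' ps
  halfgraph-map G G' R f g []       _        _ = tt
  halfgraph-map G G' R f g (p ∷ ps) (r ∷ rs) ((ne , e) , rel , hg) =
    (ne , f r ne e) , All.zipWith (λ (r' , x) → g r r' x) (rs , rel) , halfgraph-map G G' R f g ps rs hg

  -- The path p ∷ P (last vertex first) is attached, through p only, to all the b's of a half graph with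
  -- independent a's. If the b's are independent, local complementation at b₁ and then at a₁ makes a₁ the new
  -- last vertex and the b's a clique; if they form a clique, local complementation at b₁ makes b₁
  -- the new last vertex and the b's independent again.
  record Growing (G : Graph n) (cb : Bool) (p : Fin n) (P : List (Fin n)) (ps : List (Fin n × Fin n)) : Set where
    constructor growing
    field
      path     : IPath G (p ∷ P)
      attached : All (λ (a , b) → p ≢ a × p ≢ b × adj G p a ≡ false × adj G p b ≡ true) ps
      clear    : All (λ q → All (λ (a , b) → (q ≢ a × q ≢ b) × adj G a q ≡ false × adj G b q ≡ false) ps) P
      half     : HalfGraph G false cb true ps

  -- The two cases alternate, as each flips `cb`. A consumed pair adds one vertex to the path, so
  -- the sum of the two lengths is preserved.
  grow : (G : Graph n) (cb : Bool) (p : Fin n) (P : List (Fin n)) (ps : List (Fin n × Fin n)) →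
         Growing G cb p P ps → t ≤ length (p ∷ P) + length ps → VertexMinor (Path t) G
  grow G cb p P [] gr t≤ =
    ipath-minor G (p ∷ P) (Growing.path gr) (≤-trans t≤ (≤-reflexive (+-identityʳ _)))
  grow {n} {t} G true p P ((a , b) ∷ ps) (growing ip ((p≢a , p≢b , pa , pb) ∷ att) clr ((a≢b , ab) , rel , hg)) t≤ =
    minor-lc t G b (grow G₁ false b (p ∷ P) ps (growing ip₁ att₁ clr₁ hg₁)
      (≤-trans t≤ (≤-reflexive (+-suc _ (length ps)))))
    where
    G₁ = localComp G b
    bp : adj G b p ≡ true
    bp = trans (Graph.sym G b p) pb
    bP : All (λ q → q ≢ b × adj G b q ≡ false) P
    bP = All.map (λ { (((_ , q≢b) , _ , bq) ∷ _) → q≢b , bq }) clr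
    offP : All (λ q → ∀ x → adj G₁ x q ≡ adj G x q) P
    offP = All.map (λ (_ , bq) x → lc-offʳ G b x bq) bP
    b-row : ∀ y → adj G₁ b y ≡ adj G b y
    b-row y = lc-offˡ G b y (irrefl G b)
    ip₁ : IPath G₁ (b ∷ p ∷ P)
    ip₁ = (((λ eq → p≢b (sym eq)) , trans (b-row p) bp) ,
           All.map (λ {q} (q≢b , bq) → (λ eq → q≢b (sym eq)) , trans (b-row q) bq) bP) ,
          ipath-transport G G₁ p P offP ip
    att₁ : All (λ (a' , b') → b ≢ a' × b ≢ b' × adj G₁ b a' ≡ false × adj G₁ b b' ≡ true) ps
    att₁ = All.map (λ r → PairRel.b≢a' r , PairRel.b≢b' r , trans (b-row _) (PairRel.ba' r) , trans (b-row _) (PairRel.bb' r)) rel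
    clr₁ : All (λ q → All (λ (a' , b') → (q ≢ a' × q ≢ b') × adj G₁ a' q ≡ false × adj G₁ b' q ≡ false) ps) (p ∷ P)
    clr₁ = All.zipWith (λ ((p≢a' , p≢b' , pa' , pb') , r) →
             (p≢a' , p≢b') , trans (lc-offˡ G b p (PairRel.ba' r)) (trans (Graph.sym G _ p) pa') ,
             trans (lc-on G b (λ eq → p≢b' (sym eq)) (PairRel.bb' r) bp) (cong not (trans (Graph.sym G _ p) pb'))) (att , rel)
           ∷ All.zipWith (λ { (off , _ ∷ cs) → All.map (λ (ne , aq , bq) → ne , trans (off _) aq , trans (off _) bq) cs })
               (offP , clr)
    hg₁ : HalfGraph G₁ false false true ps
    hg₁ = halfgraph-map G G₁ (λ p' → PairRel G false true true (a , b) p')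
      (λ r _ e → trans (lc-offˡ G b _ (PairRel.ba' r)) e)
      (λ r r' x → 
        pairRel (PairRel.a≢a' x) (PairRel.a≢b' x) (PairRel.b≢a' x) (PairRel.b≢b' x) (trans (lc-offˡ G b _ (PairRel.ba' r)) (PairRel.aa' x))
          (trans (lc-offˡ G b _ (PairRel.ba' r)) (PairRel.ab' x)) (trans (lc-offʳ G b _ (PairRel.ba' r')) (PairRel.ba' x))
          (trans (lc-on G b (PairRel.b≢b' x) (PairRel.bb' r) (PairRel.bb' r')) (cong not (PairRel.bb' x))))
      ps rel hg
  grow {n} {t} G false p P ((a , b) ∷ ps) (growing ip ((p≢a , p≢b , pa , pb) ∷ att) clr ((a≢b , ab) , rel , hg)) t≤ =
    minor-lc t G b (minor-lc t G₁ a (grow G₂ true a (p ∷ P) ps (growing ip₂ att₂ clr₂ hg₂)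
      (≤-trans t≤ (≤-reflexive (+-suc _ (length ps))))))
    where
    G₁ = localComp G b
    G₂ = localComp G₁ a
    bp : adj G b p ≡ true
    bp = trans (Graph.sym G b p) pb
    ba : adj G b a ≡ true
    ba = trans (Graph.sym G b a) ab
    -- The new path edge: `p` and `a` are non-adjacent neighbours of `b`, so complementing at `b`
    -- joins them.
    ap₁ : adj G₁ a p ≡ true
    ap₁ = trans (lc-on G b (λ eq → p≢a (sym eq)) ba bp) (cong not (trans (Graph.sym G a p) pa))
    Later : Fin n × Fin n → Set
    Later (a' , b') = PairRel G false false true (a , b) (a' , b') ×
                      (∀ x → adj G₁ x a' ≡ adj G x a') × (∀ x → adj G₁ x b' ≡ adj G x b') ×
                      adj G₁ a a' ≡ false × adj G₁ a b' ≡ true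
    later : All Later ps
    later = All.map (λ r →
              r , (λ x → lc-offʳ G b x (PairRel.ba' r)) , (λ x → lc-offʳ G b x (PairRel.bb' r)) ,
              trans (lc-offʳ G b a (PairRel.ba' r)) (PairRel.aa' r) ,
              trans (lc-offʳ G b a (PairRel.bb' r)) (PairRel.ab' r)) rel
    aP : All (λ q → (q ≢ a × adj G₁ a q ≡ false) × (∀ x → adj G₁ x q ≡ adj G x q)) P
    aP = All.map (λ { (((q≢a , _) , aq , bq) ∷ _) →
           (q≢a , trans (lc-offʳ G b a bq) aq) , λ x → lc-offʳ G b x bq }) clr
    offP : All (λ q → ∀ x → adj G₂ x q ≡ adj G x q) P
    offP = All.map (λ ((_ , aq) , off) x → trans (lc-offʳ G₁ a x aq) (off x)) aP
    a-row : ∀ y → adj G₂ a y ≡ adj G₁ a y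
    a-row y = lc-offˡ G₁ a y (irrefl G₁ a)
    ip₂ : IPath G₂ (a ∷ p ∷ P)
    ip₂ = (((λ eq → p≢a (sym eq)) , trans (a-row p) ap₁) ,
           All.map (λ {q} ((q≢a , aq) , _) → (λ eq → q≢a (sym eq)) , trans (a-row q) aq) aP) ,
          ipath-transport G G₂ p P offP ip
    att₂ : All (λ (a' , b') → a ≢ a' × a ≢ b' × adj G₂ a a' ≡ false × adj G₂ a b' ≡ true) ps
    att₂ = All.map (λ (r , _ , _ , aa' , ab') → PairRel.a≢a' r , PairRel.a≢b' r ,
             trans (a-row _) aa' , trans (a-row _) ab') later
    clr₂ : All (λ q → All (λ (a' , b') → (q ≢ a' × q ≢ b') × adj G₂ a' q ≡ false × adj G₂ b' q ≡ false) ps) (p ∷ P)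
    clr₂ = All.zipWith (λ ((p≢a' , p≢b' , pa' , pb') , (r , offa , offb , aa' , ab')) →
             (p≢a' , p≢b') ,
             trans (Graph.sym G₂ _ p) (trans (lc-offʳ G₁ a p aa') (trans (offa p) pa')) ,
             trans (Graph.sym G₂ _ p) (trans (lc-on G₁ a p≢b' ap₁ ab') (cong not (trans (offb p) pb')))) (att , later)
           ∷ All.zipWith (λ { (off , _ ∷ cs) → All.map (λ (ne , aq , bq) → ne , trans (off _) aq , trans (off _) bq) cs })
               (offP , clr)
    hg₂ : HalfGraph G₂ false true true ps
    hg₂ = halfgraph-map G G₂ Later
      (λ (r , offa , offb , aa' , ab') _ e → trans (lc-offˡ G₁ a _ aa') (trans (offb _) e))
      (λ (r , _ , _ , ra , rb) (r' , offa , offb , ra' , rb') x → 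
        pairRel (PairRel.a≢a' x) (PairRel.a≢b' x) (PairRel.b≢a' x) (PairRel.b≢b' x) (trans (lc-offˡ G₁ a _ ra) (trans (offa _) (PairRel.aa' x)))
          (trans (lc-offˡ G₁ a _ ra) (trans (offb _) (PairRel.ab' x))) (trans (lc-offʳ G₁ a _ ra') (trans (offa _) (PairRel.ba' x)))
          (trans (lc-on G₁ a (PairRel.b≢b' x) rb rb') (cong not (trans (offb _) (PairRel.bb' x)))))
      ps later hg

  halfgraph-path : (G : Graph n) (cb : Bool) (ps : List (Fin n × Fin n)) → HalfGraph G false cb true ps →
                   1 ≤ length ps → t ≤ length ps → VertexMinor (Path t) G
  halfgraph-path G cb ((a , b) ∷ ps) ((a≢b , ab) , rel , hg) _ t≤ =
    grow G cb a [] ps (growing (tt , tt)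
      (All.map (λ r → PairRel.a≢a' r , PairRel.a≢b' r , PairRel.aa' r , PairRel.ab' r) rel) [] hg) t≤

  -- With `h` false each b-vertex sees exactly the a-vertices of later pairs. Pairing it with the
  -- next a-vertex gives a half graph with `h` true, at the cost of one pair.
  shift : List (Fin n × Fin n) → List (Fin n × Fin n)
  shift []                          = []
  shift (_ ∷ [])                    = []
  shift ((a , b) ∷ (a' , b') ∷ ps) = (b , a') ∷ shift ((a' , b') ∷ ps)

  length-shift : (ps : List (Fin n × Fin n)) → length ps ≤ suc (length (shift ps))
  length-shift []            = z≤n
  length-shift (_ ∷ [])      = ≤-refl
  length-shift (_ ∷ p ∷ ps) = s≤s (length-shift (p ∷ ps))

  shift-All : {Q R : Fin n → Set} (p : Fin n × Fin n) (ps : List (Fin n × Fin n)) →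
              Q (proj₂ p) → All (λ (a , b) → R a × Q b) ps → All (λ (b , a) → Q b × R a) (shift (p ∷ ps))
  shift-All p []       q []              = []
  shift-All p (_ ∷ ps) q ((r , q') ∷ rs) = (q , r) ∷ shift-All _ ps q' rs

  halfgraph-shift : (G : Graph n) (ca cb : Bool) (ps : List (Fin n × Fin n)) →
                    HalfGraph G ca cb false ps → HalfGraph G cb ca true (shift ps)
  halfgraph-shift G ca cb []       _ = tt
  halfgraph-shift G ca cb (p ∷ []) _ = tt
  halfgraph-shift G ca cb ((a , b) ∷ (a' , b') ∷ ps) (_ , r ∷ rs , hg@((a'≢b' , a'b') , rs' , _)) =
    (PairRel.b≢a' r , PairRel.ba' r) ,
    All.map (λ (((n1 , e1) , (n2 , e2)) , ((n3 , e3) , (n4 , e4))) → pairRel n1 n3 n2 n4 e1 e3 e2 e4)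
      (shift-All {Q = λ x → (b ≢ x × adj G b x ≡ cb) × (a' ≢ x × adj G a' x ≡ false)}
          {R = λ y → (b ≢ y × adj G b y ≡ true) × (a' ≢ y × adj G a' y ≡ ca)}
          (a' , b') ps ((PairRel.b≢b' r , PairRel.bb' r) , (a'≢b' , a'b'))
          (All.zipWith (λ (s , s') → 
              ((PairRel.b≢a' s , PairRel.ba' s) , (PairRel.a≢a' s' , PairRel.aa' s')) ,
              ((PairRel.b≢b' s , PairRel.bb' s) , (PairRel.a≢b' s' , PairRel.ab' s')))
            (rs , rs'))) ,
    halfgraph-shift G ca cb ((a' , b') ∷ ps) hg

  -- If the a-vertices form a clique, complementing at `v` makes them independent. If both sides are
  -- cliques, `v` sees everything and the edges between the sides are complemented as well; `shift`
  -- repairs this and uses up the spare pair.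
  halfgraph-minor : (G : Graph n) (ca cb : Bool) (v : Fin n) (ps : List (Fin n × Fin n)) →
                    HalfGraph G ca cb true ps →
                    All (λ (a , b) → adj G v a ≡ true × adj G v b ≡ cb) ps →
                    1 ≤ t → suc t ≤ length ps → VertexMinor (Path t) G
  halfgraph-minor G false cb v ps hg _ 1≤t t< =
    halfgraph-path G cb ps hg (≤-trans 1≤t t≤) t≤
    where t≤ = ≤-trans (n≤1+n _) t<
  halfgraph-minor {t = t} G true false v ps hg vs 1≤t t< =
    minor-lc t G v (halfgraph-path (localComp G v) false ps
      (halfgraph-map G (localComp G v) _ (λ (_ , vb) _ e → trans (lc-offʳ G v _ vb) e)
        (λ (va , vb) (va' , vb') x → 
          pairRel (PairRel.a≢a' x) (PairRel.a≢b' x) (PairRel.b≢a' x) (PairRel.b≢b' x) (trans (lc-on G v (PairRel.a≢a' x) va va') (cong not (PairRel.aa' x)))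
            (trans (lc-offʳ G v _ vb') (PairRel.ab' x)) (trans (lc-offˡ G v _ vb) (PairRel.ba' x)) (trans (lc-offˡ G v _ vb) (PairRel.bb' x)))
        ps vs hg)
      (≤-trans 1≤t t≤) t≤)
    where t≤ = ≤-trans (n≤1+n _) t<
  halfgraph-minor {t = t} G true true v ps hg vs 1≤t t< =
    minor-lc t G v (halfgraph-path (localComp G v) false (shift ps)
      (halfgraph-shift (localComp G v) false false ps
        (halfgraph-map G (localComp G v) _ (λ (va , vb) ne e → trans (lc-on G v ne va vb) (cong not e))
          (λ (va , vb) (va' , vb') x → 
            pairRel (PairRel.a≢a' x) (PairRel.a≢b' x) (PairRel.b≢a' x) (PairRel.b≢b' x) (trans (lc-on G v (PairRel.a≢a' x) va va') (cong not (PairRel.aa' x)))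
              (trans (lc-on G v (PairRel.a≢b' x) va vb') (cong not (PairRel.ab' x))) (trans (lc-on G v (PairRel.b≢a' x) vb va') (cong not (PairRel.ba' x)))
              (trans (lc-on G v (PairRel.b≢b' x) vb vb') (cong not (PairRel.bb' x))))
          ps vs hg))
      (≤-trans 1≤t t≤) t≤)
    where
    t≤ : t ≤ length (shift ps)
    t≤ = ≤-pred (≤-trans t< (length-shift ps))

  -- Twisted paths: vertices labelled by letters, in which an earlier vertex with letter α and a later one with
  -- letter β have adjacency M α β, complemented when they are consecutive.

  module _ {Λ : Set} where

    Far : Graph n → (Λ → Λ → Bool) → Fin n → Λ → List (Fin n × Λ) → Set
    Far G M x α = All (λ (z , γ) → x ≢ z × adj G x z ≡ M α γ)

    TwistedHead : Graph n → (Λ → Λ → Bool) → Fin n → Λ → List (Fin n × Λ) → Set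
    TwistedHead G M x α []             = ⊤
    TwistedHead G M x α ((y , β) ∷ xs) = (x ≢ y × adj G x y ≡ not (M α β)) × Far G M x α xs

    Twisted : Graph n → (Λ → Λ → Bool) → List (Fin n × Λ) → Set
    Twisted G M []             = ⊤
    Twisted G M ((x , α) ∷ xs) = TwistedHead G M x α xs × Twisted G M xs

    module _ (G : Graph n) (M : Λ → Λ → Bool) where

      twisted-suffix : ∀ xs ys → Twisted G M (xs ++ ys) → Twisted G M ys
      twisted-suffix []       ys tw       = tw
      twisted-suffix (_ ∷ xs) ys (_ , tw) = twisted-suffix xs ys tw

      twisted-prefix : ∀ xs ys → Twisted G M (xs ++ ys) → Twisted G M xs
      twisted-prefix []                 ys tw                  = tt
      twisted-prefix ((x , α) ∷ [])     ys (hd , tw)           = tt , tt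
      twisted-prefix ((x , α) ∷ y ∷ xs) ys ((hd , far) , tw) =
        (hd , ++⁻ˡ xs far) , twisted-prefix (y ∷ xs) ys tw

      twisted-far : ∀ x α us s vs → Twisted G M ((x , α) ∷ us ++ s ∷ vs) → Far G M x α vs
      twisted-far x α []       s vs ((_ , far) , _) = far
      twisted-far x α (u ∷ us) s vs ((_ , far) , _) with ++⁻ʳ us far
      ... | _ ∷ far' = far'

      twisted-zero : ∀ xs → Twisted G M xs → All (λ (_ , α) → All (λ (_ , β) → M α β ≡ false) xs) xs →
                     IPath G (map proj₁ xs)
      twisted-zero []                         tw                         zs = tt
      twisted-zero ((x , α) ∷ [])             tw                         zs = tt , tt
      twisted-zero ((x , α) ∷ (y , β) ∷ xs) (((x≢y , xy) , far) , tw) ((_ ∷ z ∷ zfar) ∷ zs) =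
        ((x≢y , trans xy (cong not z)) , far⁺ far zfar) ,
        twisted-zero ((y , β) ∷ xs) tw (All.map (λ { (_ ∷ zs) → zs }) zs)
        where
        far⁺ : ∀ {xs} → Far G M x α xs → All (λ (_ , β) → M α β ≡ false) xs →
               All (λ z → x ≢ z × adj G x z ≡ false) (map proj₁ xs)
        far⁺ []               []       = []
        far⁺ ((ne , e) ∷ far) (z ∷ zs) = (ne , trans e z) ∷ far⁺ far zs

    infixl 6 _⊕_
    -- The outer product of row `a` with itself is added: a step of symmetric Gaussian elimination
    -- over GF(2).
    _⊕_ : (Λ → Λ → Bool) → Λ → Λ → Λ → Bool
    (M ⊕ a) β γ = M β γ xor (M a β ∧ M a γ)

    -- Since `x` is not consecutive with any vertex of `xs`, its adjacencies are entries of `M`, so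
    -- the update depends on letters alone.
    twisted-lc : (G : Graph n) (M : Λ → Λ → Bool) (x : Fin n) (a : Λ) → ∀ xs →
                 Far G M x a xs → Twisted G M xs → Twisted (localComp G x) (M ⊕ a) xs
    twisted-lc G M x a []                 _                         _ = tt
    twisted-lc G M x a ((y , β) ∷ [])     _                         _ = tt , tt
    twisted-lc G M x a ((y , β) ∷ (z , γ) ∷ xs) ((_ , xy) ∷ far@((_ , xz) ∷ far')) (((y≢z , yz) , yfar) , tw) =
      ((y≢z , trans (update y≢z yz xz) (sym (Bool.not-distribˡ-xor (M β γ) _))) ,
       All.zipWith (λ ((y≢w , yw) , (_ , xw)) → y≢w , update y≢w yw xw) (yfar , far')) ,
      twisted-lc G M x a ((z , γ) ∷ xs) far tw
      where
      update : ∀ {w c δ} → y ≢ w → adj G y w ≡ c → adj G x w ≡ M a δ →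
             adj (localComp G x) y w ≡ c xor (M a β ∧ M a δ)
      update y≢w refl xw = trans (lc-val G x y≢w) (cong₂ (λ p q → adj G y _ xor (p ∧ q)) xy xw)

  split-at : {A : Set} (l r : ℕ) (xs : List A) → l + suc r ≤ length xs →
             ∃[ us ] ∃[ s ] ∃[ vs ] (xs ≡ us ++ s ∷ vs × length us ≡ l × r ≤ length vs)
  split-at zero    r (x ∷ xs) (s≤s le) = [] , x , xs , refl , refl , le
  split-at (suc l) r (x ∷ xs) (s≤s le) with split-at l r xs le
  ... | us , s , vs , refl , eq , le' = x ∷ us , s , vs , refl , cong suc eq , le'

  -- Three segments of the previous length and two separators. Pivot vertices come from the first
  -- two segments, and the separators keep them from being consecutive with the part that is kept.
  symLength : ℕ → ℕ → ℕ
  symLength t zero    = t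
  symLength t (suc u) = L + suc (L + suc L) where L = symLength t u

  symLength-≥ : ∀ t u → t ≤ symLength t u
  symLength-≥ t zero    = ≤-refl
  symLength-≥ t (suc u) = ≤-trans (symLength-≥ t u) (m≤m+n _ _)

  module _ {Λ : Set} (_≟Λ_ : (α β : Λ) → Dec (α ≡ β)) where

    remove : Λ → List Λ → List Λ
    remove a = filter (λ α → ¬? (α ≟Λ a))

    length-remove : ∀ {a live u} → a ∈ live → length live ≤ suc u → length (remove a live) ≤ u
    length-remove {a} a∈ le =
      ≤-pred (≤-trans (filter-notAll _ _ (Any.map (λ { refl ne → ne refl }) a∈)) le)

  -- Removing the letters one at a time: the live letters are those whose row of M need not vanish.
  module _ {Λ : Set} (_≟Λ_ : (α β : Λ) → Dec (α ≡ β)) (P : Λ → Set) where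

    ZeroIn : (Λ → Λ → Bool) → List (Fin n × Λ) → Λ → Set
    ZeroIn M xs α = All (λ (_ , β) → M α β ≡ false) xs

    Covered : (Λ → Λ → Bool) → List Λ → List (Fin n × Λ) → Set
    Covered M live xs = All (λ (_ , α) → α ∈ live ⊎ ZeroIn M xs α) xs

    Symmetric : (Λ → Λ → Bool) → Set
    Symmetric M = ∀ {α β} → P α → P β → M α β ≡ M β α

    ⊕-symmetric : ∀ M a → Symmetric M → Symmetric (M ⊕ a)
    ⊕-symmetric M a sy {α} {β} p q = cong₂ _xor_ (sy p q) (Bool.∧-comm (M a α) (M a β))

    -- A letter leaves the live list either because its row has become zero or because no remaining
    -- vertex carries it.
    covered-remove : ∀ {M M' live a} {xs ys : List (Fin n × Λ)} → Covered M live xs →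
                     (∀ {p} → p ∈ ys → p ∈ xs) → (∀ {β} → P β → ZeroIn M xs β → ZeroIn M' ys β) →
                     ZeroIn M' ys a ⊎ All (λ (_ , α) → α ≢ a) ys → All (P ∘ proj₂) xs →
                     Covered M' (remove _≟Λ_ a live) ys
    covered-remove {M' = M'} {live = live} {a} {ys = ys} cov sub zero-pres a-dead Ps = All.tabulate covers
      where
      covers : ∀ {p} → p ∈ ys → proj₂ p ∈ remove _≟Λ_ a live ⊎ ZeroIn M' ys (proj₂ p)
      covers {x , α} p∈ with All.lookup cov (sub p∈) | α ≟Λ a
      ... | inj₂ z   | _      = inj₂ (zero-pres (All.lookup Ps (sub p∈)) z)
      ... | inj₁ α∈  | no ne  = inj₁ (∈-filter⁺ _ α∈ ne)
      ... | inj₁ _   | yes refl = inj₂ ([ (λ z → z) , (λ ne → ⊥-elim (All.lookup ne p∈ refl)) ]′ a-dead)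

    find-letter : (a : Λ) (xs : List (Fin n × Λ)) →
                  (∃[ x ] ∃[ us ] ∃[ vs ] xs ≡ us ++ (x , a) ∷ vs) ⊎ All (λ (_ , α) → α ≢ a) xs
    find-letter a xs with Any.any? (λ (_ , α) → α ≟Λ a) xs
    ... | no ¬any = inj₂ (¬Any⇒All¬ xs ¬any)
    ... | yes any with find any
    ... | (x , _) , x∈ , refl with ∈-∃++ x∈
    ... | us , vs , eq = inj₁ (x , us , vs , eq)

    private
      -- `M b b` is the pivot: row `b` is added to itself.
      row-dies : ∀ M b (ys : List (Fin n × Λ)) → M b b ≡ true → ZeroIn (M ⊕ b) ys b
      row-dies M b ys bb = All.tabulate (λ {(_ , γ)} _ → dies γ)
        where
        dies : ∀ γ → (M ⊕ b) b γ ≡ false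
        dies γ rewrite bb with M b γ
        ... | true  = refl
        ... | false = refl

      zero-stays : ∀ M b {β} {xs ys : List (Fin n × Λ)} → (∀ {p} → p ∈ ys → p ∈ xs) → M b β ≡ false →
                   ZeroIn M xs β → ZeroIn (M ⊕ b) ys β
      zero-stays M b {β} sub bβ z = All.tabulate (λ {(_ , γ)} p∈ → stays γ (All.lookup z (sub p∈)))
        where
        stays : ∀ γ → M β γ ≡ false → (M ⊕ b) β γ ≡ false
        stays γ eq rewrite eq | bβ = refl

      restrict : {Q : Fin n × Λ → Set} {xs ys : List (Fin n × Λ)} → (∀ {p} → p ∈ ys → p ∈ xs) → All Q xs → All Q ys
      restrict sub qs = All.tabulate (λ p∈ → All.lookup qs (sub p∈))

    -- Each round retires one live letter. A letter missing from its segment is retired by passing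
    -- to that segment. Otherwise a diagonal entry one is a pivot; if `M a a` is zero, a letter `b`
    -- with `M a b` one is sought, and where `M b b` is zero too, complementing at a vertex of
    -- letter `a` makes it one.
    symmetric-minor : ∀ u live → length live ≤ u → (G : Graph n) (M : Λ → Λ → Bool) → Symmetric M →
                      ∀ xs → Twisted G M xs → All (P ∘ proj₂) xs → Covered M live xs →
                      symLength t u ≤ length xs → VertexMinor (Path t) G
    symmetric-minor u [] _ G M sy xs tw Ps cov le =
      ipath-minor G (map proj₁ xs)
        (twisted-zero G M xs tw (All.map (λ { (inj₁ ()) ; (inj₂ z) → z }) cov))
        (≤-trans (symLength-≥ _ u) (≤-trans le (≤-reflexive (sym (length-map proj₁ xs)))))
    symmetric-minor {n} {t} (suc u) live@(a ∷ live') le₀ G M sy xs tw Ps cov le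
      with split-at (symLength t u) (symLength t u + suc (symLength t u)) xs le
    ... | U , s₁ , R , refl , lenU , leR with split-at (symLength t u) (symLength t u) R leR
    ... | V , s₂ , W , refl , lenV , leW = cases
      where
      All-xs = U ++ s₁ ∷ V ++ s₂ ∷ W
      U⊆ : ∀ {p} → p ∈ U → p ∈ All-xs
      U⊆ = ∈-++⁺ˡ
      VW⊆ : ∀ {p} → p ∈ V ++ s₂ ∷ W → p ∈ All-xs
      VW⊆ p∈ = ∈-++⁺ʳ U (there p∈)
      V⊆ : ∀ {p} → p ∈ V → p ∈ All-xs
      V⊆ p∈ = VW⊆ (∈-++⁺ˡ p∈)
      W⊆VW : ∀ {p} → p ∈ W → p ∈ V ++ s₂ ∷ W
      W⊆VW p∈ = ∈-++⁺ʳ V (there p∈)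
      W⊆ : ∀ {p} → p ∈ W → p ∈ All-xs
      W⊆ p∈ = VW⊆ (W⊆VW p∈)
      twVW : Twisted G M (V ++ s₂ ∷ W)
      twVW = proj₂ (twisted-suffix G M U _ tw)
      twW : Twisted G M W
      twW = proj₂ (twisted-suffix G M V _ twVW)
      row-zero : ∀ {y b β} → (y , b) ∈ All-xs → P β → ZeroIn M All-xs β → M b β ≡ false
      row-zero b∈ pβ z = trans (sy (All.lookup Ps b∈) pβ) (All.lookup z b∈)
      recurse : ∀ {b} → b ∈ live → (G' : Graph n) (M' : Λ → Λ → Bool) → Symmetric M' →
                ∀ ys → (∀ {p} → p ∈ ys → p ∈ All-xs) → Twisted G' M' ys →
                (∀ {β} → P β → ZeroIn M All-xs β → ZeroIn M' ys β) →
                ZeroIn M' ys b ⊎ All (λ (_ , α) → α ≢ b) ys →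
                symLength t u ≤ length ys → VertexMinor (Path t) G'
      recurse b∈ G' M' sy' ys sub tw' pres dead len =
        symmetric-minor u _ (length-remove _≟Λ_ b∈ le₀) G' M' sy' ys tw' (restrict sub Ps)
          (covered-remove cov sub pres dead Ps) len
      cases : VertexMinor (Path t) G
      cases with find-letter a U
      ... | inj₂ ne = recurse (here refl) G M sy U U⊆ (twisted-prefix G M U _ tw) (λ _ → restrict U⊆) (inj₂ ne)
                        (≤-reflexive (sym lenU))
      ... | inj₁ (x , us , vs , refl) = cases-a (M a a) refl
        where
        xa∈ : (x , a) ∈ All-xs
        xa∈ = U⊆ (∈-++⁺ʳ us (here refl))
        farVW : Far G M x a (V ++ s₂ ∷ W)
        farVW = twisted-far G M x a vs s₁ _
                  (twisted-suffix G M us _ (subst (Twisted G M) (++-assoc us _ _) tw))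
        farW : Far G M x a W
        farW with ++⁻ʳ V farVW
        ... | _ ∷ far = far
        cases-a : ∀ c → M a a ≡ c → VertexMinor (Path t) G
        cases-a true aa =
          minor-lc t G x (recurse (here refl) (localComp G x) (M ⊕ a) (⊕-symmetric M a sy) W W⊆
            (twisted-lc G M x a W farW twW) (λ pβ z → zero-stays M a W⊆ (row-zero xa∈ pβ z) z)
            (inj₁ (row-dies M a W aa)) leW)
        cases-a false aa with Any.any? (λ b → M a b Bool.≟ true) live'
        -- Row `a` is already zero: it vanishes at live letters by the failed search and at the
        -- others by symmetry.
        ... | no ¬b = recurse (here refl) G M sy U U⊆ (twisted-prefix G M U _ tw) (λ _ → restrict U⊆)
                        (inj₁ (restrict U⊆ (All.tabulate zero-a))) (≤-reflexive (sym lenU))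
          where
          zero-a : ∀ {p} → p ∈ All-xs → M a (proj₂ p) ≡ false
          zero-a {y , β} p∈ with All.lookup cov p∈
          ... | inj₂ z            = row-zero xa∈ (All.lookup Ps p∈) z
          ... | inj₁ (here refl)  = aa
          ... | inj₁ (there β∈) with M a β in eq
          ... | false = refl
          ... | true  = ⊥-elim (¬b (lose β∈ eq))
        ... | yes any-b with find any-b
        ... | b , b∈ , ab with find-letter b V
        ... | inj₂ ne = recurse (there b∈) G M sy V V⊆ (twisted-prefix G M V _ twVW) (λ _ → restrict V⊆) (inj₂ ne)
                          (≤-reflexive (sym lenV))
        ... | inj₁ (y , us' , vs' , refl) = cases-b (M b b) refl
          where
          yb∈ : (y , b) ∈ All-xs
          yb∈ = V⊆ (∈-++⁺ʳ us' (here refl))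
          far-y : ∀ {G' M'} → Twisted G' M' (V ++ s₂ ∷ W) → Far G' M' y b W
          far-y {G'} {M'} tw' = twisted-far G' M' y b vs' s₂ W
            (twisted-suffix G' M' us' _ (subst (Twisted G' M') (++-assoc us' _ _) tw'))
          cases-b : ∀ c → M b b ≡ c → VertexMinor (Path t) G
          cases-b true bb =
            minor-lc t G y (recurse (there b∈) (localComp G y) (M ⊕ b) (⊕-symmetric M b sy) W W⊆
              (twisted-lc G M y b W (far-y twVW) twW) (λ pβ z → zero-stays M b W⊆ (row-zero yb∈ pβ z) z)
              (inj₁ (row-dies M b W bb)) leW)
          cases-b false bb =
            minor-lc t G x (minor-lc t G₁ y (recurse (there b∈) (localComp G₁ y) (M₁ ⊕ b)
              (⊕-symmetric M₁ b (⊕-symmetric M a sy)) W W⊆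
              (twisted-lc G₁ M₁ y b W (far-y tw₁) (proj₂ (twisted-suffix G₁ M₁ V _ tw₁)))
              (λ pβ z → zero-stays M₁ b W⊆VW (stays₁ (row-zero xa∈ pβ z) (row-zero yb∈ pβ z))
                          (zero-stays M a VW⊆ (row-zero xa∈ pβ z) z))
              (inj₁ (row-dies M₁ b W bb₁)) leW))
            where
            G₁ = localComp G x
            M₁ = M ⊕ a
            tw₁ : Twisted G₁ M₁ (V ++ s₂ ∷ W)
            tw₁ = twisted-lc G M x a _ farVW twVW
            -- The diagonal entry grows by the square of `M a b`.
            bb₁ : M₁ b b ≡ true
            bb₁ rewrite bb | ab = refl
            stays₁ : ∀ {β} → M a β ≡ false → M b β ≡ false → M₁ b β ≡ false
            stays₁ aβ bβ rewrite aβ | bβ | ab = refl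

-- Shallow and deep vertex sets

module Depth where

  open import Defs hiding (sym)
  open FiniteSets
  open import Data.Nat using (ℕ; zero; suc; _+_; _≤_; z≤n; _≤′_; ≤′-reflexive; ≤′-step)
  open import Data.Nat.Properties using (≤⇒≤′)
  open import Data.Bool using (Bool)
  import Data.Bool.Properties as Bool
  open import Data.Fin using (Fin; zero; suc; _≟_; inject≤)
  open import Data.Fin.Properties using (any?; inject≤-injective)
  open import Data.Fin.Subset using (Subset; _∈_; _∉_; _⊆_; Nonempty)
  open import Data.Fin.Subset.Properties using (_∈?_; nonempty?; anySubset?)
  open import Data.Vec using (Vec; lookup; tabulate)
  open import Data.Vec.Properties using (lookup∘tabulate)
  open import Data.Product using (Σ; ∃-syntax; _×_; _,_; proj₁; proj₂)
  open import Data.Empty using (⊥-elim)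
  open import Relation.Nullary using (¬_; Dec; yes; no; ¬?; _×-dec_; _→-dec_)
  open import Relation.Binary.PropositionalEquality using (_≡_; _≢_; refl; sym; trans; subst)

  private
    variable
      n : ℕ

  fiber : {L : ℕ} → (Fin n → Fin L) → Subset n → Fin L → Subset n
  fiber c B i = ⟪ (λ x → (x ∈? B) ×-dec (c x ≟ i)) ⟫

  ∈-fiber⁺ : {L : ℕ} (c : Fin n → Fin L) {B : Subset n} {x : Fin n} {i : Fin L} → x ∈ B → c x ≡ i → x ∈ fiber c B i
  ∈-fiber⁺ c {B} {x} {i} x∈ eq = ∈⟪⟫⁺ (λ x → (x ∈? B) ×-dec (c x ≟ i)) (x∈ , eq)

  ∈-fiber⁻ : {L : ℕ} (c : Fin n → Fin L) {B : Subset n} {x : Fin n} {i : Fin L} → x ∈ fiber c B i → x ∈ B × c x ≡ i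
  ∈-fiber⁻ c {B} {x} {i} = ∈⟪⟫⁻ (λ x → (x ∈? B) ×-dec (c x ≟ i))

  without : Fin n → Subset n → Subset n
  without p B = ⟪ (λ x → (x ∈? B) ×-dec ¬? (x ≟ p)) ⟫

  ∈-without⁺ : {p x : Fin n} {B : Subset n} → x ∈ B → x ≢ p → x ∈ without p B
  ∈-without⁺ {p = p} {B = B} x∈ ne = ∈⟪⟫⁺ (λ x → (x ∈? B) ×-dec ¬? (x ≟ p)) (x∈ , ne)

  ∈-without⁻ : {p x : Fin n} {B : Subset n} → x ∈ without p B → x ∈ B × x ≢ p
  ∈-without⁻ {p = p} {B = B} = ∈⟪⟫⁻ (λ x → (x ∈? B) ×-dec ¬? (x ≟ p))

  -- Only rows inside `U` are typed, against columns outside; the reverse direction is the same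
  -- condition for the complement of `U`.
  Separates : {L M : ℕ} → Graph n → (Fin n → Fin L) → Subset n → Subset L → (Fin n → Fin M) → Set
  Separates G c B U ℓ = ∀ x x' y → x ∈ B → x' ∈ B → y ∈ B → c x ∈ U → c x' ∈ U → c y ∉ U →
                        ℓ x ≡ ℓ x' → adj G x y ≡ adj G x' y

  -- Depth≤ d B: the vertices of B are the leaves, all at depth d, of a rooted tree; the label is the child
  -- through which a leaf is reached. Four labels are kept besides the n vertices, so that a partition may
  -- be labelled by small numbers whatever n is.
  module _ (G : Graph n) (M : ℕ) where

    Depth≤ : ℕ → Subset n → Set
    Depth≤ zero    B = ∀ x y → x ∈ B → y ∈ B → x ≡ y
    Depth≤ (suc d) B = Σ (Vec (Fin (4 + n)) n) λ c →
      (∀ U → Σ (Vec (Fin M) n) λ ℓ → Separates G (lookup c) B U (lookup ℓ)) ×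
      (∀ i → Depth≤ d (fiber (lookup c) B i))

    separates? : {L : ℕ} (c : Fin n → Fin L) (B : Subset n) (U : Subset L) (ℓ : Fin n → Fin M) →
                 Dec (Separates G c B U ℓ)
    separates? c B U ℓ =
      all-of? any? λ x → all-of? any? λ x' → all-of? any? λ y →
        (x ∈? B) →-dec (x' ∈? B) →-dec (y ∈? B) →-dec (c x ∈? U) →-dec (c x' ∈? U) →-dec
        ¬? (c y ∈? U) →-dec (ℓ x ≟ ℓ x') →-dec (adj G x y Bool.≟ adj G x' y)

    abstract

      depth≤? : ∀ d B → Dec (Depth≤ d B)
      depth≤? zero    B = all-of? any? λ x → all-of? any? λ y → (x ∈? B) →-dec (y ∈? B) →-dec (x ≟ y)
      depth≤? (suc d) B = search-Vec any? n λ c →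
        all-of? anySubset? (λ U → search-Vec any? n (λ ℓ → separates? (lookup c) B U (lookup ℓ))) ×-dec
        all-of? any? (λ i → depth≤? d (fiber (lookup c) B i))

    depth-⊆ : ∀ d {B B'} → B' ⊆ B → Depth≤ d B → Depth≤ d B'
    depth-⊆ zero    sub f x y x∈ y∈ = f x y (sub x∈) (sub y∈)
    depth-⊆ (suc d) sub (c , types , classes) =
      c , (λ U → proj₁ (types U) , λ x x' y x∈ x'∈ y∈ → proj₂ (types U) x x' y (sub x∈) (sub x'∈) (sub y∈)) ,
      λ i → depth-⊆ d (λ x∈ → let x∈B , eq = ∈-fiber⁻ (lookup c) x∈ in ∈-fiber⁺ (lookup c) (sub x∈B) eq) (classes i)

    depth-node : ∀ d {B} (c : Fin n → Fin (4 + n)) →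
                 (∀ U → Σ (Fin n → Fin M) (Separates G c B U)) → (∀ i → Depth≤ d (fiber c B i)) → Depth≤ (suc d) B
    depth-node d {B} c types classes = tabulate c , types' , classes'
      where
      tab : ∀ x → lookup (tabulate c) x ≡ c x
      tab = lookup∘tabulate c
      types' : ∀ U → Σ (Vec (Fin M) n) λ ℓ → Separates G (lookup (tabulate c)) B U (lookup ℓ)
      types' U with types U
      ... | ℓ , sep = tabulate ℓ , λ x x' y x∈ x'∈ y∈ cx cx' cy eq →
        sep x x' y x∈ x'∈ y∈ (subst (_∈ U) (tab x) cx) (subst (_∈ U) (tab x') cx')
          (λ p → cy (subst (_∈ U) (sym (tab y)) p))
          (trans (sym (lookup∘tabulate ℓ x)) (trans eq (lookup∘tabulate ℓ x')))
      classes' : ∀ i → Depth≤ d (fiber (lookup (tabulate c)) B i)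
      classes' i = depth-⊆ d (λ {x} x∈ → let x∈B , eq = ∈-fiber⁻ (lookup (tabulate c)) x∈ in
        ∈-fiber⁺ c x∈B (trans (sym (tab x)) eq)) (classes i)

    -- A source of deep subsets: a partition with few row types between its parts costs a single
    -- level.
    deep-class : ∀ d {B} (c : Fin n → Fin (4 + n)) → (∀ U → Σ (Fin n → Fin M) (Separates G c B U)) →
                 ¬ Depth≤ (suc d) B → ∃[ i ] ¬ Depth≤ d (fiber c B i)
    deep-class d {B} c types deep =
      not-all any? (λ i → depth≤? d (fiber c B i)) (λ classes → deep (depth-node d c types classes))

    module _ (2≤M : 2 ≤ M) where

      depth-suc : ∀ d {B} → Depth≤ d B → Depth≤ (suc d) B
      depth-suc d {B} dep = depth-node d (λ _ → zero)
        (λ U → (λ _ → inject≤ {2} zero 2≤M) , λ x x' y _ _ _ x∈ _ y∉ → ⊥-elim (y∉ x∈))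
        (λ i → depth-⊆ d (λ x∈ → proj₁ (∈-fiber⁻ (λ _ → zero) {B} {i = i} x∈)) dep)

      depth-mono : ∀ {d d'} {B} → d ≤ d' → Depth≤ d B → Depth≤ d' B
      depth-mono {d} {d'} {B} le dep = go (≤⇒≤′ le)
        where
        go : ∀ {d'} → d ≤′ d' → Depth≤ d' B
        go (≤′-reflexive refl) = dep
        go (≤′-step le)        = depth-suc _ (go le)

      depth-subsingleton : ∀ d {B} → (∀ x y → x ∈ B → y ∈ B → x ≡ y) → Depth≤ d B
      depth-subsingleton d f = depth-mono {0} z≤n f

      deep-nonempty : ∀ d {B} → ¬ Depth≤ d B → Nonempty B
      deep-nonempty d {B} deep with nonempty? B
      ... | yes ne = ne
      ... | no ¬ne = ⊥-elim (deep (depth-subsingleton d (λ x y x∈ _ → ⊥-elim (¬ne (x , x∈)))))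

      -- A new root splits `p` from the rest. Rows of the rest have two types, by adjacency to `p`;
      -- in the other direction `p` is the only row.
      depth-without : ∀ d {B} p → Depth≤ d (without p B) → Depth≤ (suc d) B
      depth-without d {B} p dep = depth-node d c (λ U → ℓ , sep U) classes
        where
        c : Fin n → Fin (4 + n)
        c x with x ≟ p
        ... | yes _ = suc zero
        ... | no _  = zero
        c-p : ∀ {x} → x ≡ p → c x ≡ suc zero
        c-p {x} eq with x ≟ p
        ... | yes _ = refl
        ... | no ne = ⊥-elim (ne eq)
        c-other : ∀ {x} → x ≢ p → c x ≡ zero
        c-other {x} ne with x ≟ p
        ... | yes eq = ⊥-elim (ne eq)
        ... | no _   = refl
        ℓ : Fin n → Fin M
        ℓ x = inject≤ (bit (adj G x p)) 2≤M
        sep : ∀ U → Separates G c B U ℓ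
        sep U x x' y _ _ _ x∈ x'∈ y∉ eq with y ≟ p
        ... | yes refl = bit-injective (inject≤-injective 2≤M 2≤M _ _ eq)
        ... | no y≢p with x ≟ p | x' ≟ p
        ... | yes refl | yes refl = refl
        ... | no _     | _        = ⊥-elim (y∉ x∈)
        ... | yes _    | no _     = ⊥-elim (y∉ x'∈)
        classes : ∀ i → Depth≤ d (fiber c B i)
        classes zero = depth-⊆ d (λ {x} x∈ → let x∈B , eq = ∈-fiber⁻ c x∈ in
          ∈-without⁺ x∈B (λ x≡p → 0≢1 (trans (sym eq) (c-p x≡p)))) dep
          where
          0≢1 : _≢_ {A = Fin (4 + n)} zero (suc zero)
          0≢1 ()
        classes (suc i) = depth-subsingleton d (λ x y x∈ y∈ → trans (is-p x x∈) (sym (is-p y y∈)))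
          where
          is-p : ∀ x → x ∈ fiber c B (suc i) → x ≡ p
          is-p x x∈ with x ≟ p
          ... | yes eq = eq
          ... | no ne with trans (sym (c-other ne)) (proj₂ (∈-fiber⁻ c {B} x∈))
          ... | ()

-- Deep cuts in a rank-decomposition and the bound on robust families

module RankDecomposition where

  open import Defs hiding (sym)
  open FiniteSets
  open CutRank
  open Depth
  open import Data.Nat using (ℕ; zero; suc; _+_; _*_; _^_; _≤_; _<_; z≤n; s≤s)
  open import Data.Nat.Properties using (≤-refl; ≤-pred; +-mono-≤; +-suc; <-≤-trans)
  open import Data.Bool using (Bool; true; false)
  import Data.Bool.Properties as Bool
  open import Data.Fin using (Fin; zero; suc; _≟_; inject≤; inject₁; fromℕ; fromℕ<; combine; _↑ˡ_)
  open import Data.Fin.Properties using (any?; inject≤-injective; combine-injective; suc-injective; ↑ˡ-injective)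
  open import Data.Fin.Subset using (Subset; _∈_; _∉_; _⊆_; ∣_∣; ⊤)
  open import Data.Fin.Subset.Properties using (_∈?_; nonempty?; p⊂q⇒∣p∣<∣q∣; ∣p∣≤n; ∈⊤; ⊆⊤; x∉p⇒x∈∁p)
  open import Data.Vec using (Vec; []; _∷_; lookup; tabulate; replicate)
  open import Data.Vec.Properties using (lookup∘tabulate; lookup⇒[]=)
  open import Data.Product using (∃-syntax; _×_; _,_; proj₁; proj₂)
  open import Data.Sum using (_⊎_; inj₁; inj₂)
  open import Data.Empty using (⊥-elim)
  open import Function using (_∘_; Injective; mk⇔)
  open import Relation.Nullary using (¬_; Dec; yes; no; ¬?; _×-dec_)
  open import Relation.Binary.PropositionalEquality using (_≡_; _≢_; refl; sym; trans; cong; subst)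

  private
    variable
      n m : ℕ

  -- Indexed like the cycles of `HasCycle`, so that closing a simple path by an edge yields one.
  record SimplePath (E : Fin m → Fin m → Set) (a c : Fin m) : Set where
    field
      len       : ℕ
      vertex    : Fin (suc len) → Fin m
      start     : vertex zero ≡ a
      end       : vertex (fromℕ len) ≡ c
      edges     : ∀ i → E (vertex (inject₁ i)) (vertex (suc i))
      injective : Injective _≡_ _≡_ vertex

  module _ {E : Fin m → Fin m → Set} where
    open SimplePath

    path-from : ∀ {a c} (P : SimplePath E a c) (j : Fin (suc (len P))) → SimplePath E (vertex P j) c
    path-from P zero = record
      { len = len P ; vertex = vertex P ; start = refl ; end = end P ; edges = edges P ; injective = injective P }
    path-from record { len = suc l ; vertex = f ; end = e ; edges = es ; injective = inj } (suc j) =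
      path-from (record { len = l ; vertex = f ∘ suc ; start = refl ; end = e ; edges = es ∘ suc
                        ; injective = suc-injective ∘ inj }) j

    simple-path : ∀ {a c} → Conn E a c → SimplePath E a c
    simple-path {a} (_ , here) = record
      { len = 0 ; vertex = λ _ → a ; start = refl ; end = refl ; edges = λ () ; injective = λ { {zero} {zero} _ → refl } }
    simple-path {a} {c} (_ , step e w) with simple-path (_ , w)
    ... | P with any? (λ j → vertex P j ≟ a)
    ... | yes (j , eq) = subst (λ a → SimplePath E a c) eq (path-from P j)
    ... | no fresh = record
      { len = suc (len P) ; vertex = f ; start = refl ; end = end P ; edges = es ; injective = inj }
      where
      f : Fin (suc (suc (len P))) → Fin m
      f zero    = a
      f (suc i) = vertex P i
      es : ∀ i → E (f (inject₁ i)) (f (suc i))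
      es zero    = subst (E a) (sym (start P)) e
      es (suc i) = edges P i
      inj : Injective _≡_ _≡_ f
      inj {zero}  {zero}  _  = refl
      inj {zero}  {suc j} eq = ⊥-elim (fresh (j , sym eq))
      inj {suc i} {zero}  eq = ⊥-elim (fresh (i , eq))
      inj {suc i} {suc j} eq = cong suc (injective P eq)

  module Tree (T : Graph m) (tree : IsTree T) where

    edge-sym : ∀ {a b} → Edge T a b → Edge T b a
    edge-sym {a} {b} e = trans (Graph.sym T b a) e

    edge-irrefl : ∀ {a} → ¬ Edge T a a
    edge-irrefl {a} e with trans (sym (irrefl T a)) e
    ... | ()

    edge? : ∀ a b → Dec (Edge T a b)
    edge? a b = adj T a b Bool.≟ true

    DelE : Fin m → Fin m → Fin m → Fin m → Set
    DelE = EdgeDelE T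

    delE-sym : ∀ {u w a b} → DelE u w a b → DelE u w b a
    delE-sym (e , p , q) = edge-sym e , (λ (x , y) → q (y , x)) , (λ (x , y) → p (y , x))

    delE-swap : ∀ {u w a b} → DelE u w a b → DelE w u a b
    delE-swap (e , p , q) = e , q , p

    delE? : ∀ u w a b → Dec (DelE u w a b)
    delE? u w a b = edge? a b ×-dec ¬? ((a ≟ u) ×-dec (b ≟ w)) ×-dec ¬? ((a ≟ w) ×-dec (b ≟ u))

    side? : ∀ u w v → Dec (Conn (DelE u w) u v)
    side? u w v = conn? (delE? u w) delE-sym u v

    -- A simple path avoiding the edge has length at least two and forms a cycle with it.
    bridge : ∀ {u w} → Edge T u w → ¬ Conn (DelE u w) u w
    bridge {u} {w} uw conn with simple-path conn
    ... | record { len = 0 ; start = refl ; end = refl } = edge-irrefl uw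
    ... | record { len = 1 ; start = refl ; end = refl ; edges = es } = proj₁ (proj₂ (es zero)) (refl , refl)
    ... | record { len = suc (suc k) ; vertex = f ; start = refl ; end = refl ; edges = es ; injective = inj } =
      proj₂ (proj₂ tree) (k , f , inj , (λ i → proj₁ (es i)) , edge-sym uw)

    one-side : ∀ u w v → Conn (DelE u w) u v ⊎ Conn (DelE w u) w v
    one-side u w v with proj₁ (proj₂ tree) u v
    ... | _ , walk with reach walk
      where
      reach : ∀ {x l} → WalkLen (Edge T) x v l →
              Conn (DelE u w) x v ⊎ Conn (DelE u w) u v ⊎ Conn (DelE u w) w v
      reach here = inj₁ conn-refl
      reach (step {x} {y} e walk) with reach walk
      ... | inj₂ r = inj₂ r
      ... | inj₁ c with delE? u w x y | (x ≟ u) ×-dec (y ≟ w) | (x ≟ w) ×-dec (y ≟ u)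
      ... | yes e' | _                 | _                 = inj₁ (conn-step e' c)
      ... | no _   | yes (refl , refl) | _                 = inj₂ (inj₂ c)
      ... | no _   | no _              | yes (refl , refl) = inj₂ (inj₁ c)
      ... | no ¬e' | no p              | no q              = ⊥-elim (¬e' (e , p , q))
    ... | inj₁ c        = inj₁ c
    ... | inj₂ (inj₁ c) = inj₁ c
    ... | inj₂ (inj₂ c) = inj₂ (conn-map (λ x → x) delE-swap c)

    not-both : ∀ {u w v} → Edge T u w → Conn (DelE u w) u v → ¬ Conn (DelE w u) w v
    not-both uw c c' = bridge uw (conn-trans c (conn-map (λ x → x) delE-swap (conn-sym delE-sym c')))

    branch : ∀ {z v} → v ≢ z → ∃[ w ] (Edge T z w × Conn (EdgeDelV T z) w v)
    branch {z} {v} v≢z with first (proj₂ (proj₁ (proj₂ tree) z v))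
      where
      first : ∀ {x l} → WalkLen (Edge T) x v l →
              (x ≢ z × Conn (EdgeDelV T z) x v) ⊎ ∃[ w ] (Edge T z w × Conn (EdgeDelV T z) w v)
      first here = inj₁ (v≢z , conn-refl)
      first (step {x} e walk) with first walk
      ... | inj₂ r = inj₂ r
      ... | inj₁ (y≢z , c) with x ≟ z
      ... | yes refl = inj₂ (_ , e , c)
      ... | no x≢z   = inj₁ (x≢z , conn-step (e , x≢z , y≢z) c)
    ... | inj₁ (z≢z , _) = ⊥-elim (z≢z refl)
    ... | inj₂ r         = r

    branch⇒side : ∀ {z w v} → Conn (EdgeDelV T z) w v → Conn (DelE w z) w v
    branch⇒side = conn-map (λ x → x) (λ (e , a≢z , b≢z) → e , (λ (_ , eq) → b≢z eq) , λ (eq , _) → a≢z eq)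

    other-branch⇒side : ∀ {z w w' v} → Edge T z w' → w' ≢ w → Conn (EdgeDelV T z) w' v → Conn (DelE z w) z v
    other-branch⇒side {z} {w} e ne c =
      conn-step (e , (λ (_ , eq) → ne eq) , λ (_ , eq) → edge-irrefl (subst (Edge T z) eq e))
        (conn-map (λ x → x) (λ (e , a≢z , b≢z) → e , (λ (eq , _) → a≢z eq) , λ (_ , eq) → b≢z eq) c)

    -- A walk from `w'` that avoids the edge to `w` never meets `w`, by `bridge`, and so cannot
    -- cross from `w` to `z`.
    side-nested : ∀ {z w w' v} → Edge T w w' → w' ≢ z → Conn (DelE w' w) w' v → Conn (DelE w z) w v
    side-nested {z} {w} {w'} ww' w'≢z c =
      conn-step (ww' , (λ (_ , eq) → w'≢z eq) , λ (_ , eq) → edge-irrefl (subst (Edge T w) eq ww')) (avoid conn-refl c)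
      where
      avoid : ∀ {x v} → Conn (DelE w' w) w' x → Conn (DelE w' w) x v → Conn (DelE w z) x v
      avoid p (_ , here)            = conn-refl
      avoid p (_ , step {x} {y} e c) =
        conn-step (proj₁ e , (λ { (refl , _) → bridge (edge-sym ww') p }) , λ { (_ , refl) → bridge (edge-sym ww') p' })
          (avoid p' (_ , c))
        where p' = conn-trans p (conn-step e conn-refl)

  -- Independence on every deep subset survives cutting `B` along a tree edge.
  Robust : (G : Graph n) (M : ℕ) {k : ℕ} → Vec (Fin n) k → Subset n → ℕ → Set
  Robust G M ws B d = ∀ B' → B' ⊆ B → ¬ Depth≤ G M d B' → Indep G ws B'

  module _ (G : Graph n) (T : Graph m) (L : Fin n → Fin m) (q : ℕ) (dec : IsRankDecomp≤ G T L q)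
           (M : ℕ) (2≤M : 2 ≤ M) (4*2^q≤M : 4 * 2 ^ q ≤ M) where

    open Tree T (proj₁ dec)

    private
      L-injective : ∀ {x y} → L x ≡ L y → x ≡ y
      L-injective = proj₁ (proj₁ (proj₂ (proj₂ dec)))

    sideV : Fin m → Fin m → Subset n
    sideV u w = ⟪ (λ x → side? u w (L x)) ⟫

    sideV-rank : ∀ {u w} → Edge T u w → CutRank≤ G (sideV u w) q
    sideV-rank {u} {w} uw = proj₂ (proj₂ (proj₂ dec)) u w uw (sideV u w)
      (λ x → mk⇔ (∈⟪⟫⁻ (λ x → side? u w (L x))) (∈⟪⟫⁺ (λ x → side? u w (L x))))

    sideB : Subset n → Fin m → Fin m → Subset n
    sideB B u w = ⟪ (λ x → (x ∈? B) ×-dec side? u w (L x)) ⟫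

    ∈-sideB⁺ : ∀ {B u w x} → x ∈ B → Conn (DelE u w) u (L x) → x ∈ sideB B u w
    ∈-sideB⁺ {B} {u} {w} x∈ c = ∈⟪⟫⁺ (λ x → (x ∈? B) ×-dec side? u w (L x)) (x∈ , c)

    ∈-sideB⁻ : ∀ {B u w x} → x ∈ sideB B u w → x ∈ B × Conn (DelE u w) u (L x)
    ∈-sideB⁻ {B} {u} {w} = ∈⟪⟫⁻ (λ x → (x ∈? B) ×-dec side? u w (L x))

    module Sink (z : Fin m) where

      nbrs : Subset m
      nbrs = tabulate (adj T z)

      ∣nbrs∣≤3 : ∣ nbrs ∣ ≤ 3
      ∣nbrs∣≤3 with proj₁ (proj₂ dec) z
      ... | inj₁ eq = subst (_≤ 3) (sym eq) (s≤s z≤n)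
      ... | inj₂ eq = subst (_≤ 3) (sym eq) ≤-refl

      ∈-nbrs : ∀ {w} → Edge T z w → w ∈ nbrs
      ∈-nbrs {w} e = lookup⇒[]= w nbrs (trans (lookup∘tabulate (adj T z) w) e)

      data View (x : Fin n) : Set where
        self   : L x ≡ z → View x
        through : L x ≢ z → ∀ w → Edge T z w → Conn (EdgeDelV T z) w (L x) → View x

      view : ∀ x → View x
      view x with L x ≟ z
      ... | yes eq = self eq
      ... | no ne with branch ne
      ... | w , e , c = through ne w e c

      -- The edge is decided anew, so that the type does not depend on the proof stored in a `View`;
      -- the second case is a dummy.
      types : Fin m → Fin n → Fin (2 ^ q)
      types w with edge? w z
      ... | yes e = proj₁ (rank⇒types G (sideV w z) q (sideV-rank e))
      ... | no _  = λ _ → code {q} (replicate q false)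

      types-same : ∀ {w x x' y} → Edge T w z → x ∈ sideV w z → x' ∈ sideV w z → y ∉ sideV w z →
                   types w x ≡ types w x' → adj G x y ≡ adj G x' y
      types-same {w} {x} {x'} {y} e x∈ x'∈ y∉ eq with edge? w z
      ... | yes e' = proj₂ (rank⇒types G (sideV w z) q (sideV-rank e')) x x' x∈ x'∈ eq y y∉
      ... | no ¬e  = ⊥-elim (¬e e)

      number : ∀ {x} → View x → Fin 4
      number (self _)          = zero
      number (through _ w e _) = suc (inject≤ (proj₁ (index (∈-nbrs e))) ∣nbrs∣≤3)

      type : ∀ {x} → View x → Fin (2 ^ q)
      type         (self _)          = code {q} (replicate q false)
      type {x = x} (through _ w _ _) = types w x

      data Same {x y : Fin n} : View x → View y → Set where
        same-self   : ∀ {p q} → Same (self p) (self q)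
        same-branch : ∀ {p q w e c e' c'} → Same (through p w e c) (through q w e' c')

      same : ∀ {x y} (v : View x) (v' : View y) → number v ≡ number v' → Same v v'
      same (self _) (self _) _ = same-self
      same (through _ w e _) (through _ w' e' _) eq
        with trans (sym (proj₂ (index (∈-nbrs e))))
               (trans (cong (at nbrs) (inject≤-injective ∣nbrs∣≤3 ∣nbrs∣≤3 _ _ (suc-injective eq)))
                 (proj₂ (index (∈-nbrs e'))))
      ... | refl = same-branch

      in-side : ∀ {w x} → Conn (EdgeDelV T z) w (L x) → x ∈ sideV w z
      in-side {w} c = ∈⟪⟫⁺ (λ x → side? w z (L x)) (branch⇒side c)

      not-in-side : ∀ {w y} → Edge T z w → (v : View y) →
                    (∀ {w'} {p e c} → v ≡ through p w' e c → w' ≢ w) → y ∉ sideV w z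
      not-in-side {w} {y} zw (self eq) _ y∈ =
        bridge (edge-sym zw) (subst (Conn (DelE w z) w) eq (∈⟪⟫⁻ (λ x → side? w z (L x)) y∈))
      not-in-side {w} {y} zw (through p w' e c) ne y∈ =
        not-both zw (other-branch⇒side e (ne refl) c) (∈⟪⟫⁻ (λ x → side? w z (L x)) y∈)

      -- The node `z` serves as root of a tree for `B`. A branch is one side of a tree edge, so it
      -- has at most `2 ^ q` row types; the factor 4 records the branch, with number zero for a
      -- vertex placed at `z`.
      sink : ∀ d B → (∀ w → Edge T z w → Depth≤ G M d (sideB B w z)) → Depth≤ G M (suc d) B
      sink d B shallow = depth-node G M d c (λ U → ℓ , sep U) classes
        where
        c : Fin n → Fin (4 + n)
        c x = number (view x) ↑ˡ n
        ℓ : Fin n → Fin M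
        ℓ x = inject≤ (combine (number (view x)) (type (view x))) 4*2^q≤M
        sep : ∀ U → Separates G c B U ℓ
        sep U x x' y _ _ _ x∈ _ y∉ eq
          with combine-injective (number (view x)) (type (view x)) (number (view x')) (type (view x'))
                 (inject≤-injective 4*2^q≤M 4*2^q≤M _ _ eq)
        ... | nums , tys = go (view x) (view x') (view y) nums tys
                             (λ num → y∉ (subst (_∈ U) (cong (_↑ˡ n) num) x∈))
          where
          go : (v : View x) (v' : View x') (v″ : View y) → number v ≡ number v' → type v ≡ type v' →
               number v ≢ number v″ → adj G x y ≡ adj G x' y
          go v v' v″ nums tys ne with same v v' nums
          go (self p) (self q) v″ nums tys ne | same-self =
            cong (λ x → adj G x y) (L-injective (trans p (sym q)))
          go (through p w e cx) (through _ w e' cx') v″ nums tys ne | same-branch =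
            types-same (edge-sym e) (in-side cx) (in-side cx') (not-in-side e v″ (λ { {w'} {p'} {e″} {c″} refl → other {w'} {p'} {e″} {c″} ne })) tys
            where
            other : ∀ {w' p' e″ c″} → number (through p w e cx) ≢ number (through {x = y} p' w' e″ c″) → w' ≢ w
            other {e″ = e″} ne refl = ne (cong (λ e → suc (inject≤ (proj₁ (index (∈-nbrs e))) ∣nbrs∣≤3)) (uip e e″))
              where
              -- `number` refers to the proof of the edge, so two proofs of the same edge must be
              -- identified.
              uip : ∀ {b : Bool} (p q : b ≡ true) → p ≡ q
              uip refl refl = refl
        classes : ∀ i → Depth≤ G M d (fiber c B i)
        classes i with nonempty? (fiber c B i)
        ... | no ¬ne = depth-subsingleton G M 2≤M d (λ x y x∈ _ → ⊥-elim (¬ne (x , x∈)))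
        ... | yes (x₀ , x₀∈) = class (view x₀) refl
          where
          same-x₀ : ∀ {x} → x ∈ fiber c B i → Same (view x₀) (view x)
          same-x₀ {x} x∈ = same (view x₀) (view x)
            (↑ˡ-injective n _ _ (trans (proj₂ (∈-fiber⁻ c {B} x₀∈)) (sym (proj₂ (∈-fiber⁻ c {B} x∈)))))
          class : (v : View x₀) → view x₀ ≡ v → Depth≤ G M d (fiber c B i)
          class (self p) eq = depth-subsingleton G M 2≤M d
            (λ x y x∈ y∈ → L-injective (trans (at-z x x∈) (sym (at-z y y∈))))
            where
            at-z : ∀ x → x ∈ fiber c B i → L x ≡ z
            at-z x x∈ = self-self (view x₀) (view x) eq (same-x₀ x∈)
              where
              self-self : (v : View x₀) (v' : View x) → v ≡ self p → Same v v' → L x ≡ z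
              self-self (self _) (self r) refl same-self = r
          class (through p w e cx) eq = depth-⊆ G M d
            (λ {x} x∈ → ∈-sideB⁺ (proj₁ (∈-fiber⁻ c {B} x∈)) (branch⇒side (in-branch x x∈))) (shallow w e)
            where
            in-branch : ∀ x → x ∈ fiber c B i → Conn (EdgeDelV T z) w (L x)
            in-branch x x∈ = same-through (view x₀) (view x) eq (same-x₀ x∈)
              where
              same-through : (v : View x₀) (v' : View x) → v ≡ through p w e cx → Same v v' → Conn (EdgeDelV T z) w (L x)
              same-through (through _ _ _ _) (through _ _ _ c') refl same-branch = c'

    sideT : Fin m → Fin m → Subset m
    sideT u w = ⟪ (λ v → side? u w v) ⟫

    -- At a node with only shallow branches, `sink` makes `B` shallow. Otherwise the walk enters a
    -- deep branch and stops once the side left behind is deep as well.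
    deep-cut : ∀ d B → Depth≤ G M (suc d) B ⊎
               ∃[ u ] ∃[ w ] (Edge T u w × ¬ Depth≤ G M d (sideB B u w) × ¬ Depth≤ G M d (sideB B w u))
    deep-cut d B = search (suc m) root ⊤ (s≤s (∣p∣≤n ⊤)) ∈⊤ (λ w _ → inj₂ ⊆⊤)
      where
      root : Fin m
      root = fromℕ< {0} (proj₁ (proj₁ dec))
      -- A walk towards deep sides; S contains the tree vertices that can still be reached.
      search : ∀ k z (S : Subset m) → ∣ S ∣ < k → z ∈ S →
               (∀ w → Edge T z w → Depth≤ G M d (sideB B w z) ⊎ sideT w z ⊆ S) →
               Depth≤ G M (suc d) B ⊎
               ∃[ u ] ∃[ w ] (Edge T u w × ¬ Depth≤ G M d (sideB B u w) × ¬ Depth≤ G M d (sideB B w u))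
      search (suc k) z S ∣S∣<k z∈ st
        with any? (λ w → edge? z w ×-dec ¬? (depth≤? G M d (sideB B w z)))
      ... | no ¬w = inj₁ (Sink.sink z d B shallow)
        where
        shallow : ∀ w → Edge T z w → Depth≤ G M d (sideB B w z)
        shallow w e with depth≤? G M d (sideB B w z)
        ... | yes p = p
        ... | no ¬p = ⊥-elim (¬w (w , e , ¬p))
      ... | yes (w , zw , deep) with depth≤? G M d (sideB B z w)
      ... | no deep'   = inj₂ (z , w , zw , deep' , deep)
      ... | yes shallow with st w zw
      ... | inj₁ p   = ⊥-elim (deep p)
      ... | inj₂ T⊆S = search k w (sideT w z)
        (<-≤-trans (p⊂q⇒∣p∣<∣q∣ (T⊆S , z , z∈ , λ z∈T → bridge (edge-sym zw) (∈⟪⟫⁻ (λ v → side? w z v) z∈T))) (≤-pred ∣S∣<k))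
        (∈⟪⟫⁺ (λ v → side? w z v) conn-refl) st'
        where
        st' : ∀ w' → Edge T w w' → Depth≤ G M d (sideB B w' w) ⊎ sideT w' w ⊆ sideT w z
        st' w' ww' with w' ≟ z
        -- The walk never turns back: the side behind it has just been found shallow.
        ... | yes refl = inj₁ shallow
        ... | no w'≢z  = inj₂ (λ v∈ → ∈⟪⟫⁺ (λ v → side? w z v) (side-nested ww' w'≢z (∈⟪⟫⁻ (λ v → side? w' w v) v∈)))

    record Partition {k : ℕ} (X : Subset n) (ws : Vec (Fin n) k) : Set where
      field
        {a b} : ℕ
        us    : Vec (Fin n) a
        vs    : Vec (Fin n) b
        sub-u : Sub us ws
        sub-v : Sub vs ws
        us∈   : ∀ i → lookup us i ∈ X
        vs∉   : ∀ i → lookup vs i ∉ X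
        sum   : a + b ≡ k

    partition : ∀ {k} X (ws : Vec (Fin n) k) → Partition X ws
    partition X [] = record { us = [] ; vs = [] ; sub-u = [] ; sub-v = [] ; us∈ = λ () ; vs∉ = λ () ; sum = refl }
    partition X (w ∷ ws) with partition X ws | w ∈? X
    ... | p | yes w∈ = record
      { us = w ∷ us ; vs = vs ; sub-u = keep sub-u ; sub-v = skip sub-v
      ; us∈ = λ { zero → w∈ ; (suc i) → us∈ i } ; vs∉ = vs∉ ; sum = cong suc sum }
      where open Partition p
    ... | p | no w∉ = record
      { us = us ; vs = w ∷ vs ; sub-u = skip sub-u ; sub-v = keep sub-v
      ; us∈ = us∈ ; vs∉ = λ { zero → w∉ ; (suc i) → vs∉ i } ; sum = trans (+-suc a b) (cong suc sum) }
      where open Partition p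

    -- The reference vertices on one side of a deep cut are independent on the deep part of `B` on
    -- the other side, so each side has at most `q` of them.
    robust-bound : ∀ {k} (ws : Vec (Fin n) k) B d → Robust G M ws B d → ¬ Depth≤ G M (suc d) B → k ≤ q + q
    robust-bound ws B d rob deep with deep-cut d B
    ... | inj₁ p = ⊥-elim (deep p)
    ... | inj₂ (u , w , uw , deep-u , deep-w) = subst (_≤ q + q) sum (+-mono-≤
            (indep⇒≤rank G (sideV u w) (sideV-rank uw) us us∈
              (indep-sub G sub-u (weaken (λ {x} x∈ → x∉p⇒x∈∁p (λ x∈u →
                 not-both uw (∈⟪⟫⁻ (λ x → side? u w (L x)) x∈u) (proj₂ (∈-sideB⁻ {B} x∈))))
                (rob (sideB B w u) (λ x∈ → proj₁ (∈-sideB⁻ x∈)) deep-w))))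
            (indep⇒≤rank G (sideV w u) (sideV-rank (edge-sym uw)) vs vs∈
              (indep-sub G sub-v (weaken (λ {x} x∈ → x∉p⇒x∈∁p (λ x∈w →
                 not-both uw (proj₂ (∈-sideB⁻ {B} x∈)) (∈⟪⟫⁻ (λ x → side? w u (L x)) x∈w)))
                (rob (sideB B u w) (λ x∈ → proj₁ (∈-sideB⁻ x∈)) deep-u)))))
      where
      open Partition (partition (sideV u w) ws)
      weaken : ∀ {k} {ws : Vec (Fin n) k} {Y Y'} → Y ⊆ Y' → Indep G ws Y → Indep G ws Y'
      weaken sub ind s ne with ind s ne
      ... | y , y∈ , eq = y , sub y∈ , eq
      vs∈ : ∀ i → lookup vs i ∈ sideV w u
      vs∈ i with one-side u w (L (lookup vs i))
      ... | inj₁ c = ⊥-elim (vs∉ i (∈⟪⟫⁺ (λ x → side? u w (L x)) c))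
      ... | inj₂ c = ∈⟪⟫⁺ (λ x → side? w u (L x)) c

-- From deep sets to paths: letters, path search, alternation

module DeepSets where

  open import Defs hiding (sym)
  open FiniteSets
  open CutRank
  open LocalComplementation
  open Depth
  open RankDecomposition
  open import Data.Nat using (ℕ; zero; suc; _+_; _*_; _^_; _≤_; _<_; z≤n; s≤s)
  open import Data.Nat.Properties using (≤-refl; ≤-trans; ≤-reflexive; m≤m+n; m≤n+m; n≤1+n; +-suc; ^-monoʳ-≤; 1+n≰n; *-monoʳ-≤; m<n⇒m<1+n)
  open import Data.Bool using (Bool; true; false; not)
  import Data.Bool.Properties as Bool
  open import Data.Fin using (Fin; zero; suc; _≟_; inject≤; _↑ʳ_)
  open import Data.Fin.Properties using (any?; inject≤-injective; ↑ʳ-injective)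
  open import Data.Fin.Subset using (Subset; _∈_; _∉_; _⊆_)
  open import Data.Fin.Subset.Properties using (_∈?_; _⊆?_; anySubset?)
  open import Data.Vec using (Vec; []; _∷_; replicate)
  import Data.Vec.Properties as Vec
  open import Data.List using (List; []; _∷_; length; cartesianProduct; _++_; map)
  open import Data.List.Membership.Propositional using (find; lose) renaming (_∈_ to _∈ₗ_)
  open import Data.List.Membership.Propositional.Properties using (∈-cartesianProduct⁺; ∈-map⁺; ∈-++⁺ˡ; ∈-++⁺ʳ; ∈-filter⁺)
  open import Data.List.Relation.Unary.Any using (here)
  import Data.List.Relation.Unary.Any as Any
  open import Data.List.Relation.Unary.All using (All; []; _∷_)
  import Data.List.Relation.Unary.All as All
  open import Data.Product using (∃-syntax; _×_; _,_; proj₁; proj₂)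
  open import Data.List.Properties using (length-map)
  open import Data.List.Relation.Unary.All.Properties using (map⁺)
  open import Data.Product.Properties using (≡-dec)
  open import Data.Sum using (_⊎_; inj₁; inj₂)
  open import Data.Unit using (tt)
  open import Data.Empty using (⊥-elim)
  open import Function using (_∘_)
  open import Relation.Nullary using (¬_; Dec; yes; no; ¬?; _×-dec_; _→-dec_; _⊎-dec_)
  open import Relation.Binary.PropositionalEquality using (_≡_; _≢_; refl; sym; trans; cong; subst)

  private
    variable
      n k : ℕ

  -- Letters: the second component of the letter of a vertex is its adjacency vector to the reference vertices, the
  -- first one describes its adjacencies to a later set as a linear function of these vectors.
  Letter : ℕ → Set
  Letter k = Vec Bool k × Vec Bool k

  _≟ₗ_ : (α β : Letter k) → Dec (α ≡ β)
  _≟ₗ_ = ≡-dec (Vec.≡-dec Bool._≟_) (Vec.≡-dec Bool._≟_)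

  pairing : Letter k → Letter k → Bool
  pairing (s , _) (_ , e) = dot s e

  vectors : ∀ k → List (Vec Bool k)
  vectors zero    = [] ∷ []
  vectors (suc k) = map (true ∷_) (vectors k) ++ map (false ∷_) (vectors k)

  ∈-vectors : (v : Vec Bool k) → v ∈ₗ vectors k
  ∈-vectors []          = here refl
  ∈-vectors (true ∷ v)  = ∈-++⁺ˡ (∈-map⁺ (true ∷_) (∈-vectors v))
  ∈-vectors (false ∷ v) = ∈-++⁺ʳ (map (true ∷_) (vectors _)) (∈-map⁺ (false ∷_) (∈-vectors v))

  letters : ∀ k → List (Letter k)
  letters k = cartesianProduct (vectors k) (vectors k)

  ∈-letters : (α : Letter k) → α ∈ₗ letters k
  ∈-letters (s , e) = ∈-cartesianProduct⁺ (∈-vectors s) (∈-vectors e)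

  least : {P : ℕ → Set} → (∀ l → Dec (P l)) → ∀ l → P l → ∃[ j ] (P j × ∀ i → i < j → ¬ P i)
  least {P} P? l pl with P? 0
  ... | yes p0 = 0 , p0 , λ _ ()
  least {P} P? zero    pl | no ¬p0 = ⊥-elim (¬p0 pl)
  least {P} P? (suc l) pl | no ¬p0 with least (P? ∘ suc) l pl
  ... | j , pj , min = suc j , pj , λ { zero _ → ¬p0 ; (suc i) (s≤s i<j) → min i i<j }

  insert : Fin n → Subset n → Subset n
  insert p C = ⟪ (λ x → (x ∈? C) ⊎-dec (x ≟ p)) ⟫

  ∈-insert : (p : Fin n) (C : Subset n) → p ∈ insert p C
  ∈-insert p C = ∈⟪⟫⁺ (λ x → (x ∈? C) ⊎-dec (x ≟ p)) (inj₂ refl)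

  ⊆-insert : (p : Fin n) (C : Subset n) → C ⊆ insert p C
  ⊆-insert p C x∈ = ∈⟪⟫⁺ (λ x → (x ∈? C) ⊎-dec (x ≟ p)) (inj₁ x∈)

  insert⁻ : (p : Fin n) (C : Subset n) {x : Fin n} → x ∈ insert p C → x ∈ C ⊎ x ≡ p
  insert⁻ p C = ∈⟪⟫⁻ (λ x → (x ∈? C) ⊎-dec (x ≟ p))

  -- Depth thresholds

  module _ (t : ℕ) (f : ℕ → ℕ) where

    -- Per search step, `f` pays for a deep part on which the current vertex is linear and the inner
    -- `suc` for a deep component of it. The second summand keeps the value above `δ` for arbitrary
    -- `f`.
    dfsDepth : ℕ → ℕ → ℕ
    dfsDepth δ zero    = δ
    dfsDepth δ (suc i) = f (suc (dfsDepth δ i)) + suc (dfsDepth δ i)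

    -- The first summand pays for giving each vertex a letter after removing that vertex, the second
    -- for a deep component and the removal of its starting vertex.
    symDepth : ℕ → ℕ → ℕ
    symDepth u δ = suc (f δ) + suc (suc (dfsDepth δ (symLength t u)))

    -- Each pair of the half graph needs two nested occurrences, hence two applications of `g`.
    altDepth : (ℕ → ℕ) → ℕ → ℕ → ℕ
    altDepth g δ zero    = g δ
    altDepth g δ (suc i) = g (g (altDepth g δ i))

    lettersDepth : ℕ → ℕ → ℕ
    lettersDepth zero    δ = symDepth zero δ
    lettersDepth (suc u) δ = symDepth (suc u) δ + altDepth (lettersDepth u) δ (suc t)

    dfsDepth-≥ : ∀ δ i → δ ≤ dfsDepth δ i
    dfsDepth-≥ δ zero    = ≤-refl
    dfsDepth-≥ δ (suc i) = ≤-trans (dfsDepth-≥ δ i) (≤-trans (n≤1+n _) (m≤n+m _ _))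

    symDepth-≥ : ∀ u δ → δ ≤ symDepth u δ
    symDepth-≥ u δ = ≤-trans (dfsDepth-≥ δ (symLength t u)) (≤-trans (n≤1+n _) (≤-trans (n≤1+n _) (m≤n+m _ (suc (f δ)))))

    symDepth≤lettersDepth : ∀ u δ → symDepth u δ ≤ lettersDepth u δ
    symDepth≤lettersDepth zero    δ = ≤-refl
    symDepth≤lettersDepth (suc u) δ = m≤m+n _ _

    lettersDepth-≥ : ∀ u δ → δ ≤ lettersDepth u δ
    lettersDepth-≥ u δ = ≤-trans (symDepth-≥ u δ) (symDepth≤lettersDepth u δ)

    altDepth-≥ : ∀ u δ i → δ ≤ altDepth (lettersDepth u) δ i
    altDepth-≥ u δ zero    = lettersDepth-≥ u δ
    altDepth-≥ u δ (suc i) =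
      ≤-trans (altDepth-≥ u δ i) (≤-trans (lettersDepth-≥ u _) (lettersDepth-≥ u _))

  -- `k` rows are chosen and `j` more are needed to reach `2q + 1`; `m` is the depth from which on
  -- the family is robust.
  rankDepth : ℕ → ℕ → ℕ → ℕ → ℕ
  rankDepth t zero    k m = suc m
  rankDepth t (suc j) k m = lettersDepth t (rankDepth t j (suc k)) (length (letters k)) m

  module Level (t : ℕ) (1≤t : 1 ≤ t) (G : Graph n) (M : ℕ) (2≤M : 2 ≤ M) (k : ℕ) (2^k≤M : 2 ^ k ≤ M)
    (ws : Vec (Fin n) k) (f : ℕ → ℕ)
    (next : ∀ p B δ → Robust G M (p ∷ ws) B δ → ¬ Depth≤ G M (f δ) B → VertexMinor (Path t) G)
    (B₀ : Subset n) (m : ℕ) (robust : Robust G M ws B₀ m) where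

    Outcome : Set
    Outcome = VertexMinor (Path t) G

    Deep : ℕ → Subset n → Set
    Deep d B = ¬ Depth≤ G M d B

    deep-mono : ∀ {d d' B} → d ≤ d' → Deep d' B → Deep d B
    deep-mono le deep dep = deep (depth-mono G M 2≤M le dep)

    deep-⊆ : ∀ {d B B'} → B' ⊆ B → Deep d B' → Deep d B
    deep-⊆ {d} sub deep dep = deep (depth-⊆ G M d sub dep)

    e : Fin n → Vec Bool k
    e = ev G ws

    abstract

      -- If `p` were independent of `ws` on every deep part of `C`, the longer family would be
      -- robust on `C` and `next` would finish.
      linear-part : ∀ p C δ → C ⊆ B₀ → m ≤ δ → Deep (f δ) C →
                    Outcome ⊎ ∃[ C' ] (C' ⊆ C × Deep δ C' × ∃[ s ] Linear G ws s p C')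
      linear-part p C δ C⊆ m≤δ deep
        with anySubset? (λ C' → (C' ⊆? C) ×-dec ¬? (depth≤? G M δ C') ×-dec ¬? (indep? G (p ∷ ws) C'))
      ... | no ¬C' = inj₁ (next p C δ rob deep)
        where
        rob : Robust G M (p ∷ ws) C δ
        rob C' sub deep' with indep? G (p ∷ ws) C'
        ... | yes ind = ind
        ... | no ¬ind = ⊥-elim (¬C' (C' , sub , deep' , ¬ind))
      ... | yes (C' , sub , deep' , ¬ind) with linear-or-indep G p ws (robust C' (C⊆ ∘ sub) (deep-mono m≤δ deep'))
      ... | inj₁ lin = inj₂ (C' , sub , deep' , lin)
      ... | inj₂ ind = ⊥-elim (¬ind ind)

    -- The witness lies outside the set on which it is linear, so vertices picked later from that
    -- set differ from it.
    Occurs : Subset n → ℕ → Letter k → Set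
    Occurs B δ (s , v) = ∃[ x ] (x ∈ B × e x ≡ v × ∃[ B' ] (B' ⊆ B × x ∉ B' × Deep δ B' × Linear G ws s x B'))

    occurs? : ∀ B δ α → Dec (Occurs B δ α)
    occurs? B δ (s , v) = any? (λ x → (x ∈? B) ×-dec Vec.≡-dec Bool._≟_ (e x) v ×-dec
      anySubset? (λ B' → (B' ⊆? B) ×-dec ¬? (x ∈? B') ×-dec ¬? (depth≤? G M δ B') ×-dec linear? G ws s x B'))

    occurs-mono : ∀ {B B' δ δ' α} → B' ⊆ B → δ ≤ δ' → Occurs B' δ' α → Occurs B δ α
    occurs-mono sub le (x , x∈ , ex , C , C⊆ , x∉ , deep , lin) =
      x , sub x∈ , ex , C , sub ∘ C⊆ , x∉ , deep-mono le deep , lin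

    module Symmetric-case (u δ : ℕ) (B : Subset n) (𝓛 : List (Letter k)) (m≤δ : m ≤ δ) (B⊆ : B ⊆ B₀)
      (occ : ∀ α → Occurs B δ α → α ∈ₗ 𝓛)
      (symm : ∀ {α β} → α ∈ₗ 𝓛 → β ∈ₗ 𝓛 → pairing α β ≡ pairing β α) where

      HasLetter : Fin n → Set
      HasLetter y = Any.Any (λ α → proj₂ α ≡ e y) 𝓛

      hasLetter? : ∀ y → Dec (HasLetter y)
      hasLetter? y = Any.any? (λ α → Vec.≡-dec Bool._≟_ (proj₂ α) (e y)) 𝓛

      linear⇒letter : ∀ {p s C δ'} → p ∈ B → p ∉ C → C ⊆ B → δ ≤ δ' → Deep δ' C → Linear G ws s p C → (s , e p) ∈ₗ 𝓛
      linear⇒letter {p} {s} {C} p∈ p∉ C⊆ le deep lin =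
        occ (s , e p) (p , p∈ , refl , C , C⊆ , p∉ , deep-mono le deep , lin)

      has-letter : Deep (suc (f δ)) B → ∀ y → y ∈ B → Outcome ⊎ HasLetter y
      has-letter deep y y∈
        with linear-part y (without y B) δ (λ x∈ → B⊆ (proj₁ (∈-without⁻ {B = B} x∈))) m≤δ
               (λ dep → deep (depth-without G M 2≤M (f δ) y dep))
      ... | inj₁ out = inj₁ out
      ... | inj₂ (C , C⊆ , deep' , s , lin) =
        inj₂ (lose (linear⇒letter {s = s} {C} y∈ (λ y∈C → proj₂ (∈-without⁻ {B = B} (C⊆ y∈C)) refl)
                     (λ x∈ → proj₁ (∈-without⁻ {B = B} (C⊆ x∈))) ≤-refl deep' lin) refl)

      all-letters : Deep (suc (f δ)) B → Outcome ⊎ (∀ y → y ∈ B → HasLetter y)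
      all-letters deep with all-of? any? (λ y → (y ∈? B) →-dec hasLetter? y)
      ... | yes all = inj₂ all
      ... | no ¬all with not-all any? (λ y → (y ∈? B) →-dec hasLetter? y) ¬all
      ... | y , ¬imp with y ∈? B
      ... | no y∉ = ⊥-elim (¬imp (⊥-elim ∘ y∉))
      ... | yes y∈ with has-letter deep y y∈
      ... | inj₁ out = inj₁ out
      ... | inj₂ h   = ⊥-elim (¬imp (λ _ → h))

      module _ (all : ∀ y → y ∈ B → HasLetter y) where

        -- By symmetry of the pairing on `𝓛`, any letter with second component `e y` represents `y`.
        -- The dummy occurs only outside `B`.
        letter : Fin n → Letter k
        letter y with hasLetter? y
        ... | yes h = proj₁ (find h)
        ... | no _  = replicate k false , e y

        letter-snd : ∀ y → proj₂ (letter y) ≡ e y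
        letter-snd y with hasLetter? y
        ... | yes h = proj₂ (proj₂ (find h))
        ... | no _  = refl

        letter-∈ : ∀ {y} → y ∈ B → letter y ∈ₗ 𝓛
        letter-∈ {y} y∈ with hasLetter? y
        ... | yes h = proj₁ (proj₂ (find h))
        ... | no ¬h = ⊥-elim (¬h (all y y∈))

        μ : Fin n → Fin n → Bool
        μ x y = pairing (letter x) (letter y)

        -- Adjacency plus pairing. Loops are possible, so distinctness along a path comes from
        -- distances, not from edges.
        _⋈_ : Fin n → Fin n → Set
        x ⋈ y = adj G x y ≡ not (μ x y)

        _⋈?_ : ∀ x y → Dec (x ⋈ y)
        x ⋈? y = adj G x y Bool.≟ not (μ x y)

        ⋈-sym : ∀ {x y} → x ∈ B → y ∈ B → x ⋈ y → y ⋈ x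
        ⋈-sym {x} {y} x∈ y∈ eq =
          trans (Graph.sym G y x) (trans eq (cong not (symm (letter-∈ x∈) (letter-∈ y∈))))

        ¬⋈ : ∀ {x y} → ¬ x ⋈ y → adj G x y ≡ μ x y
        ¬⋈ {x} {y} ne with adj G x y | μ x y
        ... | true  | true  = refl
        ... | false | false = refl
        ... | true  | false = ⊥-elim (ne refl)
        ... | false | true  = ⊥-elim (ne refl)

        -- The letter of p ∈ B is determined by any deep set on which p is linear, because the letters
        -- in 𝓛 pair symmetrically.
        linear⇒¬⋈ : ∀ {p s C δ'} → p ∈ B → p ∉ C → C ⊆ B → δ ≤ δ' → Deep δ' C → Linear G ws s p C →
                    ∀ {y} → y ∈ C → ¬ p ⋈ y
        linear⇒¬⋈ {p} {s} {C} p∈ p∉ C⊆ le deep lin {y} y∈ p⋈y = not≢ _ (trans (sym p⋈y) adj≡)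
          where
          sp∈ : (s , e p) ∈ₗ 𝓛
          sp∈ = linear⇒letter {s = s} {C} p∈ p∉ C⊆ le deep lin
          adj≡ : adj G p y ≡ μ p y
          adj≡ = trans (lin y y∈) (trans (cong (dot s) (sym (letter-snd y)))
            (trans (symm sp∈ (letter-∈ (C⊆ y∈)))
              (trans (cong (dot (proj₁ (letter y))) (sym (letter-snd p)))
                (symm (letter-∈ (C⊆ y∈)) (letter-∈ p∈)))))
          not≢ : ∀ b → not b ≢ b
          not≢ true  ()
          not≢ false ()

        In : Subset n → Fin n → Fin n → Set
        In C x y = x ∈ C × y ∈ C × x ⋈ y

        module _ (C : Subset n) (C⊆ : C ⊆ B) where

          in-sym : ∀ {x y} → In C x y → In C y x
          in-sym (x∈ , y∈ , eq) = y∈ , x∈ , ⋈-sym (C⊆ x∈) (C⊆ y∈) eq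

          in? : ∀ x y → Dec (In C x y)
          in? x y = (x ∈? C) ×-dec (y ∈? C) ×-dec (x ⋈? y)

          open Components (components in? in-sym)

          abstract

            -- Between different components adjacency equals the pairing, so a row is determined by
            -- the first part of its letter: `2 ^ k` types.
            deep-component : ∀ d → Deep (suc d) C →
                             ∃[ C' ] (C' ⊆ C × Deep d C' × ∀ {x y} → x ∈ C' → y ∈ C' → Conn (In C') x y)
            deep-component d deep =
              C' , (λ x∈ → proj₁ (∈-fiber⁻ c {C} {i = i} x∈)) , proj₂ deepest , conn
              where
              c : Fin n → Fin (4 + n)
              c x = 4 ↑ʳ comp x
              ℓ : Fin n → Fin M
              ℓ x = inject≤ (code (proj₁ (letter x))) 2^k≤M
              sep : ∀ U → Separates G c C U ℓ
              sep U x x' y x∈ x'∈ y∈ cx cx' cy eq =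
                trans (apart x∈ cx) (trans (cong (λ s → dot s (proj₂ (letter y)))
                  (code-injective (proj₁ (letter x)) (proj₁ (letter x')) (inject≤-injective 2^k≤M 2^k≤M _ _ eq)))
                  (sym (apart x'∈ cx')))
                where
                apart : ∀ {z} → z ∈ C → c z ∈ U → adj G z y ≡ μ z y
                apart z∈ cz = ¬⋈ (λ z⋈y → cy (subst (_∈ U) (cong (4 ↑ʳ_) (comp-edge (z∈ , y∈ , z⋈y))) cz))
              deepest : ∃[ i ] Deep d (fiber c C i)
              deepest = deep-class G M d c (λ U → ℓ , sep U) deep
              i : Fin (4 + n)
              i = proj₁ deepest
              C' : Subset n
              C' = fiber c C i
              label : ∀ {x} → x ∈ C' → c x ≡ i
              label {x} x∈ = proj₂ (∈-fiber⁻ c {C} {x} {i} x∈)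
              stay : ∀ {x y} → x ∈ C' → Conn (In C) x y → Conn (In C') x y
              stay x∈ (_ , here) = conn-refl
              stay x∈ (_ , step {b = b} edge@(_ , y∈ , x⋈y) w) = conn-step (x∈ , y∈' , x⋈y) (stay y∈' (_ , w))
                where
                y∈' : b ∈ C'
                y∈' = ∈-fiber⁺ c y∈ (trans (cong (4 ↑ʳ_) (sym (comp-edge edge))) (label x∈))
              conn : ∀ {x y} → x ∈ C' → y ∈ C' → Conn (In C') x y
              conn {x} {y} x∈ y∈ =
                stay x∈ (comp⇒conn in? in-sym (↑ʳ-injective 4 (comp x) (comp y) (trans (label x∈) (sym (label y∈)))))

        module _ (D C' : Subset n) where

          -- `l` counts the vertices outside `C'` that a walk from `x` into `C'` visits after `x`;
          -- the least such `l` is the distance minus one.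
          Reaches : ℕ → Fin n → Set
          Reaches zero    x = ∃[ y ] (y ∈ C' × x ⋈ y)
          Reaches (suc l) x = ∃[ y ] (y ∈ D × y ∉ C' × x ⋈ y × Reaches l y)

          reaches? : ∀ l x → Dec (Reaches l x)
          reaches? zero    x = any? (λ y → (y ∈? C') ×-dec (x ⋈? y))
          reaches? (suc l) x = any? (λ y → (y ∈? D) ×-dec ¬? (y ∈? C') ×-dec (x ⋈? y) ×-dec reaches? l y)

          conn⇒reaches : ∀ {x z} → Conn (In D) x z → z ∈ C' → x ∈ C' ⊎ ∃[ l ] Reaches l x
          conn⇒reaches (_ , here) z∈ = inj₁ z∈
          conn⇒reaches (_ , step {b = y} (_ , y∈ , x⋈y) w) z∈ with y ∈? C' | conn⇒reaches (_ , w) z∈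
          ... | yes y∈C' | _              = inj₂ (0 , y , y∈C' , x⋈y)
          ... | no y∉    | inj₁ y∈C'      = ⊥-elim (y∉ y∈C')
          ... | no y∉    | inj₂ (l , r)   = inj₂ (suc l , y , y∈ , y∉ , x⋈y , r)

        tw : Fin n → Fin n × Letter k
        tw x = x , letter x

        TwistedFrom : Fin n → (Fin n → Set) → ℕ → Set
        TwistedFrom p Q l = ∃[ xs ] (Twisted G pairing (tw p ∷ map tw xs) × All Q xs × l ≤ length xs)

        -- Inside a deep part that `p` misses, a deep component `C'` is chosen. A shortest path from
        -- `p` towards `C'` ends in a vertex `x` with a neighbour in `C'`; `C'` with `x` is
        -- connected, and the search restarts there from `x`. Earlier path vertices have no
        -- neighbours in `C'`, so the continuation creates no chords.
        dfs : ∀ i p D → p ∈ D → D ⊆ B → (∀ {z} → z ∈ D → Conn (In D) p z) →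
              Deep (dfsDepth t f δ i) (without p D) → Outcome ⊎ TwistedFrom p (λ z → z ∈ D × z ≢ p) i
        dfs zero    p D p∈ D⊆ conn deep = inj₂ ([] , (tt , tt) , [] , z≤n)
        dfs (suc i) p D p∈ D⊆ conn deep
          with linear-part p (without p D) (suc (dfsDepth t f δ i))
                 (λ x∈ → B⊆ (D⊆ (proj₁ (∈-without⁻ {B = D} x∈))))
                 (≤-trans m≤δ (≤-trans (dfsDepth-≥ t f δ i) (n≤1+n _))) (deep-mono (m≤m+n _ _) deep)
        ... | inj₁ out = inj₁ out
        ... | inj₂ (C₁ , C₁⊆ , deep₁ , s , lin)
            with deep-component C₁ (λ x∈ → D⊆ (proj₁ (∈-without⁻ {B = D} (C₁⊆ x∈)))) (dfsDepth t f δ i) deep₁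
        ... | C' , C'⊆ , deep' , conn' = result
          where
          C₁⊆D : C₁ ⊆ D
          C₁⊆D x∈ = proj₁ (∈-without⁻ {B = D} (C₁⊆ x∈))
          p∉C₁ : p ∉ C₁
          p∉C₁ p∈C₁ = proj₂ (∈-without⁻ {B = D} (C₁⊆ p∈C₁)) refl
          C'⊆B : C' ⊆ B
          C'⊆B x∈ = D⊆ (C₁⊆D (C'⊆ x∈))
          p-off : ∀ {y} → y ∈ C' → ¬ p ⋈ y
          p-off y∈ = linear⇒¬⋈ {s = s} {C₁} (D⊆ p∈) p∉C₁ (λ x∈ → D⊆ (C₁⊆D x∈)) (≤-trans (dfsDepth-≥ t f δ i) (n≤1+n _)) deep₁ lin (C'⊆ y∈)
          R = Reaches D C'
          -- Later vertices lie in `C'` or are closer to it; being adjacent to one too early would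
          -- shorten the distance.
          Later : ℕ → Fin n → Set
          Later l z = z ∈ D × (z ∈ C' ⊎ (z ∉ C' × ∃[ j ] (j < l × R j z)))

          walk : ∀ l x → x ∈ D → x ∉ C' → R l x → (∀ j → j < l → ¬ R j x) →
                 Outcome ⊎ TwistedFrom x (Later l) (l + i)
          walk zero x x∈ x∉ (y , y∈ , x⋈y) _ with dfs i x (insert x C') (∈-insert x C') D'⊆ conn″ deep″
            where
            D'⊆ : insert x C' ⊆ B
            D'⊆ z∈ with insert⁻ x C' z∈
            ... | inj₁ z∈C' = C'⊆B z∈C'
            ... | inj₂ refl = D⊆ x∈
            C'⊆D' : C' ⊆ insert x C'
            C'⊆D' = ⊆-insert x C'
            conn″ : ∀ {z} → z ∈ insert x C' → Conn (In (insert x C')) x z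
            conn″ z∈ with insert⁻ x C' z∈
            ... | inj₂ refl = conn-refl
            ... | inj₁ z∈C' = conn-step (∈-insert x C' , C'⊆D' y∈ , x⋈y)
              (conn-map (λ v → v) (λ (a∈ , b∈ , eq) → C'⊆D' a∈ , C'⊆D' b∈ , eq) (conn' y∈ z∈C'))
            deep″ : Deep (dfsDepth t f δ i) (without x (insert x C'))
            deep″ = deep-⊆ (λ z∈ → ∈-without⁺ (C'⊆D' z∈) (λ { refl → x∉ z∈ })) deep'
          ... | inj₁ out = inj₁ out
          ... | inj₂ (xs , twisted , all , le) = inj₂ (xs , twisted , All.map in-C' all , le)
            where
            in-C' : ∀ {z} → z ∈ insert x C' × z ≢ x → Later 0 z
            in-C' (z∈ , z≢x) with insert⁻ x C' z∈
            ... | inj₁ z∈C' = C₁⊆D (C'⊆ z∈C') , inj₁ z∈C'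
            ... | inj₂ z≡x  = ⊥-elim (z≢x z≡x)
          walk (suc l) x x∈ x∉ (y , y∈ , y∉ , x⋈y , r) min
            with walk l y y∈ y∉ r (λ j j<l r' → min (suc j) (s≤s j<l) (y , y∈ , y∉ , x⋈y , r'))
          ... | inj₁ out = inj₁ out
          ... | inj₂ (xs , twisted , all , le) =
            inj₂ (y ∷ xs , ((((λ { refl → min l ≤-refl r }) , x⋈y) , far xs all) , twisted) ,
                  (y∈ , inj₂ (y∉ , l , ≤-refl , r)) ∷ All.map later-suc all , s≤s le)
            where
            later-suc : ∀ {z} → Later l z → Later (suc l) z
            later-suc (z∈ , inj₁ z∈C')              = z∈ , inj₁ z∈C'
            later-suc (z∈ , inj₂ (z∉ , j , j<l , r)) = z∈ , inj₂ (z∉ , j , m<n⇒m<1+n j<l , r)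
            off : ∀ {z} → Later l z → x ≢ z × adj G x z ≡ μ x z
            off (z∈ , inj₁ z∈C')              =
              (λ { refl → x∉ z∈C' }) , ¬⋈ (λ x⋈z → min 0 (s≤s z≤n) (_ , z∈C' , x⋈z))
            off (z∈ , inj₂ (z∉ , j , j<l , r)) =
              (λ { refl → min j (m<n⇒m<1+n j<l) r }) , ¬⋈ (λ x⋈z → min (suc j) (s≤s j<l) (_ , z∈ , z∉ , x⋈z , r))
            far : ∀ xs → All (Later l) xs → Far G pairing x (letter x) (map tw xs)
            far []       []       = []
            far (z ∷ xs) (p ∷ ps) = off p ∷ far xs ps

          p∉C' : p ∉ C'
          p∉C' p∈C' = p∉C₁ (C'⊆ p∈C')
          result : Outcome ⊎ TwistedFrom p (λ z → z ∈ D × z ≢ p) (suc i)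
          result with deep-nonempty G M 2≤M _ deep'
          ... | z , z∈ with conn⇒reaches D C' (conn (C₁⊆D (C'⊆ z∈))) z∈
          ... | inj₁ p∈C' = ⊥-elim (p∉C' p∈C')
          ... | inj₂ (l , r) with least (λ l → reaches? D C' l p) l r
          -- `p` misses `C'`, so the shortest path has an intermediate vertex and the result grows
          -- by at least one.
          ... | zero , (y , y∈ , p⋈y) , _ = ⊥-elim (p-off y∈ p⋈y)
          ... | suc l' , r' , min with walk (suc l') p p∈ p∉C' r' min
          ... | inj₁ out = inj₁ out
          ... | inj₂ (xs , twisted , all , le) =
            inj₂ (xs , twisted , All.map not-p all , ≤-trans (s≤s (m≤n+m i l')) le)
            where
            not-p : ∀ {z} → Later (suc l') z → z ∈ D × z ≢ p
            not-p (z∈ , inj₁ z∈C')             = z∈ , λ { refl → p∉C' z∈C' }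
            not-p (z∈ , inj₂ (_ , j , j<l , r)) = z∈ , λ { refl → min j j<l r }

        twisted-outcome : length 𝓛 ≤ u → Deep (suc (suc (dfsDepth t f δ (symLength t u)))) B → Outcome
        twisted-outcome len deep with deep-component B (λ x∈ → x∈) (suc (dfsDepth t f δ (symLength t u))) deep
        ... | C , C⊆ , deep' , conn with deep-nonempty G M 2≤M _ deep'
        ... | p , p∈ with dfs (symLength t u) p C p∈ C⊆ (conn p∈) (λ dep → deep' (depth-without G M 2≤M _ p dep))
        ... | inj₁ out = out
        ... | inj₂ (xs , twisted , all , le) =
          symmetric-minor _≟ₗ_ (_∈ₗ 𝓛) u 𝓛 len G pairing symm (map tw (p ∷ xs)) twisted in-𝓛
            (All.map inj₁ in-𝓛) (≤-trans le (≤-trans (n≤1+n _) (≤-reflexive (cong suc (sym (length-map tw xs))))))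
          where
          in-𝓛 : All (λ (_ , α) → α ∈ₗ 𝓛) (map tw (p ∷ xs))
          in-𝓛 = map⁺ (letter-∈ (C⊆ p∈) ∷ All.map (λ (z∈ , _) → letter-∈ (C⊆ z∈)) all)

      symmetric-outcome : length 𝓛 ≤ u → Deep (symDepth t f u δ) B → Outcome
      symmetric-outcome len deep with all-letters (deep-mono (m≤m+n _ _) deep)
      ... | inj₁ out = out
      ... | inj₂ all = twisted-outcome all len (deep-mono (m≤n+m _ (suc (f δ))) deep)

    -- Induction on the number of letters that may still occur. For an asymmetric pair, either both
    -- letters keep occurring alternately, or one of them is absent from some deep subset and the
    -- shorter list covers that subset.
    letters-outcome : ∀ u δ B 𝓛 → m ≤ δ → B ⊆ B₀ → length 𝓛 ≤ u → (∀ α → Occurs B δ α → α ∈ₗ 𝓛) →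
                      Deep (lettersDepth t f u δ) B → Outcome
    letters-outcome u δ B 𝓛 m≤δ B⊆ len occ deep
      with Any.any? (λ α → Any.any? (λ β → (pairing α β Bool.≟ true) ×-dec (pairing β α Bool.≟ false)) 𝓛) 𝓛
    ... | no ¬bad = Symmetric-case.symmetric-outcome u δ B 𝓛 m≤δ B⊆ occ symm len
                      (deep-mono (symDepth≤lettersDepth t f u δ) deep)
      where
      symm : ∀ {α β} → α ∈ₗ 𝓛 → β ∈ₗ 𝓛 → pairing α β ≡ pairing β α
      symm {α} {β} α∈ β∈ with pairing α β in p | pairing β α in q
      ... | true  | true  = refl
      ... | false | false = refl
      ... | true  | false = ⊥-elim (¬bad (lose α∈ (lose β∈ (p , q))))
      ... | false | true  = ⊥-elim (¬bad (lose β∈ (lose α∈ (q , p))))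
    ... | yes bad with find bad
    ... | α , α∈ , bad-α with find bad-α
    letters-outcome zero    δ B []      _ _ len _ _ | yes bad | α , () , _ | _
    letters-outcome zero    δ B (_ ∷ _) _ _ ()  _ _ | yes bad | α , α∈ , _ | _
    letters-outcome (suc u) δ B 𝓛 m≤δ B⊆ len occ deep | yes bad | α , α∈ , _ | β , β∈ , αβ , βα =
      -- One pair more than `t`, for the pair that `halfgraph-minor` may lose.
      finish (alternate (suc t) B (λ x∈ → x∈) (deep-mono (m≤n+m _ (symDepth t f (suc u) δ)) deep))
      where
      alt : ℕ → ℕ
      alt = altDepth t f (lettersDepth t f u) δ
      alt-≥ : ∀ i → δ ≤ alt i
      alt-≥ = altDepth-≥ t f u δ
      occurrence : ∀ {γ} → γ ∈ₗ 𝓛 → ∀ δ' B' → δ ≤ δ' → B' ⊆ B → Deep (lettersDepth t f u δ') B' →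
                   Outcome ⊎ Occurs B' δ' γ
      occurrence {γ} γ∈ δ' B' δ≤ sub deep' with occurs? B' δ' γ
      ... | yes o = inj₂ o
      ... | no ¬o = inj₁ (letters-outcome u δ' B' (remove _≟ₗ_ γ 𝓛) (≤-trans m≤δ δ≤) (B⊆ ∘ sub) (length-remove _≟ₗ_ γ∈ len)
                            (λ γ' o → ∈-filter⁺ _ (occ γ' (occurs-mono {α = γ'} sub δ≤ o)) (λ { refl → ¬o o })) deep')
      Good : Subset n → Fin n × Fin n → Set
      Good B' (a , b) = (a ∈ B' × e a ≡ proj₂ α) × (b ∈ B' × e b ≡ proj₂ β)
      record Alternation (i : ℕ) (B' : Subset n) : Set where
        field
          pairs : List (Fin n × Fin n)
          -- An innermost vertex with the vector of `β`. Every earlier vertex is linear on a set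
          -- containing it, so its adjacencies are those required of `v` in `halfgraph-minor`.
          last  : Fin n
          half  : HalfGraph G (pairing α α) (pairing β β) true pairs
          good  : All (Good B') pairs
          last∈ : last ∈ B' × e last ≡ proj₂ β
          ends  : All (λ (a , b) → adj G last a ≡ true × adj G last b ≡ pairing β β) pairs
          size  : length pairs ≡ i
      row : ∀ {x C} → ∀ γ γ' → Linear G ws (proj₁ γ) x C → ∀ {y c} → y ∈ C → e y ≡ proj₂ γ' → pairing γ γ' ≡ c → adj G x y ≡ c
      row γ γ' lin {y} y∈ ey eq = trans (lin y y∈) (trans (cong (dot (proj₁ γ)) ey) eq)
      -- `x` is linear on `B₁`, and `z` in `B₁` is linear on `B₂` inside `B₁`; later choices are
      -- made in `B₂`, so their adjacencies to both are pairings of letters.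
      alternate : ∀ i B' → B' ⊆ B → Deep (alt i) B' → Outcome ⊎ Alternation i B'
      alternate zero B' sub deep' with occurrence β∈ δ B' ≤-refl sub deep'
      ... | inj₁ out = inj₁ out
      ... | inj₂ (v , v∈ , ev , _) = inj₂ record
        { pairs = [] ; last = v ; half = tt ; good = [] ; last∈ = v∈ , ev ; ends = [] ; size = refl }
      alternate (suc i) B' sub deep'
        with occurrence α∈ _ B' (≤-trans (alt-≥ i) (lettersDepth-≥ t f u (alt i))) sub deep'
      ... | inj₁ out = inj₁ out
      ... | inj₂ (x , x∈ , ex , B₁ , B₁⊆ , x∉ , deep₁ , lin-x)
          with occurrence β∈ (alt i) B₁ (alt-≥ i) (sub ∘ B₁⊆) deep₁
      ... | inj₁ out = inj₁ out
      ... | inj₂ (z , z∈ , ez , B₂ , B₂⊆ , z∉ , deep₂ , lin-z) with alternate i B₂ (sub ∘ B₁⊆ ∘ B₂⊆) deep₂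
      ... | inj₁ out = inj₁ out
      ... | inj₂ r = inj₂ record
        { pairs = (x , z) ∷ pairs ; last = last
        ; half = ((λ { refl → x∉ z∈ }) , row α β lin-x z∈ ez αβ) ,
                 All.map (λ ((a∈ , ea) , (b∈ , eb)) → pairRel
                   (λ { refl → x∉ (B₂⊆ a∈) }) (λ { refl → x∉ (B₂⊆ b∈) }) (λ { refl → z∉ a∈ }) (λ { refl → z∉ b∈ })
                   (row α α lin-x (B₂⊆ a∈) ea refl) (row α β lin-x (B₂⊆ b∈) eb αβ)
                   (row β α lin-z a∈ ea βα) (row β β lin-z b∈ eb refl)) good , half
        ; good = ((x∈ , ex) , (B₁⊆ z∈ , ez)) ∷ All.map (λ ((a∈ , ea) , (b∈ , eb)) → (B₁⊆ (B₂⊆ a∈) , ea) , (B₁⊆ (B₂⊆ b∈) , eb)) good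
        ; last∈ = B₁⊆ (B₂⊆ (proj₁ last∈)) , proj₂ last∈
        ; ends = (trans (Graph.sym G last x) (row α β lin-x (B₂⊆ (proj₁ last∈)) (proj₂ last∈) αβ) ,
                  trans (Graph.sym G last z) (row β β lin-z (proj₁ last∈) (proj₂ last∈) refl)) ∷ ends
        ; size = cong suc size }
        where open Alternation r
      finish : Outcome ⊎ Alternation (suc t) B → Outcome
      finish (inj₁ out) = out
      finish (inj₂ r)   =
        halfgraph-minor G (pairing α α) (pairing β β) last pairs half ends 1≤t (≤-reflexive (sym size))
        where open Alternation r

    level-outcome : Deep (lettersDepth t f (length (letters k)) m) B₀ → Outcome
    level-outcome = letters-outcome (length (letters k)) m B₀ (letters k) ≤-refl (λ x∈ → x∈) ≤-refl (λ α _ → ∈-letters α)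

  labelBound : ℕ → ℕ
  labelBound q = 4 * 2 ^ suc (q + q)

  module _ (t q : ℕ) (1≤t : 1 ≤ t) {m : ℕ} (G : Graph n) (T : Graph m) (L : Fin n → Fin m)
    (dec : IsRankDecomp≤ G T L q) where

    private
      2^≤M : ∀ {k} → k ≤ suc (q + q) → 2 ^ k ≤ labelBound q
      2^≤M le = ≤-trans (^-monoʳ-≤ 2 le) (m≤m+n _ _)

      2≤M : 2 ≤ labelBound q
      2≤M = 2^≤M {1} (s≤s z≤n)

      4*2^q≤M : 4 * 2 ^ q ≤ labelBound q
      4*2^q≤M = *-monoʳ-≤ 4 (^-monoʳ-≤ 2 (≤-trans (m≤m+n q q) (n≤1+n _)))

    -- The statement for `k + 1` rows is passed to `Level` as `next`, with its threshold as `f`. At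
    -- `2q + 1` rows `robust-bound` gives the contradiction.
    rank-outcome : ∀ j k → j + k ≡ suc (q + q) → (ws : Vec (Fin n) k) (B : Subset n) (d : ℕ) →
                   Robust G (labelBound q) ws B d → ¬ Depth≤ G (labelBound q) (rankDepth t j k d) B → VertexMinor (Path t) G
    rank-outcome zero    k refl ws B d rob deep =
      ⊥-elim (1+n≰n (robust-bound G T L q dec (labelBound q) 2≤M 4*2^q≤M ws B d rob deep))
    rank-outcome (suc j) k eq   ws B d rob deep =
      Level.level-outcome t 1≤t G (labelBound q) 2≤M k (2^≤M (≤-trans (m≤n+m k (suc j)) (≤-reflexive eq))) ws
        (rankDepth t j (suc k)) (λ p → rank-outcome j (suc k) (trans (+-suc j k) eq) (p ∷ ws)) B d rob deep

-- Trees given by levels and parents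

module LevelTree where

  open import Defs hiding (sym)
  open FiniteSets
  open import Data.Nat using (ℕ; zero; suc; _+_; _≤_; z≤n; s≤s)
  open import Data.Nat.Properties using (≤-refl; ≤-trans; ≤-total; 1+n≰n; suc-injective; m<n⇒m<1+n; <⇒≢; n<1+n)
  open import Data.Bool using (_∨_)
  open import Data.Bool.Properties using (∨-comm)
  open import Data.Fin using (Fin; zero; suc; toℕ; inject₁; fromℕ)
  open import Data.Fin.Properties using (toℕ-inject₁)
  open import Data.Fin.Relation.Unary.Top using (view; ‵fromℕ; ‵inject₁)
  open import Data.Fin.Subset using (Subset; _∈_; ∣_∣; ⁅_⁆)
  open import Data.Fin.Subset.Properties using (x∈⁅x⁆; x∈⁅y⁆⇒x≡y; ∣⁅x⁆∣≡1; ⊆-antisym; p⊂q⇒∣p∣<∣q∣)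
  open import Data.Vec using (tabulate)
  open import Data.Vec.Properties using (lookup∘tabulate; lookup⇒[]=; []=⇒lookup)
  open import Data.Product using (∃-syntax; _×_; _,_)
  open import Data.Sum using (_⊎_; inj₁; inj₂)
  open import Data.Empty using (⊥-elim)
  open import Function using (_∘_)
  open import Relation.Nullary using (¬_; Dec; yes; no; does)
  open import Relation.Nullary.Decidable using (dec-true; dec-false)
  open import Relation.Binary.PropositionalEquality using (_≡_; _≢_; refl; sym; trans; cong; cong₂; subst)

  argmax : ∀ {k} (f : Fin (suc k) → ℕ) → ∃[ i ] (∀ j → f j ≤ f i)
  argmax {zero}  f = zero , λ { zero → ≤-refl }
  argmax {suc k} f with argmax (f ∘ suc)
  ... | i , max with ≤-total (f zero) (f (suc i))
  ... | inj₁ le = suc i , λ { zero → le ; (suc j) → max j }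
  ... | inj₂ ge = zero , λ { zero → ≤-refl ; (suc j) → ≤-trans (max j) ge }

  card-one : ∀ {m} {S : Subset m} {x} → x ∈ S → (∀ {y} → y ∈ S → y ≡ x) → ∣ S ∣ ≡ 1
  card-one {S = S} {x} x∈ only = trans (cong ∣_∣ (⊆-antisym {i = S} {j = ⁅ x ⁆}
    (λ y∈ → subst (_∈ ⁅ x ⁆) (sym (only y∈)) (x∈⁅x⁆ x))
    (λ y∈ → subst (_∈ S) (sym (x∈⁅y⁆⇒x≡y x y∈)) x∈))) (∣⁅x⁆∣≡1 x)

  card-one-unique : ∀ {m} {S : Subset m} {x y} → ∣ S ∣ ≡ 1 → x ∈ S → y ∈ S → x ≢ y → ∀ {A : Set} → A
  card-one-unique {S = S} {x} {y} eq x∈ y∈ x≢y =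
    ⊥-elim (1+n≰n (subst (_≤ 1) (cong suc (∣⁅x⁆∣≡1 x)) (subst (suc ∣ ⁅ x ⁆ ∣ ≤_) eq (p⊂q⇒∣p∣<∣q∣ {p = ⁅ x ⁆} {S}
      ((λ z∈ → subst (_∈ S) (sym (x∈⁅y⁆⇒x≡y x z∈)) x∈) , y , y∈ , λ y∈x → x≢y (sym (x∈⁅y⁆⇒x≡y x y∈x)))))))

  module FromLevels {m : ℕ} (level : Fin m → ℕ) (Child : Fin m → Fin m → Set) (child? : ∀ u v → Dec (Child u v))
    (child-level : ∀ {u v} → Child u v → level v ≡ suc (level u))
    (parent-unique : ∀ {u u' v} → Child u v → Child u' v → u ≡ u')
    (root : Fin m) (parent : ∀ v → v ≡ root ⊎ ∃[ u ] Child u v) (root-level : level root ≡ 0) where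

    private
      no-loop : ∀ {u} → ¬ Child u u
      no-loop c = <⇒≢ (n<1+n _) (child-level c)

    abstract

      levelTree : Graph m
      levelTree = record
        { adj    = λ u v → does (child? u v) ∨ does (child? v u)
        ; sym    = λ u v → ∨-comm (does (child? u v)) (does (child? v u))
        ; irrefl = λ u → cong₂ _∨_ (dec-false (child? u u) no-loop) (dec-false (child? u u) no-loop) }

      child⇒edge : ∀ {u v} → Child u v → Edge levelTree u v
      child⇒edge {u} {v} c = cong (_∨ does (child? v u)) (dec-true (child? u v) c)

      edge-flip : ∀ {u v} → Edge levelTree u v → Edge levelTree v u
      edge-flip {u} {v} e = trans (∨-comm (does (child? v u)) (does (child? u v))) e

      edge⇒child : ∀ {u v} → Edge levelTree u v → Child u v ⊎ Child v u
      edge⇒child {u} {v} e with child? u v | child? v u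
      ... | yes c | _     = inj₁ c
      ... | no _  | yes c = inj₂ c
      edge⇒child () | no _ | no _

    walk-snoc : ∀ {a b c l} → WalkLen (Edge levelTree) a b l → Edge levelTree b c → WalkLen (Edge levelTree) a c (suc l)
    walk-snoc here       e = step e here
    walk-snoc (step d w) e = step d (walk-snoc w e)

    from-root : ∀ l v → level v ≡ l → WalkLen (Edge levelTree) root v l
    from-root l v eq with parent v
    from-root l       v eq | inj₁ refl    = subst (WalkLen (Edge levelTree) root root) (trans (sym root-level) eq) here
    from-root zero    v eq | inj₂ (u , c) with trans (sym (child-level c)) eq
    ... | ()
    from-root (suc l) v eq | inj₂ (u , c) =
      walk-snoc (from-root l u (suc-injective (trans (sym (child-level c)) eq))) (child⇒edge c)

    private
      reverse : ∀ {a b} → Conn (Edge levelTree) a b → Conn (Edge levelTree) b a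
      reverse = conn-sym edge-flip

      cycle-neighbours : ∀ k (c : Fin (3 + k) → Fin m) →
        (∀ (i : Fin (suc (suc k))) → Edge levelTree (c (inject₁ i)) (c (suc i))) →
        Edge levelTree (c (fromℕ (suc (suc k)))) (c zero) →
        ∀ i → ∃[ p ] ∃[ r ] (p ≢ r × Edge levelTree (c i) (c p) × Edge levelTree (c i) (c r))
      cycle-neighbours k c es last zero =
        suc zero , fromℕ (suc (suc k)) , (λ ()) , es zero , edge-flip last
      cycle-neighbours k c es last (suc j) with view j
      ... | ‵fromℕ =
        inject₁ (fromℕ (suc k)) , zero , (λ ()) , edge-flip (es (fromℕ (suc k))) , last
      ... | ‵inject₁ j' =
        inject₁ (inject₁ j') , suc (suc j') , ne , edge-flip (es (inject₁ j')) , es (suc j')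
        where
        ne : inject₁ (inject₁ j') ≢ suc (suc j')
        ne eq = <⇒≢ (m<n⇒m<1+n (n<1+n (toℕ j')))
          (trans (sym (trans (toℕ-inject₁ (inject₁ j')) (toℕ-inject₁ j'))) (cong toℕ eq))

    -- Both neighbours of a vertex of highest level on a cycle would be its parent.
    acyclic : ¬ HasCycle levelTree
    acyclic (k , c , inj , es , last) with argmax (level ∘ c)
    ... | i , max with cycle-neighbours k c es last i
    ... | p , r , p≢r , ip , ir = p≢r (inj (parent-unique (is-parent ip) (is-parent ir)))
      where
      is-parent : ∀ {j} → Edge levelTree (c i) (c j) → Child (c j) (c i)
      is-parent {j} e with edge⇒child e
      ... | inj₂ ch = ch
      ... | inj₁ ch = ⊥-elim (1+n≰n (subst (_≤ level (c i)) (child-level ch) (max j)))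

    levelTree-isTree : IsTree levelTree
    levelTree-isTree = 1≤ root ,
      (λ a b → conn-trans (reverse (_ , from-root _ a refl)) (_ , from-root _ b refl)) , acyclic
      where
      1≤ : ∀ {m} → Fin m → 1 ≤ m
      1≤ {suc m} _ = s≤s z≤n

    ∈-neighbours⁺ : ∀ {u v} → Edge levelTree u v → v ∈ tabulate (adj levelTree u)
    ∈-neighbours⁺ {u} {v} e = lookup⇒[]= v _ (trans (lookup∘tabulate (adj levelTree u) v) e)

    ∈-neighbours⁻ : ∀ {u v} → v ∈ tabulate (adj levelTree u) → Edge levelTree u v
    ∈-neighbours⁻ {u} {v} v∈ = trans (sym (lookup∘tabulate (adj levelTree u) v)) ([]=⇒lookup v∈)

    childless⇒leaf : ∀ {u v} → Child u v → (∀ w → ¬ Child v w) → IsLeaf levelTree v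
    childless⇒leaf {u} {v} c none = card-one {x = u} (∈-neighbours⁺ (edge-flip (child⇒edge c))) only
      where
      only : ∀ {w} → w ∈ tabulate (adj levelTree v) → w ≡ u
      only {w} w∈ with edge⇒child (∈-neighbours⁻ w∈)
      ... | inj₁ c' = ⊥-elim (none w c')
      ... | inj₂ c' = parent-unique c' c

    two-neighbours⇒¬leaf : ∀ {u v w} → Edge levelTree u v → Edge levelTree u w → v ≢ w → ¬ IsLeaf levelTree u
    two-neighbours⇒¬leaf e e' ne leaf = card-one-unique leaf (∈-neighbours⁺ e) (∈-neighbours⁺ e') ne

-- Shallow vertex sets give rank-depth decompositions

module DepthDecomposition where

  open import Defs hiding (sym)
  open FiniteSets
  open CutRank
  open Depth
  open LevelTree
  import Data.Nat as ℕ
  open import Data.Nat using (ℕ; zero; suc; _+_; _*_; _^_; _≤_; _<_; z≤n; s≤s)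
  open import Data.Nat.Properties using (≤-refl; ≤-trans; ≤-pred; n≤1+n; m≤m+n; m≤n+m; m≤n⇒m≤1+n; m<n⇒m<1+n; allUpTo?; m≤n⇒m<n∨m≡n; 1+n≰n; suc-injective; <⇒≢; n<1+n; +-suc; +-identityʳ; m≤n⇒∃[o]m+o≡n)
  open import Data.Bool using (Bool; true; false; _∧_; _xor_)
  open import Data.Bool.Properties using (xor-same)
  open import Data.Fin using (Fin; zero; suc; _≟_; toℕ; fromℕ<; combine; remQuot; join; splitAt)
  open import Data.Fin.Properties using (any?; combine-injective; toℕ<n; toℕ-fromℕ<; toℕ-injective; remQuot-combine; combine-remQuot; splitAt-join)
  open import Data.Fin.Subset using (Subset; _∈_; _∉_; _⊆_; ∣_∣; ⊤; ∁; ⁅_⁆)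
  open import Data.Fin.Subset.Properties using (_∈?_; ∈⊤; x∈⁅x⁆; x∈⁅y⁆⇒x≡y; x∉p⇒x∈∁p; x∈∁p⇒x∉p)
  open import Data.Vec using (Vec; lookup; tabulate; _[_]≔_)
  open import Data.Vec.Properties using (lookup∘tabulate; lookup⇒[]=; []≔-updates; lookup∘update; []≔-idempotent; []≔-lookup)
  open import Data.Product using (Σ; ∃-syntax; _×_; _,_; proj₁; proj₂)
  open import Data.Sum using (_⊎_; inj₁; inj₂)
  open import Data.Sum.Properties using (inj₁-injective; inj₂-injective)
  open import Data.Empty using (⊥-elim)
  open import Function using (_∘_)
  open import Relation.Nullary using (¬_; Dec; yes; no; ¬?; _×-dec_)
  open import Relation.Nullary.Decidable using (map′)
  open import Relation.Binary.PropositionalEquality using (_≡_; _≢_; refl; sym; trans; cong; cong₂; subst)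

  private
    variable
      n : ℕ

  -- Row types

  RowTypes : Graph n → ℕ → (P Q : Fin n → Set) → Set
  RowTypes {n} G c P Q = Σ (Fin n → Fin c) λ ℓ →
    ∀ x x' → P x → P x' → ℓ x ≡ ℓ x' → ∀ y → Q y → adj G x y ≡ adj G x' y

  module _ (G : Graph n) where

    types-restrict : ∀ {c} {P P' Q Q' : Fin n → Set} → (∀ {x} → P' x → P x) → (∀ {y} → Q' y → Q y) →
                     RowTypes G c P Q → RowTypes G c P' Q'
    types-restrict f g (ℓ , same) = ℓ , λ x x' px px' eq y qy → same x x' (f px) (f px') eq y (g qy)

    types-columns : ∀ {a b} {P Q Q' : Fin n → Set} → RowTypes G a P Q → RowTypes G b P Q' →
                    RowTypes G (a * b) P (λ y → Q y ⊎ Q' y)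
    types-columns {a} {b} {P} {Q} {Q'} (ℓ , same) (ℓ' , same') = (λ x → combine (ℓ x) (ℓ' x)) , both
      where
      both : ∀ x x' → P x → P x' → combine (ℓ x) (ℓ' x) ≡ combine (ℓ x') (ℓ' x') →
             ∀ y → Q y ⊎ Q' y → adj G x y ≡ adj G x' y
      both x x' px px' eq y q with combine-injective (ℓ x) (ℓ' x) (ℓ x') (ℓ' x') eq
      both x x' px px' eq y (inj₁ q) | e , e' = same x x' px px' e y q
      both x x' px px' eq y (inj₂ q) | e , e' = same' x x' px px' e' y q

    types-rows : ∀ {a b} {P P' Q : Fin n → Set} → (∀ x → Dec (P x)) → RowTypes G a P Q → RowTypes G b P' Q →
                 RowTypes G (a + b) (λ x → P x ⊎ P' x) Q
    types-rows {a} {b} {P} {P'} {Q} P? (ℓ , same) (ℓ' , same') = join a b ∘ pick , both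
      where
      pick : Fin n → Fin a ⊎ Fin b
      pick x with P? x
      ... | yes _ = inj₁ (ℓ x)
      ... | no _  = inj₂ (ℓ' x)
      second : ∀ {x} → ¬ P x → P x ⊎ P' x → P' x
      second ¬p (inj₁ p)  = ⊥-elim (¬p p)
      second ¬p (inj₂ p') = p'
      cases : ∀ x x' → P x ⊎ P' x → P x' ⊎ P' x' → pick x ≡ pick x' → ∀ y → Q y → adj G x y ≡ adj G x' y
      cases x x' px px' eq y q with P? x | P? x'
      ... | yes p | yes p' = same x x' p p' (inj₁-injective eq) y q
      ... | no p  | no p'  = same' x x' (second p px) (second p' px') (inj₂-injective eq) y q
      cases x x' px px' () y q | yes _ | no _
      cases x x' px px' () y q | no _  | yes _
      both : ∀ x x' → P x ⊎ P' x → P x' ⊎ P' x' → join a b (pick x) ≡ join a b (pick x') → ∀ y → Q y → adj G x y ≡ adj G x' y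
      both x x' px px' eq = cases x x' px px'
        (trans (sym (splitAt-join a b (pick x))) (trans (cong (splitAt a) eq) (splitAt-join a b (pick x'))))

    dot-pair : ∀ {k} (x y : Fin k) (v : Vec Bool k) → x ≢ y → dot (⁅ x ⁆ [ y ]≔ true) v ≡ lookup v y xor lookup v x
    dot-pair x y v x≢y = trans (dot-remove (⁅ x ⁆ [ y ]≔ true) v y) (cong₂ (λ b u → (b ∧ lookup v y) xor u)
      (lookup∘update y ⁅ x ⁆ true) (trans (cong (λ S → dot S v) restore) (dot-⁅⁆ x v)))
      where
      y∉ : lookup ⁅ x ⁆ y ≡ false
      y∉ with lookup ⁅ x ⁆ y in eq
      ... | false = refl
      ... | true  = ⊥-elim (x≢y (sym (x∈⁅y⁆⇒x≡y x (lookup⇒[]= y ⁅ x ⁆ eq))))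
      restore : (⁅ x ⁆ [ y ]≔ true) [ y ]≔ false ≡ ⁅ x ⁆
      restore = trans ([]≔-idempotent ⁅ x ⁆ y) (trans (cong (⁅ x ⁆ [ y ]≔_) (sym y∉)) ([]≔-lookup ⁅ x ⁆ y))

    -- Two rows of the same type sum to zero, so independent rows have distinct types.
    types⇒rank : ∀ {c} (X : Subset n) → RowTypes G c (_∈ X) (_∉ X) → CutRank≤ G X c
    types⇒rank X (ℓ , same) R R⊆ ind = card≤ R ℓ inj
      where
      inj : ∀ x y → x ∈ R → y ∈ R → ℓ x ≡ ℓ y → x ≡ y
      inj x y x∈ y∈ eq with x ≟ y
      ... | yes x≡y = x≡y
      ... | no x≢y with ind (⁅ x ⁆ [ y ]≔ true) pair⊆ (y , []≔-updates ⁅ x ⁆ y)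
        where
        pair⊆ : ⁅ x ⁆ [ y ]≔ true ⊆ R
        pair⊆ z∈ with ∈-insert⁻ ⁅ x ⁆ z∈
        ... | inj₁ refl = y∈
        ... | inj₂ z∈x  = subst (_∈ R) (sym (x∈⁅y⁆⇒x≡y x z∈x)) x∈
      ... | z , z∉ , sum with trans (sym sum) (trans (dot-foldr (⁅ x ⁆ [ y ]≔ true) _)
              (trans (dot-pair x y (tabulate (λ w → adj G w z)) x≢y)
                (trans (cong₂ _xor_ (lookup∘tabulate (λ w → adj G w z) y)
                         (trans (lookup∘tabulate (λ w → adj G w z) x) (same x y (R⊆ x∈) (R⊆ y∈) eq z z∉)))
                  (xor-same (adj G y z)))))
      ... | ()

  -- Addresses of the leaves

  module _ {A : Set} (label : ℕ → Fin n → A) where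

    Agree : ℕ → Fin n → Fin n → Set
    Agree j x y = ∀ i → i < j → label i x ≡ label i y

    agree-suc : ∀ {j x y} → Agree j x y → label j x ≡ label j y → Agree (suc j) x y
    agree-suc {j} ag eq i i<1+j with m≤n⇒m<n∨m≡n (≤-pred i<1+j)
    ... | inj₁ i<j  = ag i i<j
    ... | inj₂ refl = eq

    agree-pred : ∀ {j x y} → Agree (suc j) x y → Agree j x y
    agree-pred ag i i<j = ag i (m<n⇒m<1+n i<j)

    agree-sym : ∀ {j x y} → Agree j x y → Agree j y x
    agree-sym ag i i<j = sym (ag i i<j)

    agree-trans : ∀ {j x y z} → Agree j x y → Agree j y z → Agree j x z
    agree-trans ag ag' i i<j = trans (ag i i<j) (ag' i i<j)

  -- The nested labellings of `Depth≤` flattened: `label j x` is the child taken at depth `j`, and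
  -- the tree nodes of level `j` are the classes of `Agree label j`.
  record Addresses (G : Graph n) (M d : ℕ) (B : Subset n) : Set where
    field
      label    : ℕ → Fin n → Fin (4 + n)
      distinct : ∀ {x y} → x ∈ B → y ∈ B → Agree label d x y → x ≡ y
      types    : ∀ j → j < d → ∀ x₀ → x₀ ∈ B → ∀ U →
                 RowTypes G M (λ x → x ∈ B × Agree label j x₀ x × label j x ∈ U)
                              (λ y → y ∈ B × Agree label j x₀ y × label j y ∉ U)

  addresses : (G : Graph n) (M : ℕ) (d : ℕ) (B : Subset n) → Depth≤ G M d B → Addresses G M d B
  addresses G M zero B dep = record
    { label = λ _ _ → zero ; distinct = λ x∈ y∈ _ → dep _ _ x∈ y∈ ; types = λ _ () }
  addresses {n} G M (suc d) B (c , sep , classes) = record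
    { label = label ; distinct = distinct ; types = types }
    where
    sub : ∀ i → Addresses G M d (fiber (lookup c) B i)
    sub i = addresses G M d (fiber (lookup c) B i) (classes i)
    open Addresses using () renaming (label to lab)
    label : ℕ → Fin n → Fin (4 + n)
    label zero    x = lookup c x
    label (suc i) x = lab (sub (lookup c x)) i x
    below : ∀ {j x y k} → lookup c x ≡ k → Agree label (suc j) x y → Agree (lab (sub k)) j x y
    below {x = x} {y} refl ag i i<j =
      trans (ag (suc i) (s≤s i<j)) (cong (λ k → lab (sub k) i y) (sym (ag 0 (s≤s z≤n))))
    distinct : ∀ {x y} → x ∈ B → y ∈ B → Agree label (suc d) x y → x ≡ y
    distinct {x} {y} x∈ y∈ ag = Addresses.distinct (sub (lookup c x)) (∈-fiber⁺ (lookup c) x∈ refl)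
      (∈-fiber⁺ (lookup c) y∈ (sym (ag 0 (s≤s z≤n)))) (below refl ag)
    types : ∀ j → j < suc d → ∀ x₀ → x₀ ∈ B → ∀ U →
            RowTypes G M (λ x → x ∈ B × Agree label j x₀ x × label j x ∈ U)
                         (λ y → y ∈ B × Agree label j x₀ y × label j y ∉ U)
    types zero _ x₀ x₀∈ U = lookup (proj₁ (sep U)) ,
      λ x x' (x∈ , _ , xU) (x'∈ , _ , x'U) eq y (y∈ , _ , yU) → proj₂ (sep U) x x' y x∈ x'∈ y∈ xU x'U yU eq
    types (suc j) (s≤s j<d) x₀ x₀∈ U = types-restrict G conv conv'
      (Addresses.types (sub i₀) j j<d x₀ (∈-fiber⁺ (lookup c) x₀∈ refl) U)
      where
      i₀ = lookup c x₀
      same-label : ∀ {x} → lookup c x ≡ i₀ → label (suc j) x ≡ lab (sub i₀) j x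
      same-label {x} eq = cong (λ k → lab (sub k) j x) eq
      conv : ∀ {x} → x ∈ B × Agree label (suc j) x₀ x × label (suc j) x ∈ U →
             x ∈ fiber (lookup c) B i₀ × Agree (lab (sub i₀)) j x₀ x × lab (sub i₀) j x ∈ U
      conv (x∈ , ag , xU) = ∈-fiber⁺ (lookup c) x∈ (sym (ag 0 (s≤s z≤n))) , below refl ag ,
        subst (_∈ U) (same-label (sym (ag 0 (s≤s z≤n)))) xU
      conv' : ∀ {x} → x ∈ B × Agree label (suc j) x₀ x × label (suc j) x ∉ U →
              x ∈ fiber (lookup c) B i₀ × Agree (lab (sub i₀)) j x₀ x × lab (sub i₀) j x ∉ U
      conv' (x∈ , ag , xU) = ∈-fiber⁺ (lookup c) x∈ (sym (ag 0 (s≤s z≤n))) , below refl ag ,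
        xU ∘ subst (_∈ U) (sym (same-label (sym (ag 0 (s≤s z≤n)))))

  -- Row types of the outside of a node of level `j` towards its inside. The start is one because
  -- labels need a nonempty type.
  inBound : ℕ → ℕ → ℕ
  inBound M zero    = 1
  inBound M (suc j) = M + inBound M j

  -- A sum over levels `j`: `M ^ suc j` for unions of child classes, `M + inBound M j` for unions
  -- that contain the outside of the node.
  nodeWidth : ℕ → ℕ → ℕ
  nodeWidth M zero    = 0
  nodeWidth M (suc d) = nodeWidth M d + (M ^ suc d + (M + inBound M d))

  nodeWidth-≥ : ∀ M d j → j < d → M ^ suc j + (M + inBound M j) ≤ nodeWidth M d
  nodeWidth-≥ M (suc d) j (s≤s j≤d) with m≤n⇒m<n∨m≡n j≤d
  ... | inj₁ j<d  = ≤-trans (nodeWidth-≥ M d j j<d) (m≤m+n _ _)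
  ... | inj₂ refl = m≤n+m _ (nodeWidth M d)

  -- The tree of address prefixes. A prefix of length j is represented by the vertex that represents, among all vertices with
  -- this prefix, its class.
  module Trie (G : Graph n) (M d : ℕ) (addr : Addresses G M (suc d) ⊤)
    (a b : Fin n) (branching : Addresses.label addr 0 a ≢ Addresses.label addr 0 b) where

    open Addresses addr

    D : ℕ
    D = suc d

    Agr : ℕ → Fin n → Fin n → Set
    Agr = Agree label

    agree? : ∀ j x y → Dec (Agr j x y)
    agree? j x y = map′ (λ f i → f {i}) (λ ag {i} → ag i) (allUpTo? (λ i → label i x ≟ label i y) j)

    private
      classes : ∀ j → Components (Agr j)
      classes j = components (agree? j) (λ ag → agree-sym label ag)

    abstract

      rep : ℕ → Fin n → Fin n
      rep j = Components.comp (classes j)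

      rep-cong : ∀ {j x y} → Agr j x y → rep j x ≡ rep j y
      rep-cong {j} = Components.comp-edge (classes j)

      rep-agree : ∀ j x → Agr j x (rep j x)
      rep-agree j x = conn⇒agree (Components.comp-conn (classes j) x)
        where
        conn⇒agree : ∀ {x y} → Conn (Agr j) x y → Agr j x y
        conn⇒agree (_ , here) _ _ = refl
        conn⇒agree (_ , step e w) i i<j = trans (e i i<j) (conn⇒agree (_ , w) i i<j)

      rep-injective : ∀ {j x y} → rep j x ≡ rep j y → Agr j x y
      rep-injective {j} {x} {y} eq = agree-trans label (rep-agree j x)
        (subst (λ z → Agr j z y) (sym eq) (agree-sym label (rep-agree j y)))

      rep-rep : ∀ j x → rep j (rep j x) ≡ rep j x
      rep-rep j x = rep-cong (agree-sym label (rep-agree j x))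

    Canonical : Fin (suc D * n) → Set
    Canonical i = rep (toℕ (proj₁ (remQuot {suc D} n i))) (proj₂ (remQuot {suc D} n i)) ≡ proj₂ (remQuot {suc D} n i)

    canonical? : ∀ i → Dec (Canonical i)
    canonical? i = rep (toℕ (proj₁ (remQuot {suc D} n i))) (proj₂ (remQuot {suc D} n i)) ≟ proj₂ (remQuot {suc D} n i)

    abstract

      nodes : Subset (suc D * n)
      nodes = ⟪ canonical? ⟫

      m : ℕ
      m = ∣ nodes ∣

      place : Fin m → Fin (suc D * n)
      place u = at nodes u

      place-canonical : ∀ u → Canonical (place u)
      place-canonical u = ∈⟪⟫⁻ canonical? (at-∈ nodes u)

      place-injective : ∀ {u v} → place u ≡ place v → u ≡ v
      place-injective = at-injective nodes

      place-onto : ∀ {i} → Canonical i → ∃[ u ] place u ≡ i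
      place-onto c = index (∈⟪⟫⁺ canonical? c)

    level : Fin m → ℕ
    level u = toℕ (proj₁ (remQuot {suc D} n (place u)))

    vert : Fin m → Fin n
    vert u = proj₂ (remQuot {suc D} n (place u))

    level≤D : ∀ u → level u ≤ D
    level≤D u = ≤-pred (toℕ<n (proj₁ (remQuot {suc D} n (place u))))

    vert-canonical : ∀ u → rep (level u) (vert u) ≡ vert u
    vert-canonical u = place-canonical u

    node-ext : ∀ {u v} → level u ≡ level v → vert u ≡ vert v → u ≡ v
    node-ext {u} {v} eql eqv = place-injective
      (trans (sym (combine-remQuot {suc D} n (place u)))
        (trans (cong₂ combine (toℕ-injective eql) eqv) (combine-remQuot {suc D} n (place v))))

    abstract

      node-exists : ∀ j → j ≤ D → ∀ x → ∃[ u ] (level u ≡ j × vert u ≡ rep j x)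
      node-exists j j≤ x = u , trans (cong (toℕ ∘ proj₁ ∘ remQuot {suc D} n) at-u) level-i ,
                               trans (cong (proj₂ ∘ remQuot {suc D} n) at-u) vert-i
        where
        i : Fin (suc D * n)
        i = combine (fromℕ< (s≤s j≤)) (rep j x)
        level-i : toℕ (proj₁ (remQuot {suc D} n i)) ≡ j
        level-i = trans (cong (toℕ ∘ proj₁) (remQuot-combine {suc D} (fromℕ< (s≤s j≤)) (rep j x))) (toℕ-fromℕ< (s≤s j≤))
        vert-i : proj₂ (remQuot {suc D} n i) ≡ rep j x
        vert-i = cong proj₂ (remQuot-combine {suc D} (fromℕ< (s≤s j≤)) (rep j x))
        i∈ : Canonical i
        i∈ = trans (cong₂ rep level-i vert-i) (trans (rep-rep j x) (sym vert-i))
        u : Fin m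
        u = proj₁ (place-onto i∈)
        at-u : place u ≡ i
        at-u = proj₂ (place-onto i∈)

    node : ∀ {j} → j ≤ D → Fin n → Fin m
    node {j} j≤ x = proj₁ (node-exists j j≤ x)

    level-node : ∀ {j} (j≤ : j ≤ D) x → level (node j≤ x) ≡ j
    level-node {j} j≤ x = proj₁ (proj₂ (node-exists j j≤ x))

    vert-node : ∀ {j} (j≤ : j ≤ D) x → vert (node j≤ x) ≡ rep j x
    vert-node {j} j≤ x = proj₂ (proj₂ (node-exists j j≤ x))

    node-cong : ∀ {j} (j≤ j≤' : j ≤ D) {x y} → Agr j x y → node j≤ x ≡ node j≤' y
    node-cong j≤ j≤' {x} {y} ag = node-ext (trans (level-node j≤ x) (sym (level-node j≤' y)))
      (trans (vert-node j≤ x) (trans (rep-cong ag) (sym (vert-node j≤' y))))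

    node-injective : ∀ {j} (j≤ j≤' : j ≤ D) {x y} → node j≤ x ≡ node j≤' y → Agr j x y
    node-injective j≤ j≤' {x} {y} eq =
      rep-injective (trans (sym (vert-node j≤ x)) (trans (cong vert eq) (vert-node j≤' y)))

    node-vert : ∀ u → node (level≤D u) (vert u) ≡ u
    node-vert u = node-ext (level-node (level≤D u) (vert u)) (trans (vert-node (level≤D u) (vert u)) (vert-canonical u))

    node-at : ∀ {j} (j≤ : j ≤ D) u → level u ≡ j → node j≤ (vert u) ≡ u
    node-at j≤ u refl = trans (node-cong j≤ (level≤D u) (λ _ _ → refl)) (node-vert u)

    Child : Fin m → Fin m → Set
    Child u v = level v ≡ suc (level u) × vert u ≡ rep (level u) (vert v)

    abstract

      child? : ∀ u v → Dec (Child u v)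
      child? u v = (level v ℕ.≟ suc (level u)) ×-dec (vert u ≟ rep (level u) (vert v))

    child-level : ∀ {u v} → Child u v → level v ≡ suc (level u)
    child-level = proj₁

    parent-unique : ∀ {u u' v} → Child u v → Child u' v → u ≡ u'
    parent-unique {v = v} (l , e) (l' , e') = node-ext eq (trans e (trans (cong (λ j → rep j (vert v)) eq) (sym e')))
      where eq = suc-injective (trans (sym l) l')

    child-node : ∀ {j} (j< : suc j ≤ D) (j≤ : j ≤ D) x → Child (node j≤ x) (node j< x)
    child-node {j} j< j≤ x =
      trans (level-node j< x) (cong suc (sym (level-node j≤ x))) ,
      trans (vert-node j≤ x) (trans (rep-cong (agree-pred label (rep-agree (suc j) x)))
        (cong₂ rep (sym (level-node j≤ x)) (sym (vert-node j< x))))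

    root : Fin m
    root = node z≤n a

    root-level : level root ≡ 0
    root-level = level-node z≤n a

    abstract

      parent : ∀ v → v ≡ root ⊎ ∃[ u ] Child u v
      parent v = by-level (level v) refl
        where
        by-level : ∀ l → level v ≡ l → v ≡ root ⊎ ∃[ u ] Child u v
        by-level zero    eq = inj₁ (trans (sym (node-at z≤n v eq)) (node-cong z≤n z≤n (λ _ ())))
        by-level (suc j) eq = inj₂ (node j≤ (vert v) , subst (Child _) (node-at j< v eq) (child-node j< j≤ (vert v)))
          where
          j< : suc j ≤ D
          j< = subst (_≤ D) eq (level≤D v)
          j≤ : j ≤ D
          j≤ = ≤-trans (n≤1+n j) j<

    open FromLevels level Child child? child-level parent-unique root parent root-level
      renaming (levelTree to tree; levelTree-isTree to isTree; child⇒edge to edge; edge-flip to flip)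

    σ : Fin n → Fin m
    σ = node {D} ≤-refl

    σ-injective : ∀ {x y} → σ x ≡ σ y → x ≡ y
    σ-injective eq = distinct ∈⊤ ∈⊤ (node-injective ≤-refl ≤-refl eq)

    bottom-leaf : ∀ {v} → level v ≡ D → IsLeaf tree v
    bottom-leaf {v} eq = childless⇒leaf
      (subst (Child _) (node-at ≤-refl v eq) (child-node ≤-refl (n≤1+n d) (vert v)))
      (λ w c → 1+n≰n (subst (_≤ D) (trans (child-level {v} {w} c) (cong suc eq)) (level≤D w)))

    -- The root has children towards `a` and `b`; any other inner node has a parent and a child.
    ¬leaf : ∀ {u} → level u < D → ¬ IsLeaf tree u
    ¬leaf {u} l<D = by-level (level u) refl
      where
      by-level : ∀ l → level u ≡ l → ¬ IsLeaf tree u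
      by-level zero eq = two-neighbours⇒¬leaf (to a) (to b) (λ e → branching (node-injective {1} (s≤s z≤n) (s≤s z≤n) e 0 (s≤s z≤n)))
        where
        to : ∀ x → Edge tree u (node {1} (s≤s z≤n) x)
        to x = edge (subst (λ u → Child u (node {1} (s≤s z≤n) x))
          (trans (node-cong z≤n z≤n (λ _ ())) (node-at z≤n u eq)) (child-node (s≤s z≤n) z≤n x))
      by-level (suc j) eq with parent u
      ... | inj₁ refl with trans (sym root-level) eq
      ... | ()
      by-level (suc j) eq | inj₂ (p , c) = two-neighbours⇒¬leaf (flip (edge c)) (edge down) ne
        where
        down : Child u (node l<D (vert u))
        down = subst (λ v → Child v (node l<D (vert u))) (node-vert u) (child-node l<D (level≤D u) (vert u))
        ne : p ≢ node l<D (vert u)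
        ne refl = <⇒≢ (m<n⇒m<1+n (n<1+n _)) (trans (child-level {p} {u} c) (cong suc (child-level {u} {p} down)))

    leafBijection : LeafBijection tree σ
    leafBijection = σ-injective , (λ x → bottom-leaf (level-node ≤-refl x)) , onto
      where
      onto : ∀ u → IsLeaf tree u → ∃[ x ] σ x ≡ u
      onto u leaf with m≤n⇒m<n∨m≡n (level≤D u)
      ... | inj₁ l<D = ⊥-elim (¬leaf l<D leaf)
      ... | inj₂ eq  = vert u , node-at ≤-refl u eq

    radius : Radius≤ tree D
    radius = root , λ u → level u , level≤D u ,
      from-root (level u) u refl

    climb : ∀ v x j k (eq : j + k ≡ D) (j≤ : j ≤ D) → (∀ i (i≤ : i ≤ D) → j ≤ i → node i≤ x ≢ v) →
            Conn (EdgeDelV tree v) (σ x) (node j≤ x)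
    climb v x j zero    eq j≤ off with trans (sym (+-identityʳ j)) eq
    ... | refl = subst (Conn (EdgeDelV tree v) (σ x)) (node-cong ≤-refl j≤ (λ _ _ → refl)) conn-refl
    climb v x j (suc k) eq j≤ off = conn-trans (climb v x (suc j) k eq' j< (λ i i≤ j<i → off i i≤ (≤-trans (n≤1+n j) j<i)))
      (conn-step (flip (edge (child-node j< j≤ x)) , off (suc j) j< (n≤1+n j) , off j j≤ ≤-refl) conn-refl)
      where
      eq' : suc j + k ≡ D
      eq' = trans (sym (+-suc j k)) eq
      j< : suc j ≤ D
      j< = subst (suc j ≤_) eq' (m≤m+n (suc j) k)

    meet : ∀ v {x y} j (j≤ : j ≤ D) → Agr j x y → (∀ i (i≤ : i ≤ D) → j ≤ i → node i≤ x ≢ v) →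
           (∀ i (i≤ : i ≤ D) → j ≤ i → node i≤ y ≢ v) → Conn (EdgeDelV tree v) (σ x) (σ y)
    meet v {x} {y} j j≤ ag offx offy with m≤n⇒∃[o]m+o≡n j≤
    ... | k , eq = conn-trans (climb v x j k eq j≤ offx)
      (subst (λ u → Conn (EdgeDelV tree v) u (σ y)) (sym (node-cong j≤ j≤ ag))
        (conn-sym (λ (e , p , q) → flip e , q , p) (climb v y j k eq j≤ offy)))

    -- A column outside the class leaves the address of `x₀` at some level below `j`. Every level
    -- contributes a factor `M`, with the single label of `x₀` as `U`.
    types-out : ∀ j → j ≤ D → ∀ x₀ → RowTypes G (M ^ j) (Agr j x₀) (λ y → ¬ Agr j x₀ y)
    types-out zero    _  x₀ = (λ _ → zero) , λ x x' _ _ _ y ¬ag → ⊥-elim (¬ag (λ _ ()))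
    types-out (suc j) j< x₀ = types-restrict G (λ ag → ag) split
      (types-columns G
        (types-restrict G (λ ag → ∈⊤ , agree-pred label ag , subst (_∈ ⁅ label j x₀ ⁆) (ag j ≤-refl) (x∈⁅x⁆ (label j x₀)))
                          (λ q → q) (types j j< x₀ ∈⊤ ⁅ label j x₀ ⁆))
        (types-restrict G (agree-pred label) (λ q → q) (types-out j (≤-trans (n≤1+n j) j<) x₀)))
      where
      split : ∀ {y} → ¬ Agr (suc j) x₀ y → (y ∈ ⊤ × Agr j x₀ y × label j y ∉ ⁅ label j x₀ ⁆) ⊎ ¬ Agr j x₀ y
      split {y} ¬ag with agree? j x₀ y
      ... | no ¬ag' = inj₂ ¬ag'
      ... | yes ag  = inj₁ (∈⊤ , ag , λ y∈ → ¬ag (agree-suc label ag (sym (x∈⁅y⁆⇒x≡y _ y∈))))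

    -- Here the rows are split by the level at which they leave, so the types add up; `U` is the
    -- complement of the label of `x₀`.
    types-in : ∀ j → j ≤ D → ∀ x₀ → RowTypes G (inBound M j) (λ x → ¬ Agr j x₀ x) (Agr j x₀)
    types-in zero    _  x₀ = (λ _ → zero) , λ x x' ¬ag _ _ y _ → ⊥-elim (¬ag (λ _ ()))
    types-in (suc j) j< x₀ = types-restrict G split (λ ag → ag)
      (types-rows G P?
        (types-restrict G (λ p → p)
          (λ ag → ∈⊤ , agree-pred label ag , λ y∈ → x∈∁p⇒x∉p y∈ (subst (_∈ ⁅ label j x₀ ⁆) (ag j ≤-refl) (x∈⁅x⁆ (label j x₀))))
          (types j j< x₀ ∈⊤ (∁ ⁅ label j x₀ ⁆)))
        (types-restrict G (λ p → p) (agree-pred label) (types-in j (≤-trans (n≤1+n j) j<) x₀)))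
      where
      P? : ∀ x → Dec (x ∈ ⊤ × Agr j x₀ x × label j x ∈ ∁ ⁅ label j x₀ ⁆)
      P? x = (x ∈? ⊤) ×-dec (agree? j x₀ x) ×-dec (label j x ∈? ∁ ⁅ label j x₀ ⁆)
      split : ∀ {x} → ¬ Agr (suc j) x₀ x → (x ∈ ⊤ × Agr j x₀ x × label j x ∈ ∁ ⁅ label j x₀ ⁆) ⊎ ¬ Agr j x₀ x
      split {x} ¬ag with agree? j x₀ x
      ... | no ¬ag' = inj₂ ¬ag'
      ... | yes ag  = inj₁ (∈⊤ , ag , x∉p⇒x∈∁p (λ x∈ → ¬ag (agree-suc label ag (sym (x∈⁅y⁆⇒x≡y _ x∈)))))

    -- The parts at `v` are its child classes and the outside. If `X` misses the outside, its
    -- columns split into inner and outer ones and types multiply; if `X` contains the outside, all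
    -- columns are inner, the rows split and types add.
    node-width : ∀ v → ¬ IsLeaf tree v → NodeWidth≤ G tree σ v (nodeWidth M D)
    node-width v ¬lf X closed with m≤n⇒m<n∨m≡n (level≤D v)
    ... | inj₂ eq = ⊥-elim (¬lf (bottom-leaf eq))
    ... | inj₁ l<D = cut (any? (λ x → (x ∈? X) ×-dec ¬? (agree? j x₀ x)))
      where
      j : ℕ
      j = level v
      j≤ : j ≤ D
      j≤ = level≤D v
      x₀ : Fin n
      x₀ = vert v
      inside : ∀ {x y} → Agr (suc j) x y → x ∈ X → y ∈ X
      inside {x} {y} ag = closed x y (meet v (suc j) l<D ag (below x) (below y))
        where
        below : ∀ x i (i≤ : i ≤ D) → suc j ≤ i → node i≤ x ≢ v
        below x i i≤ j<i eq = <⇒≢ j<i (trans (sym (cong level eq)) (level-node i≤ x))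
      outside : ∀ {x y} → ¬ Agr j x₀ x → ¬ Agr j x₀ y → x ∈ X → y ∈ X
      outside {x} {y} ¬ax ¬ay = closed x y (meet v 0 z≤n (λ _ ()) (off ¬ax) (off ¬ay))
        where
        off : ∀ {x} → ¬ Agr j x₀ x → ∀ i (i≤ : i ≤ D) → 0 ≤ i → node i≤ x ≢ v
        off {x} ¬ax i i≤ _ eq with trans (sym (level-node i≤ x)) (cong level eq)
        ... | refl = ¬ax (agree-sym label (node-injective i≤ j≤ (trans eq (sym (node-vert v)))))
      met? : ∀ k → Dec (∃[ z ] (z ∈ X × Agr j x₀ z × label j z ≡ k))
      met? k = any? (λ z → (z ∈? X) ×-dec (agree? j x₀ z) ×-dec (label j z ≟ k))
      -- Inside the class of `v`, the set `X` is a union of child classes; these are their labels.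
      U : Subset (4 + n)
      U = ⟪ met? ⟫
      in-U : ∀ {x} → x ∈ X → Agr j x₀ x → label j x ∈ U
      in-U x∈ ag = ∈⟪⟫⁺ met? (_ , x∈ , ag , refl)
      not-in-U : ∀ {y} → y ∉ X → Agr j x₀ y → label j y ∉ U
      not-in-U y∉ ag y∈U with ∈⟪⟫⁻ met? y∈U
      ... | z , z∈ , agz , eq = y∉ (inside (agree-suc label (agree-trans label (agree-sym label agz) ag) eq) z∈)
      local : RowTypes G M (λ x → x ∈ X × Agr j x₀ x) (λ y → y ∉ X × Agr j x₀ y)
      local = types-restrict G (λ (x∈ , ag) → ∈⊤ , ag , in-U x∈ ag) (λ (y∉ , ag) → ∈⊤ , ag , not-in-U y∉ ag)
                (types j l<D x₀ ∈⊤ U)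
      bound : ∀ {c} → c ≤ M ^ suc j + (M + inBound M j) → RowTypes G c (_∈ X) (_∉ X) → CutRank≤ G X (nodeWidth M D)
      bound c≤ ty R R⊆ ind = ≤-trans (types⇒rank G X ty R R⊆ ind) (≤-trans c≤ (nodeWidth-≥ M D j l<D))
      cut : Dec (∃[ x ] (x ∈ X × ¬ Agr j x₀ x)) → CutRank≤ G X (nodeWidth M D)
      cut (no ¬out) = bound (m≤m+n (M ^ suc j) _) (types-restrict G (λ x∈ → x∈ , within x∈) split
        (types-columns G local (types-restrict G proj₂ (λ q → q) (types-out j j≤ x₀))))
        where
        within : ∀ {x} → x ∈ X → Agr j x₀ x
        within {x} x∈ with agree? j x₀ x
        ... | yes ag = ag
        ... | no ¬ag = ⊥-elim (¬out (x , x∈ , ¬ag))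
        split : ∀ {y} → y ∉ X → (y ∉ X × Agr j x₀ y) ⊎ ¬ Agr j x₀ y
        split {y} y∉ with agree? j x₀ y
        ... | yes ag = inj₁ (y∉ , ag)
        ... | no ¬ag = inj₂ ¬ag
      cut (yes (w , w∈ , ¬agw)) = bound (m≤n+m _ (M ^ suc j)) (types-restrict G split (λ y∉ → y∉ , within y∉)
        (types-rows G (λ x → (x ∈? X) ×-dec (agree? j x₀ x)) local (types-restrict G (λ p → p) proj₂ (types-in j j≤ x₀))))
        where
        within : ∀ {y} → y ∉ X → Agr j x₀ y
        within {y} y∉ with agree? j x₀ y
        ... | yes ag = ag
        ... | no ¬ag = ⊥-elim (y∉ (outside ¬agw ¬ag w∈))
        split : ∀ {x} → x ∈ X → (x ∈ X × Agr j x₀ x) ⊎ ¬ Agr j x₀ x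
        split {x} x∈ with agree? j x₀ x
        ... | yes ag = inj₁ (x∈ , ag)
        ... | no ¬ag = inj₂ ¬ag

    decomposition : ∀ k → D ≤ k → nodeWidth M D ≤ k → HasDepthDecomp G k
    decomposition k D≤ w≤ = m , tree , σ , isTree , leafBijection ,
      (λ v ¬lf X closed R R⊆ ind → ≤-trans (node-width v ¬lf X closed R R⊆ ind) w≤) ,
      proj₁ radius , λ u → let l , l≤ , w = proj₂ radius u in l , ≤-trans l≤ D≤ , w

  -- A decomposition whose root has a single child would have the root as an additional leaf, so such roots are skipped.
  branching-root : (G : Graph n) (M : ℕ) (a b : Fin n) → a ≢ b → ∀ d → Depth≤ G M d ⊤ →
                   ∃[ d' ] (suc d' ≤ d × Σ (Depth≤ G M (suc d') ⊤) λ dep →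
                     ∃[ x ] ∃[ y ] lookup (proj₁ dep) x ≢ lookup (proj₁ dep) y)
  branching-root G M a b a≢b zero    dep = ⊥-elim (a≢b (dep a b ∈⊤ ∈⊤))
  branching-root G M a b a≢b (suc d) dep@(c , _ , classes)
    with any? (λ x → any? (λ y → ¬? (lookup c x ≟ lookup c y)))
  ... | yes (x , y , ne) = d , ≤-refl , dep , x , y , ne
  ... | no ¬ne with branching-root G M a b a≢b d (depth-⊆ G M d (λ {x} _ → ∈-fiber⁺ (lookup c) ∈⊤ (same x)) (classes (lookup c a)))
    where
    same : ∀ x → lookup c x ≡ lookup c a
    same x with lookup c x ≟ lookup c a
    ... | yes eq = eq
    ... | no ne  = ⊥-elim (¬ne (x , a , ne))
  ... | d' , le , rest = d' , m≤n⇒m≤1+n le , rest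

  nodeWidth-mono : ∀ M {d d'} → d ≤ d' → nodeWidth M d ≤ nodeWidth M d'
  nodeWidth-mono M {d} {zero}   z≤n = ≤-refl
  nodeWidth-mono M {d} {suc d'} le with m≤n⇒m<n∨m≡n le
  ... | inj₁ (s≤s d≤) = ≤-trans (nodeWidth-mono M d≤) (m≤m+n _ _)
  ... | inj₂ refl     = ≤-refl

  depth⇒decomposition : (G : Graph n) (M d : ℕ) → 2 ≤ n → Depth≤ G M d ⊤ → HasDepthDecomp G (d + nodeWidth M d)
  depth⇒decomposition {suc (suc n)} G M d _ dep with branching-root G M zero (suc zero) (λ ()) d dep
  ... | d' , d'<d , dep' , x , y , ne =
    Trie.decomposition G M d' (addresses G M (suc d') ⊤ dep') x y ne (d + nodeWidth M d)
      (≤-trans d'<d (m≤m+n d _)) (≤-trans (nodeWidth-mono M d'<d) (m≤n+m _ d))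
  depth⇒decomposition {suc zero} G M d (s≤s ()) dep

-- The bound and the theorem

module Bound where

  open import Defs using (Graph; Path; VertexMinor; RankWidth≤; RankDepth≥)
  open Depth
  open DeepSets
  open DepthDecomposition
  open import Data.Nat using (ℕ; suc; _+_; _≤_; s≤s)
  open import Data.Nat.Properties using (≤-refl; +-identityʳ; ≰⇒>; _≤?_)
  open import Data.Fin.Subset using (⊤)
  open import Data.Vec using ([])
  open import Data.Product using (_,_)
  open import Data.Sum using (inj₁; inj₂)
  open import Data.Empty using (⊥-elim)
  open import Relation.Nullary using (yes; no)

  levels : ℕ → ℕ → ℕ
  levels t q = rankDepth t (suc (q + q)) 0 0

  depthBound : ℕ → ℕ → ℕ
  depthBound t q = levels t q + nodeWidth (labelBound q) (levels t q)

  path-minor : ∀ t q → 1 ≤ t → ∀ {n} (G : Graph n) → RankWidth≤ G q → RankDepth≥ G (suc (depthBound t q)) →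
               VertexMinor (Path t) G
  path-minor t q 1≤t {n} G rw rd with 2 ≤? n
  path-minor t q 1≤t {n} G rw rd | no n≱2 = ⊥-elim (rd (depthBound t q) ≤-refl (inj₁ (≰⇒> n≱2)))
  path-minor t q 1≤t G (inj₁ n≤1) rd | yes _ = ⊥-elim (rd (depthBound t q) ≤-refl (inj₁ (s≤s n≤1)))
  path-minor t q 1≤t G (inj₂ (_ , T , L , dec)) rd | yes 2≤n with depth≤? G (labelBound q) (levels t q) ⊤
  ... | yes dep = ⊥-elim (rd (depthBound t q) ≤-refl (inj₂ (depth⇒decomposition G (labelBound q) (levels t q) 2≤n dep)))
  -- The empty family is robust vacuously: no coefficient vector of length zero is nonempty.
  ... | no deep = rank-outcome t q 1≤t G T L dec (suc (q + q)) 0 (+-identityʳ _) [] ⊤ 0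
                    (λ _ _ _ → λ { [] (() , _) }) deep

open import Defs
open import Data.Nat using (ℕ; _≤_)
open import Data.Product using (Σ; ∃-syntax; _×_)

theorem3p3 : ∀ (t q : ℕ) → 1 ≤ t → 1 ≤ q →
    ∃[ F ] (∀ {n} (G : Graph n) → RankWidth≤ G q → RankDepth≥ G F →
    Σ (Graph t) λ H → VertexMinor H G × (H ≅ Path t))
theorem3p3 t q 1≤t 1≤q =
  -- `RankDepth≥ G F` denies only values below `F`; the value to be denied is `depthBound t q`.
  suc (depthBound t q) , λ G rw rd →
    Path t , path-minor t q 1≤t G rw rd , (λ x → x) , (λ x → x) , (λ _ → refl) , (λ _ → refl) , λ _ _ → refl
  where
  open import Data.Nat using (suc)
  open import Data.Product using (_,_)
  open import Relation.Binary.PropositionalEquality using (refl)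
  open Bound
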